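{- Let $A,B$ be distributed unit-free MALL formulas. If there exist cut-free proof-nets $\theta$ with conclusions $A^\perp,B$ and $\psi$ with conclusions $B^\perp,A$ such that the composition of $\theta$ and $\psi$ over $B$ reduces by cut-elimination to the identity proof-net of $A$ and the composition of $\psi$ and $\theta$ over $A$ reduces to the identity proof-net of $B$, then $A=_{\mathcal{AC}}B$.
   Context: Unit-free MALL formulas $A::=X\mid X^\perp\mid A\otimes A\mid A⅋A\mid A\&A\mid A\oplus A$, $(A\otimes B)^\perp=B^\perp⅋A^\perp$, $(A\&B)^\perp=B^\perp\oplus A^\perp$. Distributed: no subformula of the form $A\otimes(B\oplus C)$, $(A\oplus B)\otimes C$, $(C\&B)⅋A$, $C⅋(B\&A)$. $=_{\mathcal{AC}}$: congruence generated by associativity and commutativity of $\otimes,⅋,\&,\oplus$. Proof-nets (Hughes–van Glabbeek): a cut sequent $[\Sigma]\Gamma$ is a list $\Sigma$ of cut pairs $A*A^\perp$ and a sequent $\Gamma$, seen as a forest of syntactic trees with atom occurrences as leaves. Additive resolution: delete zero or more cut pairs and one argument subtree of each $\&$/$\oplus$; $\&$-resolution: delete one argument of each $\&$. Link: pair of leaves labelled $X$, $X^\perp$. Linking: set of disjoint links whose leaves are exactly the leaves of an additive resolution. $\Lambda$ toggles $\&$-vertex $W$ if both premises of $W$ occur in the union of the resolutions of $\Lambda$; link $a$ depends on $W$ in $\Lambda$ if $a\in\lambda\setminus\lambda'$ for some $\lambda,\lambda'\in\Lambda$ with $W$ the only $\&$ toggled by $\{\lambda,\lambda'\}$. $\mathcal{G}_\Lambda$: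 union of the resolutions, the links, and jump edges $l\to W$ for leaves $l$ of links depending on $W$. Switching cycle: cycle using at most one in-edge (premise edge or jump) of each $⅋$/$\&$ vertex; $⅋$-switching of $\lambda$: delete one premise edge of each $⅋$. A proof-net is a set $\theta$ of linkings with (P0) each cut pair has a leaf in some linking, (P1) exactly one linking on each $\&$-resolution, (P2) each $⅋$-switching of each linking is a tree, (P3) each $\Lambda\subseteq\theta$ of size $\ge2$ toggles a $\&$ in no switching cycle of $\mathcal{G}_\Lambda$. Cut-free: $\Sigma=\emptyset$; conclusions $\Gamma$. Composition over $A$: all unions $\lambda\cup\mu$, adding the cut pair $A*A^\perp$. Cut-elimination steps: atomic cut: merge links $(l,A),(A^\perp,m)$ into $(l,m)$; $\otimes/⅋$ cut: split into the two subformula cuts; $\&/\oplus$ cut: split, delete linkings choosing non-dual premises, garbage-collect unused cut pairs. Identity proof-net of $A$: translation of the fully axiom-expanded axiom proof of $\vdash A^\perp,A$ (atomic axiom $\mapsto\{\{(X,X^\perp)\}\}$; $⅋,\oplus_i$ keep the set; $\otimes$ takes pairwise unions; $\&$ takes union of sets). -}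

module Defs where

open import Data.Nat using (ℕ; zero; suc; _<_; _≟_)
open import Data.List using (List; []; _∷_; _++_; _∷ʳ_; map; concatMap; length; lookup)
open import Data.List.Membership.Propositional using (_∈_; _∉_)
open import Data.List.Relation.Unary.Unique.Propositional using (Unique)
open import Data.List.Relation.Binary.Pointwise using (Pointwise)
open import Data.List.Relation.Binary.Permutation.Propositional using (_↭_)
open import Relation.Binary.Construct.Closure.ReflexiveTransitive using (Star)
open import Data.Product using (Σ; ∃; ∃-syntax; _×_; _,_; proj₁; proj₂)
open import Data.Sum using (_⊎_)
open import Data.Maybe using (Maybe; just; nothing)
open import Data.Empty using (⊥)
open import Relation.Nullary using (¬_; yes; no)
open import Relation.Binary.PropositionalEquality using (_≡_; _≢_)
open import Function.Bundles using (_⇔_)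
open import Data.Fin using (fromℕ<)

infixr 6 _⊗_ _⅋_
infixr 5 _&_ _⊕_

data Formula : Set where
  var  : ℕ → Formula
  dual : ℕ → Formula
  _⊗_ _⅋_ _&_ _⊕_ : Formula → Formula → Formula

neg : Formula → Formula
neg (var x)  = dual x
neg (dual x) = var x
neg (A ⊗ B)  = neg B ⅋ neg A
neg (A ⅋ B)  = neg B ⊗ neg A
neg (A & B)  = neg B ⊕ neg A
neg (A ⊕ B)  = neg B & neg A

data Dir : Set where
  L R : Dir

-- paths are read from the root downwards
Path : Set
Path = List Dir

subAt : Formula → Path → Maybe Formula
subAt A [] = just A
subAt (var x) (_ ∷ _) = nothing
subAt (dual x) (_ ∷ _) = nothing
subAt (A ⊗ B) (L ∷ p) = subAt A p
subAt (A ⊗ B) (R ∷ p) = subAt B p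
subAt (A ⅋ B) (L ∷ p) = subAt A p
subAt (A ⅋ B) (R ∷ p) = subAt B p
subAt (A & B) (L ∷ p) = subAt A p
subAt (A & B) (R ∷ p) = subAt B p
subAt (A ⊕ B) (L ∷ p) = subAt A p
subAt (A ⊕ B) (R ∷ p) = subAt B p

data Undistributed : Formula → Set where
  ⊗⊕ : ∀ A B C → Undistributed (A ⊗ (B ⊕ C))
  ⊕⊗ : ∀ A B C → Undistributed ((A ⊕ B) ⊗ C)
  &⅋ : ∀ A B C → Undistributed ((C & B) ⅋ A)
  ⅋& : ∀ A B C → Undistributed (C ⅋ (B & A))

Distributed : Formula → Set
Distributed A = ∀ p F → subAt A p ≡ just F → ¬ Undistributed F

infix 4 _=AC_
data _=AC_ : Formula → Formula → Set where
  ac-refl  : ∀ {A} → A =AC A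
  ac-sym   : ∀ {A B} → A =AC B → B =AC A
  ac-trans : ∀ {A B C} → A =AC B → B =AC C → A =AC C
  ⊗-cong : ∀ {A A' B B'} → A =AC A' → B =AC B' → (A ⊗ B) =AC (A' ⊗ B')
  ⅋-cong : ∀ {A A' B B'} → A =AC A' → B =AC B' → (A ⅋ B) =AC (A' ⅋ B')
  &-cong : ∀ {A A' B B'} → A =AC A' → B =AC B' → (A & B) =AC (A' & B')
  ⊕-cong : ∀ {A A' B B'} → A =AC A' → B =AC B' → (A ⊕ B) =AC (A' ⊕ B')
  ⊗-assoc : ∀ A B C → ((A ⊗ B) ⊗ C) =AC (A ⊗ (B ⊗ C))
  ⅋-assoc : ∀ A B C → ((A ⅋ B) ⅋ C) =AC (A ⅋ (B ⅋ C))
  &-assoc : ∀ A B C → ((A & B) & C) =AC (A & (B & C))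
  ⊕-assoc : ∀ A B C → ((A ⊕ B) ⊕ C) =AC (A ⊕ (B ⊕ C))
  ⊗-comm : ∀ A B → (A ⊗ B) =AC (B ⊗ A)
  ⅋-comm : ∀ A B → (A ⅋ B) =AC (B ⅋ A)
  &-comm : ∀ A B → (A & B) =AC (B & A)
  ⊕-comm : ∀ A B → (A ⊕ B) =AC (B ⊕ A)

-- Cut sequents [Σ]Γ as forests of syntax trees.
-- Each cut pair carries a name n; the pair (n , C) is the cut C * C^⊥,
-- whose two trees have roots  cutL n  (formula C) and  cutR n  (C^⊥).
-- Conclusion i has root  concl i.

data Root : Set where
  cutL cutR : ℕ → Root
  concl     : ℕ → Root

record CutSeq : Set where
  constructor [_]_
  field
    cuts   : List (ℕ × Formula)
    concls : List Formula
open CutSeq public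

names : List (ℕ × Formula) → List ℕ
names = map proj₁

Pos : Set
Pos = Root × Path

data RootF (S : CutSeq) : Root → Formula → Set where
  rL : ∀ {n C} → (n , C) ∈ cuts S → RootF S (cutL n) C
  rR : ∀ {n C} → (n , C) ∈ cuts S → RootF S (cutR n) (neg C)
  rC : ∀ {i F} → (lt : i < length (concls S)) →
       lookup (concls S) (fromℕ< lt) ≡ F → RootF S (concl i) F

FormAt : CutSeq → Pos → Formula → Set
FormAt S (r , p) F = ∃[ G ] (RootF S r G × subAt G p ≡ just F)

IsPar IsWith : CutSeq → Pos → Set
IsPar  S v = ∃[ A ] ∃[ B ] FormAt S v (A ⅋ B)
IsWith S v = ∃[ A ] ∃[ B ] FormAt S v (A & B)

child : Pos → Dir → Pos
child (r , q) d = (r , q ∷ʳ d)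

-- Links, linkings, proof structures.
-- A link is stored as (positive leaf labelled X , negative leaf labelled X^⊥).

Link : Set
Link = Pos × Pos

Linking : Set
Linking = List Link

Net : Set
Net = List Linking

IsLink : CutSeq → Link → Set
IsLink S (a , b) = ∃[ x ] (FormAt S a (var x) × FormAt S b (dual x))

leavesOf : Link → List Pos
leavesOf (a , b) = a ∷ b ∷ []

leaves : Linking → List Pos
leaves = concatMap leavesOf

Below : Pos → Pos → Set
Below (r , q) (r' , q') = r ≡ r' × ∃[ s ] (q' ≡ q ++ s)

Res : Linking → Pos → Set
Res λ' v = ∃[ l ] (l ∈ leaves λ' × Below v l)

IsAtomPos : CutSeq → Pos → Set
IsAtomPos S v = ∃[ x ] (FormAt S v (var x) ⊎ FormAt S v (dual x))

IsAdditiveResolutionOf : CutSeq → Linking → Set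
IsAdditiveResolutionOf S λ' =
    (∀ i → i < length (concls S) → Res λ' (concl i , []))
  × (∀ n C → (n , C) ∈ cuts S → (Res λ' (cutL n , []) ⇔ Res λ' (cutR n , [])))
  × (∀ v A B → Res λ' v → (FormAt S v (A ⊗ B) ⊎ FormAt S v (A ⅋ B)) →
        Res λ' (child v L) × Res λ' (child v R))
  × (∀ v A B → Res λ' v → (FormAt S v (A & B) ⊎ FormAt S v (A ⊕ B)) →
        (Res λ' (child v L) × ¬ Res λ' (child v R))
      ⊎ (Res λ' (child v R) × ¬ Res λ' (child v L)))
  × (∀ v → Res λ' v → IsAtomPos S v → v ∈ leaves λ')

IsLinking : CutSeq → Linking → Set
IsLinking S λ' =
    (∀ a → a ∈ λ' → IsLink S a)
  × Unique (leaves λ')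
  × IsAdditiveResolutionOf S λ'

-- linkings and nets are sets: compare by membership
_≈L_ : Linking → Linking → Set
λ₁ ≈L λ₂ = ∀ a → (a ∈ λ₁ ⇔ a ∈ λ₂)

_≈N_ : Net → Net → Set
θ ≈N θ' = (∀ λ₁ → λ₁ ∈ θ → ∃[ λ₂ ] (λ₂ ∈ θ' × λ₁ ≈L λ₂))
        × (∀ λ₂ → λ₂ ∈ θ' → ∃[ λ₁ ] (λ₁ ∈ θ × λ₁ ≈L λ₂))

data EKey : Set where
  tree : Root → Path → Dir → EKey
  cut  : ℕ → EKey
  link : Pos → Pos → EKey
  jump : Pos → Pos → EKey

src tgt : EKey → Pos
src (tree r q d) = (r , q ∷ʳ d)
src (cut n)      = (cutL n , [])
src (link a b)   = a
src (jump l w)   = l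
tgt (tree r q d) = (r , q)
tgt (cut n)      = (cutR n , [])
tgt (link a b)   = b
tgt (jump l w)   = w

inTarget : EKey → Maybe Pos
inTarget (tree r q d) = just (r , q)
inTarget (cut n)      = nothing
inTarget (link a b)   = nothing
inTarget (jump l w)   = just w

Adj : EKey → Pos → Pos → Set
Adj k u w = (src k ≡ u × tgt k ≡ w) ⊎ (tgt k ≡ u × src k ≡ w)

data Walk (E : EKey → Set) : Pos → Pos → List EKey → Set where
  nil  : ∀ {v} → Walk E v v []
  cons : ∀ {u w v k ks} → E k → Adj k u w → Walk E w v ks → Walk E u v (k ∷ ks)

IsCycle : (EKey → Set) → Pos → List EKey → Set
IsCycle E v ks = Walk E v v ks × ks ≢ [] × Unique ks

IsTree : (Pos → Set) → (EKey → Set) → Set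
IsTree V E = (∀ u v → V u → V v → ∃[ ks ] Walk E u v ks)
           × (∀ v ks → ¬ IsCycle E v ks)

-- (P2) ⅋-switchings of a linking; s(v) is the deleted premise of ⅋-vertex v

switchEdges : CutSeq → Linking → (Pos → Dir) → EKey → Set
switchEdges S λ' s (tree r q d) = Res λ' (r , q ∷ʳ d) × (IsPar S (r , q) → d ≢ s (r , q))
switchEdges S λ' s (cut n)      = Res λ' (cutL n , []) × Res λ' (cutR n , [])
switchEdges S λ' s (link a b)   = (a , b) ∈ λ'
switchEdges S λ' s (jump l w)   = ⊥

UnionRes : List Linking → Pos → Set
UnionRes Λ v = ∃[ λ' ] (λ' ∈ Λ × Res λ' v)

Toggles : CutSeq → List Linking → Pos → Set
Toggles S Λ W = IsWith S W × UnionRes Λ (child W L) × UnionRes Λ (child W R)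

OnlyToggle : CutSeq → List Linking → Pos → Set
OnlyToggle S Λ W = Toggles S Λ W × (∀ W' → Toggles S Λ W' → W' ≡ W)

DependsOn : CutSeq → List Linking → Link → Pos → Set
DependsOn S Λ a W = ∃[ λ₁ ] ∃[ λ₂ ]
  (λ₁ ∈ Λ × λ₂ ∈ Λ × a ∈ λ₁ × a ∉ λ₂ × OnlyToggle S (λ₁ ∷ λ₂ ∷ []) W)

GEdges : CutSeq → List Linking → EKey → Set
GEdges S Λ (tree r q d) = UnionRes Λ (r , q ∷ʳ d)
GEdges S Λ (cut n)      = UnionRes Λ (cutL n , []) × UnionRes Λ (cutR n , [])
GEdges S Λ (link a b)   = ∃[ λ' ] (λ' ∈ Λ × (a , b) ∈ λ')
GEdges S Λ (jump l W)   = ∃[ a ] (DependsOn S Λ a W × l ∈ leavesOf a)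

IsSwitchingCycle : CutSeq → (EKey → Set) → Pos → List EKey → Set
IsSwitchingCycle S E v ks = IsCycle E v ks ×
  (∀ W → (IsPar S W ⊎ IsWith S W) → ∀ k₁ k₂ → k₁ ∈ ks → k₂ ∈ ks →
     inTarget k₁ ≡ just W → inTarget k₂ ≡ just W → k₁ ≡ k₂)

OnCycle : Pos → List EKey → Set
OnCycle W ks = ∃[ k ] (k ∈ ks × (src k ≡ W ⊎ tgt k ≡ W))

-- linking λ lies on the &-resolution keeping premise c(W) of each & W
OnWithRes : CutSeq → (Pos → Dir) → Linking → Set
OnWithRes S c λ' = ∀ W d → IsWith S W → Res λ' (child W d) → d ≡ c W

IsProofNet : CutSeq → Net → Set
IsProofNet S θ =
    (∀ λ' → λ' ∈ θ → IsLinking S λ')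
  × (∀ n C → (n , C) ∈ cuts S → ∃[ λ' ] ∃[ l ]
        (λ' ∈ θ × l ∈ leaves λ' × (proj₁ l ≡ cutL n ⊎ proj₁ l ≡ cutR n)))
  × (∀ c → (∃[ λ' ] (λ' ∈ θ × OnWithRes S c λ'))
         × (∀ λ₁ λ₂ → λ₁ ∈ θ → λ₂ ∈ θ → OnWithRes S c λ₁ → OnWithRes S c λ₂ → λ₁ ≈L λ₂))
  × (∀ λ' → λ' ∈ θ → ∀ s → IsTree (Res λ') (switchEdges S λ' s))
  × (∀ Λ → (∀ λ' → λ' ∈ Λ → λ' ∈ θ) →
       (∃[ λ₁ ] ∃[ λ₂ ] (λ₁ ∈ Λ × λ₂ ∈ Λ × ¬ (λ₁ ≈L λ₂))) →
       ∃[ W ] (Toggles S Λ W ×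
         (∀ v ks → IsSwitchingCycle S (GEdges S Λ) v ks → ¬ OnCycle W ks)))

mapLink : (Pos → Pos) → Link → Link
mapLink f (a , b) = (f a , f b)

renLinking : (Pos → Pos) → Linking → Linking
renLinking f = map (mapLink f)

-- θ on ⊢ X , C  and  ψ on ⊢ C^⊥ , Y  give  [C * C^⊥] X , Y  (cut named 0)
compLeft : Pos → Pos
compLeft (concl (suc zero) , p) = (cutL 0 , p)
compLeft v = v

compRight : Pos → Pos
compRight (concl zero , p) = (cutR 0 , p)
compRight v = v

composeNet : Net → Net → Net
composeNet θ ψ = concatMap (λ λ₁ → map (λ μ → renLinking compLeft λ₁ ++ renLinking compRight μ) ψ) θ

composeSeq : Formula → Formula → Formula → CutSeq
composeSeq X C Y = [ (0 , C) ∷ [] ] (X ∷ Y ∷ [])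

Config : Set
Config = CutSeq × Net

TouchesCut : ℕ → Linking → Set
TouchesCut n λ' = ∃[ l ] (l ∈ leaves λ' × (proj₁ l ≡ cutL n ⊎ proj₁ l ≡ cutR n))

atomicPN : ℕ → Formula → Maybe (Pos × Pos)
atomicPN n (var x)  = just ((cutL n , []) , (cutR n , []))
atomicPN n (dual x) = just ((cutR n , []) , (cutL n , []))
atomicPN n _        = nothing

data AtomR (n : ℕ) (p₀ q₀ : Pos) : Linking → Linking → Set where
  untouched : ∀ {λ'} → ¬ TouchesCut n λ' → AtomR n p₀ q₀ λ' λ'
  merge : ∀ {λ' l m rest} → λ' ↭ ((p₀ , m) ∷ (l , q₀) ∷ rest) →
          AtomR n p₀ q₀ λ' ((l , m) ∷ rest)

-- splitting cut pair n : C*C^⊥ with C = A∘B into n : A*A^⊥ and m : B*B^⊥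
-- (C^⊥ = B^⊥ ∘' A^⊥)
splitPos : ℕ → ℕ → Pos → Pos
splitPos n m (cutL k , L ∷ p) with k ≟ n
... | yes _ = (cutL n , p)
... | no  _ = (cutL k , L ∷ p)
splitPos n m (cutL k , R ∷ p) with k ≟ n
... | yes _ = (cutL m , p)
... | no  _ = (cutL k , R ∷ p)
splitPos n m (cutR k , L ∷ p) with k ≟ n
... | yes _ = (cutR m , p)
... | no  _ = (cutR k , L ∷ p)
splitPos n m (cutR k , R ∷ p) with k ≟ n
... | yes _ = (cutR n , p)
... | no  _ = (cutR k , R ∷ p)
splitPos n m v = v

data MultSplit : Formula → Formula → Formula → Set where
  tens : ∀ A B → MultSplit (A ⊗ B) A B
  par  : ∀ A B → MultSplit (A ⅋ B) A B

data AddSplit : Formula → Formula → Formula → Set where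
  with' : ∀ A B → AddSplit (A & B) A B
  plus  : ∀ A B → AddSplit (A ⊕ B) A B

-- λ chooses non-dual premises of cut pair n (the same side d on both trees)
NonDual : ℕ → Linking → Set
NonDual n λ' = ∃[ d ]
  ((∃[ p ] ((cutL n , d ∷ p) ∈ leaves λ')) × (∃[ p ] ((cutR n , d ∷ p) ∈ leaves λ')))

data DropNonDual (n : ℕ) : Net → Net → Set where
  []   : DropNonDual n [] []
  drop : ∀ {λ' θ θ'} → NonDual n λ' → DropNonDual n θ θ' → DropNonDual n (λ' ∷ θ) θ'
  keep : ∀ {λ' θ θ'} → ¬ NonDual n λ' → DropNonDual n θ θ' → DropNonDual n (λ' ∷ θ) (λ' ∷ θ')

Used : Net → ℕ → Set
Used θ n = ∃[ λ' ] (λ' ∈ θ × TouchesCut n λ')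

data Prune (θ : Net) : List (ℕ × Formula) → List (ℕ × Formula) → Set where
  []   : Prune θ [] []
  keep : ∀ {c Σ₁ Σ₂} → Used θ (proj₁ c) → Prune θ Σ₁ Σ₂ → Prune θ (c ∷ Σ₁) (c ∷ Σ₂)
  drop : ∀ {c Σ₁ Σ₂} → ¬ Used θ (proj₁ c) → Prune θ Σ₁ Σ₂ → Prune θ (c ∷ Σ₁) Σ₂

data Step : Config → Config → Set where
  atomic : ∀ {Σ₁ Σ₂ Γ n C p₀ q₀ θ θ'} →
    atomicPN n C ≡ just (p₀ , q₀) →
    Pointwise (AtomR n p₀ q₀) θ θ' →
    Step ([ Σ₁ ++ (n , C) ∷ Σ₂ ] Γ , θ) ([ Σ₁ ++ Σ₂ ] Γ , θ')
  multiplicative : ∀ {Σ₁ Σ₂ Γ n m C A B θ} →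
    MultSplit C A B →
    m ∉ names (Σ₁ ++ (n , C) ∷ Σ₂) →
    Step ([ Σ₁ ++ (n , C) ∷ Σ₂ ] Γ , θ)
         ([ Σ₁ ++ (n , A) ∷ (m , B) ∷ Σ₂ ] Γ , map (renLinking (splitPos n m)) θ)
  additive : ∀ {Σ₁ Σ₂ Σ' Γ n m C A B θ θ₁} →
    AddSplit C A B →
    m ∉ names (Σ₁ ++ (n , C) ∷ Σ₂) →
    DropNonDual n θ θ₁ →
    Prune (map (renLinking (splitPos n m)) θ₁) (Σ₁ ++ (n , A) ∷ (m , B) ∷ Σ₂) Σ' →
    Step ([ Σ₁ ++ (n , C) ∷ Σ₂ ] Γ , θ)
         ([ Σ' ] Γ , map (renLinking (splitPos n m)) θ₁)

ReducesTo : Config → Config → Set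
ReducesTo (S , θ) (S' , θ') = ∃[ θ'' ] (Star Step (S , θ) (S' , θ'') × θ'' ≈N θ')

-- Identity proof-net of A on ⊢ A^⊥ , A  (A^⊥ = concl 0, A = concl 1)

reloc : Dir → Dir → Pos → Pos
reloc dA dN (concl (suc zero) , p) = (concl 1 , dA ∷ p)
reloc dA dN (concl zero , p)       = (concl 0 , dN ∷ p)
reloc dA dN v = v

pairwiseUnion : Net → Net → Net
pairwiseUnion θ ψ = concatMap (λ λ₁ → map (λ₁ ++_) ψ) θ

idNet : Formula → Net
idNet (var x)  = (((concl 1 , []) , (concl 0 , [])) ∷ []) ∷ []
idNet (dual x) = (((concl 0 , []) , (concl 1 , [])) ∷ []) ∷ []
idNet (A ⊗ B) = pairwiseUnion (map (renLinking (reloc L R)) (idNet A))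
                              (map (renLinking (reloc R L)) (idNet B))
idNet (A ⅋ B) = pairwiseUnion (map (renLinking (reloc L R)) (idNet A))
                              (map (renLinking (reloc R L)) (idNet B))
idNet (A & B) = map (renLinking (reloc L R)) (idNet A) ++ map (renLinking (reloc R L)) (idNet B)
idNet (A ⊕ B) = map (renLinking (reloc L R)) (idNet A) ++ map (renLinking (reloc R L)) (idNet B)

cutFree : List Formula → CutSeq
cutFree Γ = [ [] ] Γ

{-# OPTIONS --safe #-}
-- Cut elimination preserves the traces of matched linkings. Hence, if both composites reduce to
-- identities, every linking of θ joins leaves of A^⊥ to leaves of B, its converse is a linking of ψ,
-- and every additive choice on A or on B is realised by exactly one such linking.
--
-- The crux is that the partner of a leaf does not depend on the linking. Fix a link, and call a
-- &-vertex invariant if changing the choice made there never destroys the link. If some vertex is not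
-- invariant, then for every choice σ on the invariant ones (P3) yields a non-invariant W on no
-- switching cycle. The formulas being distributed, this forces W to lie below a ⊕-vertex n that is
-- joined by ⅋ alone to an end of the link, and forces all linkings that contain the link and agree
-- with σ to choose the same side of n. But n is a & in ψ, where toggling it preserves the link, so
-- some linking containing the link takes the other side of every such n: a contradiction.
--
-- The leaves of A and B are thus in bijection. Two leaves separate at the same connective in A and
-- in B: (P2) in θ and ψ tells ⊗ from ⅋, and (P1) tells & from ⊕. Up to AC, a formula is the
-- complete graph on its leaves coloured by these connectives.
module Submission where

open import Defs
open import Data.Empty using (⊥; ⊥-elim)
open import Data.List using (List; []; _∷_; _++_; _∷ʳ_; map)
open import Data.List.Membership.Propositional using (_∈_; _∉_)
open import Data.List.Membership.Propositional.Properties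
  using (∈-++⁺ˡ; ∈-++⁺ʳ; ∈-++⁻; ∈-map⁺; ∈-map⁻)
open import Data.List.Properties
  using (++-assoc; ++-identityʳ; ++-cancelˡ; ∷-injective; ∷-injectiveˡ; ∷-injectiveʳ; map-++; ++-conicalʳ)
  renaming (≡-dec to List-≡-dec)
open import Data.List.Relation.Binary.Permutation.Propositional as Perm using (_↭_)
open import Data.List.Relation.Binary.Permutation.Propositional.Properties
  using (∈-resp-↭; shift) renaming (map⁺ to ↭-map⁺)
open import Data.List.Relation.Binary.Permutation.Setoid.Properties using (Unique-resp-↭)
open import Data.List.Relation.Binary.Pointwise using (Pointwise; []; _∷_)
open import Data.List.Relation.Unary.All as All using (All; []; _∷_)
open import Data.List.Relation.Unary.AllPairs using ([]; _∷_)
open import Data.List.Relation.Unary.Any as Any using (Any; here; there)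
open import Data.List.Relation.Unary.Unique.Propositional using (Unique)
open import Data.List.Relation.Unary.Unique.Propositional.Properties
  using () renaming (++⁺ to Unique-++)
open import Data.Maybe using (Maybe; just; nothing; fromMaybe)
open import Data.Maybe.Properties using (just-injective)
open import Data.Nat using (ℕ; suc; s≤s; z≤n) renaming (_≟_ to _≟ℕ_)
open import Data.Product using (∃; ∃-syntax; _×_; _,_; proj₁; proj₂)
open import Data.Product.Properties using () renaming (≡-dec to ×-≡-dec)
open import Data.Sum using (_⊎_; inj₁; inj₂)
open import Data.Unit using (⊤; tt)
open import Function using (_∘_; id; case_of_)
open import Function.Construct.Composition using (_⇔-∘_)
open import Function.Construct.Symmetry using (⇔-sym)
open import Function.Bundles using (_⇔_; Equivalence; mk⇔)
open import Relation.Binary.Construct.Closure.ReflexiveTransitive using (Star; ε; _◅_)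
open import Relation.Binary.PropositionalEquality
  using (_≡_; _≢_; refl; sym; trans; cong; cong₂; subst; subst₂; setoid)
open import Relation.Nullary using (¬_; Dec; yes; no; contradiction)

-- Whether a linking of a composite survives cut elimination shows in its additive choices. A
-- matched linking, whose choices on the two trees of each cut are dual, is never deleted; a linking
-- of a cut-free net is matched vacuously, so every identity linking pulls back to a matched one.
--
-- For a fixed link, the obstacle is that toggling n in ψ returns a linking of θ that may make other
-- choices at the &-vertices of θ, the invariant ones included, and so may cease to agree with σ.
-- The forced side of n must therefore be the same for every σ. It is: a linking forced to the other
-- side never reaches the non-invariant & below n, so changing the choice there could not destroy
-- the link. Hence the vertices n can be toggled one after another, and the linking finally obtained
-- is confronted with its own choices in the place of σ.
--
-- Invariance puts two links into one linking only when their ends fit a common &-resolution. Ends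
-- separated by a & fit none; in ψ that & is a ⊕, and the same argument there supplies the missing
-- half.

-- Connectives, paths and subformulas

data Kind : Set where
  ⊗ₖ ⅋ₖ &ₖ ⊕ₖ : Kind

-- Indexing the connectives by `Kind` lets one case stand for four. Since `subAt` and `neg` do not
-- compute on `node k` for a variable `k`, the equations `subAt-node` and `neg-node` take the place
-- of computation.
node : Kind → Formula → Formula → Formula
node ⊗ₖ = _⊗_
node ⅋ₖ = _⅋_
node &ₖ = _&_
node ⊕ₖ = _⊕_

dualₖ : Kind → Kind
dualₖ ⊗ₖ = ⅋ₖ
dualₖ ⅋ₖ = ⊗ₖ
dualₖ &ₖ = ⊕ₖ
dualₖ ⊕ₖ = &ₖ

&ₖ? : ∀ k → Dec (k ≡ &ₖ)
&ₖ? ⊗ₖ = no λ ()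
&ₖ? ⅋ₖ = no λ ()
&ₖ? &ₖ = yes refl
&ₖ? ⊕ₖ = no λ ()

data Additive : Kind → Set where
  add-& : Additive &ₖ
  add-⊕ : Additive ⊕ₖ

data Multiplicative : Kind → Set where
  mul-⊗ : Multiplicative ⊗ₖ
  mul-⅋ : Multiplicative ⅋ₖ

polarity : ∀ k → Additive k ⊎ Multiplicative k
polarity ⊗ₖ = inj₂ mul-⊗
polarity ⅋ₖ = inj₂ mul-⅋
polarity &ₖ = inj₁ add-&
polarity ⊕ₖ = inj₁ add-⊕

mul-not-add : ∀ {k} → Multiplicative k → Additive k → ⊥
mul-not-add mul-⊗ ()
mul-not-add mul-⅋ ()

data Atom : Formula → Set where
  var⁺ : ∀ {x} → Atom (var x)
  dual⁻ : ∀ {x} → Atom (dual x)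

data Shape : Formula → Set where
  atom : ∀ {X} → Atom X → Shape X
  bin  : ∀ k A B → Shape (node k A B)

shape : ∀ F → Shape F
shape (var x) = atom var⁺
shape (dual x) = atom dual⁻
shape (A ⊗ B) = bin ⊗ₖ A B
shape (A ⅋ B) = bin ⅋ₖ A B
shape (A & B) = bin &ₖ A B
shape (A ⊕ B) = bin ⊕ₖ A B

opp : Dir → Dir
opp L = R
opp R = L

opp-opp : ∀ d → opp (opp d) ≡ d
opp-opp L = refl
opp-opp R = refl

opp-≢ : ∀ d → opp d ≢ d
opp-≢ L ()
opp-≢ R ()

_≟ᴰ_ : (d e : Dir) → Dec (d ≡ e)
L ≟ᴰ L = yes refl
L ≟ᴰ R = no λ ()
R ≟ᴰ L = no λ ()
R ≟ᴰ R = yes refl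

≢⇒opp : ∀ {d e} → d ≢ e → e ≡ opp d
≢⇒opp {L} {L} ne = ⊥-elim (ne refl)
≢⇒opp {L} {R} ne = refl
≢⇒opp {R} {L} ne = refl
≢⇒opp {R} {R} ne = ⊥-elim (ne refl)

_≟ᴾ_ : (p q : Path) → Dec (p ≡ q)
_≟ᴾ_ = List-≡-dec _≟ᴰ_

-- Negation exchanges the two arguments of every connective, so the vertex of `neg A` dual to the
-- one at `p` lies at `co p`.
co : Path → Path
co = map opp

co-co : ∀ p → co (co p) ≡ p
co-co [] = refl
co-co (d ∷ p) = cong₂ _∷_ (opp-opp d) (co-co p)

co-injective : ∀ {p q} → co p ≡ co q → p ≡ q
co-injective {p} {q} e = trans (sym (co-co p)) (trans (cong co e) (co-co q))

pick : Dir → Formula → Formula → Formula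
pick L A B = A
pick R A B = B

subAt-node : ∀ k d A B p → subAt (node k A B) (d ∷ p) ≡ subAt (pick d A B) p
subAt-node ⊗ₖ L A B p = refl
subAt-node ⊗ₖ R A B p = refl
subAt-node ⅋ₖ L A B p = refl
subAt-node ⅋ₖ R A B p = refl
subAt-node &ₖ L A B p = refl
subAt-node &ₖ R A B p = refl
subAt-node ⊕ₖ L A B p = refl
subAt-node ⊕ₖ R A B p = refl

subAt-atom : ∀ {X} → Atom X → ∀ d p → subAt X (d ∷ p) ≡ nothing
subAt-atom var⁺ d p = refl
subAt-atom dual⁻ d p = refl

subAt-++ : ∀ F z {G} s → subAt F z ≡ just G → subAt F (z ++ s) ≡ subAt G s
subAt-++ F [] s refl = refl
subAt-++ F (d ∷ z) s eq with shape F
... | atom a = contradiction (trans (sym (subAt-atom a d z)) eq) λ ()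
... | bin k A B = trans (subAt-node k d A B (z ++ s))
    (subAt-++ (pick d A B) z s (trans (sym (subAt-node k d A B z)) eq))

subAt-prefix : ∀ F z s {G} → subAt F (z ++ s) ≡ just G → ∃ λ H → subAt F z ≡ just H
subAt-prefix F [] s eq = F , refl
subAt-prefix F (d ∷ z) s eq with shape F
... | atom a = contradiction (trans (sym (subAt-atom a d (z ++ s))) eq) λ ()
... | bin k A B with subAt-prefix (pick d A B) z s (trans (sym (subAt-node k d A B (z ++ s))) eq)
... | H , e = H , trans (subAt-node k d A B z) e

node-injective : ∀ {k k' A A' B B'} → node k A B ≡ node k' A' B' → k ≡ k'
node-injective {⊗ₖ} {⊗ₖ} e = refl
node-injective {⅋ₖ} {⅋ₖ} e = refl
node-injective {&ₖ} {&ₖ} e = refl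
node-injective {⊕ₖ} {⊕ₖ} e = refl

node-not-atom : ∀ {k A B X} → Atom X → node k A B ≢ X
node-not-atom {⊗ₖ} var⁺ ()
node-not-atom {⅋ₖ} var⁺ ()
node-not-atom {&ₖ} var⁺ ()
node-not-atom {⊕ₖ} var⁺ ()
node-not-atom {⊗ₖ} dual⁻ ()
node-not-atom {⅋ₖ} dual⁻ ()
node-not-atom {&ₖ} dual⁻ ()
node-not-atom {⊕ₖ} dual⁻ ()

data At (F : Formula) (z : Path) (k : Kind) : Set where
  at : ∀ A B → subAt F z ≡ just (node k A B) → At F z k

data Leaf (F : Formula) (p : Path) : Set where
  leaf : ∀ {X} → Atom X → subAt F p ≡ just X → Leaf F p

leaf-subAt : ∀ {F p} → Leaf F p → ∃[ X ] subAt F p ≡ just X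
leaf-subAt (leaf a e) = _ , e

at-subAt : ∀ {F z k} → At F z k → ∃[ G ] subAt F z ≡ just G
at-subAt (at _ _ e) = _ , e

At-functional : ∀ {F z k l} → At F z k → At F z l → k ≡ l
At-functional (at _ _ e) (at _ _ e') = node-injective (just-injective (trans (sym e) e'))

At-not-Leaf : ∀ {F z k} → At F z k → Leaf F z → ⊥
At-not-Leaf (at _ _ e) (leaf a e') = node-not-atom a (just-injective (trans (sym e) e'))

branching : ∀ F z d s {G} → subAt F (z ++ d ∷ s) ≡ just G → ∃[ k ] At F z k
branching F z d s eq with subAt-prefix F z (d ∷ s) eq
... | H , e with shape H
... | bin k A B = k , at A B e
... | atom a = contradiction
    (trans (sym (subAt-atom a d s)) (trans (sym (subAt-++ F z (d ∷ s) e)) eq)) λ ()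

leaf-maximal : ∀ {F p} s {G} → Leaf F p → subAt F (p ++ s) ≡ just G → s ≡ []
leaf-maximal [] l eq = refl
leaf-maximal {F} {p} (d ∷ s) l eq =
  ⊥-elim (At-not-Leaf (proj₂ (branching F p d s eq)) l)

at-under⁻ : ∀ {k l A B} d {z} → At (node k A B) (d ∷ z) l → At (pick d A B) z l
at-under⁻ {k} {l} {A} {B} d {z} (at C D e) = at C D (trans (sym (subAt-node k d A B z)) e)

at-under⁺ : ∀ {k l A B} d {z} → At (pick d A B) z l → At (node k A B) (d ∷ z) l
at-under⁺ {k} {l} {A} {B} d {z} (at C D e) = at C D (trans (subAt-node k d A B z) e)

leaf-under⁻ : ∀ {k A B} d {p} → Leaf (node k A B) (d ∷ p) → Leaf (pick d A B) p
leaf-under⁻ {k} {A} {B} d {p} (leaf a e) = leaf a (trans (sym (subAt-node k d A B p)) e)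

leaf-under⁺ : ∀ {k A B} d {p} → Leaf (pick d A B) p → Leaf (node k A B) (d ∷ p)
leaf-under⁺ {k} {A} {B} d {p} (leaf a e) = leaf a (trans (subAt-node k d A B p) e)

node-root : ∀ {k A B} → ¬ Leaf (node k A B) []
node-root (leaf a e) = node-not-atom a (just-injective e)

leaf-atom : ∀ {X p} → Atom X → Leaf X p → p ≡ []
leaf-atom {p = []} a l = refl
leaf-atom {p = d ∷ p} a (leaf _ e) = contradiction (trans (sym (subAt-atom a d p)) e) λ ()

neg-node : ∀ k A B → neg (node k A B) ≡ node (dualₖ k) (neg B) (neg A)
neg-node ⊗ₖ A B = refl
neg-node ⅋ₖ A B = refl
neg-node &ₖ A B = refl
neg-node ⊕ₖ A B = refl

neg-neg : ∀ A → neg (neg A) ≡ A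
neg-neg (var x) = refl
neg-neg (dual x) = refl
neg-neg (A ⊗ B) = cong₂ _⊗_ (neg-neg A) (neg-neg B)
neg-neg (A ⅋ B) = cong₂ _⅋_ (neg-neg A) (neg-neg B)
neg-neg (A & B) = cong₂ _&_ (neg-neg A) (neg-neg B)
neg-neg (A ⊕ B) = cong₂ _⊕_ (neg-neg A) (neg-neg B)

neg-pick : ∀ d A B → pick (opp d) (neg B) (neg A) ≡ neg (pick d A B)
neg-pick L A B = refl
neg-pick R A B = refl

neg-atom : ∀ {X} → Atom X → Atom (neg X)
neg-atom var⁺ = dual⁻
neg-atom dual⁻ = var⁺

subAt-neg : ∀ A p {G} → subAt A p ≡ just G → subAt (neg A) (co p) ≡ just (neg G)
subAt-neg A [] refl = refl
subAt-neg A (d ∷ p) {G} eq with shape A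
... | atom a = contradiction (trans (sym (subAt-atom a d p)) eq) λ ()
... | bin k B C rewrite neg-node k B C | subAt-node (dualₖ k) (opp d) (neg C) (neg B) (co p)
    | neg-pick d B C = subAt-neg (pick d B C) p (trans (sym (subAt-node k d B C p)) eq)

At-neg : ∀ {A p k} → At A p k → At (neg A) (co p) (dualₖ k)
At-neg {A} {p} {k} (at B C e) = at (neg C) (neg B) (trans (subAt-neg A p e) (cong just (neg-node k B C)))

Leaf-neg : ∀ {A p} → Leaf A p → Leaf (neg A) (co p)
Leaf-neg {A} {p} (leaf a e) = leaf (neg-atom a) (subAt-neg A p e)

-- Forks of paths and the connective at which two leaves separate

data Fork (z : Path) : Path → Path → Set where
  fork : ∀ d s s' → Fork z (z ++ d ∷ s) (z ++ opp d ∷ s')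

fork-sym : ∀ {z p q} → Fork z p q → Fork z q p
fork-sym {z} (fork d s s') =
  subst (λ e → Fork z (z ++ opp d ∷ s') (z ++ e ∷ s)) (opp-opp d) (fork (opp d) s' s)

fork-co : ∀ {z p q} → Fork z p q → Fork (co z) (co p) (co q)
fork-co {z} (fork d s s') rewrite map-++ opp z (d ∷ s) | map-++ opp z (opp d ∷ s') =
  fork (opp d) (co s) (co s')

fork-under : ∀ {z p q} d → Fork z p q → Fork (d ∷ z) (d ∷ p) (d ∷ q)
fork-under d (fork e s s') = fork e s s'

fork-irrefl : ∀ {z p} → ¬ Fork z p p
fork-irrefl {z} f = go f refl
  where
  go : ∀ {p q} → Fork z p q → p ≢ q
  go (fork d s s') eq = opp-≢ d (sym (∷-injectiveˡ (++-cancelˡ z _ _ eq)))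

data Compare (p q : Path) : Set where
  below : ∀ s → q ≡ p ++ s → Compare p q
  above : ∀ s → p ≡ q ++ s → Compare p q
  apart : ∀ z → Fork z p q → Compare p q

compare : ∀ p q → Compare p q
compare [] q = below q refl
compare (d ∷ p) [] = above (d ∷ p) refl
compare (d ∷ p) (e ∷ q) with d ≟ᴰ e
compare (d ∷ p) (e ∷ q) | no d≢e rewrite ≢⇒opp d≢e = apart [] (fork d p q)
compare (d ∷ p) (d ∷ q) | yes refl with compare p q
... | below s eq = below s (cong (d ∷_) eq)
... | above s eq = above s (cong (d ∷_) eq)
... | apart z f = apart (d ∷ z) (fork-under d f)

++-unsplit : ∀ (z z' : Path) {d s e s'} → z ++ d ∷ s ≡ z' ++ e ∷ s' →
  (z ≡ z' × d ≡ e) ⊎ (∃[ r ] z' ≡ z ++ d ∷ r) ⊎ (∃[ r ] z ≡ z' ++ e ∷ r)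
++-unsplit [] [] refl = inj₁ (refl , refl)
++-unsplit [] (x ∷ z') refl = inj₂ (inj₁ (z' , refl))
++-unsplit (x ∷ z) [] refl = inj₂ (inj₂ (z , refl))
++-unsplit (x ∷ z) (y ∷ z') eq with ∷-injective eq
... | refl , eq' with ++-unsplit z z' eq'
... | inj₁ (refl , e) = inj₁ (refl , e)
... | inj₂ (inj₁ (r , refl)) = inj₂ (inj₁ (r , refl))
... | inj₂ (inj₂ (r , refl)) = inj₂ (inj₂ (r , refl))

OnPath : Path → Path → Dir → Set
OnPath p q e = ∃[ s ] p ≡ q ++ e ∷ s

onPath-functional : ∀ {p q e e'} → OnPath p q e → OnPath p q e' → e ≡ e'
onPath-functional {q = q} (s , refl) (s' , eq) = ∷-injectiveˡ (++-cancelˡ q _ _ eq)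

fork-onPath : ∀ {z p q} → Fork z p q → ∃[ d ] (OnPath p z d × OnPath q z (opp d))
fork-onPath (fork d s s') = d , (s , refl) , (s' , refl)

onPath-fork : ∀ {z p q d e} → OnPath p z d → OnPath q z e → d ≢ e → Fork z p q
onPath-fork {d = d} (s , refl) (s' , refl) ne rewrite ≢⇒opp ne = fork d s s'

-- If one fork point were a proper prefix of the other, both paths would run through the longer one
-- and hence leave the shorter one in the same direction.
fork-functional : ∀ {z z' p q} → Fork z p q → Fork z' p q → z ≡ z'
fork-functional {z} {z'} f f' with fork-onPath f | fork-onPath f'
... | d , (s , eq) , o | d' , (s' , eq') , o' with ++-unsplit z z' (trans (sym eq) eq') | o | o'
... | inj₁ (e , _) | _ | _ = e
... | inj₂ (inj₁ (r , refl)) | _ | t , e =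
  ⊥-elim (opp-≢ d (onPath-functional {q = z} o (_ , trans e (++-assoc z (d ∷ r) _))))
... | inj₂ (inj₂ (r , refl)) | t , e | _ =
  ⊥-elim (opp-≢ d' (onPath-functional {q = z'} o' (_ , trans e (++-assoc z' (d' ∷ r) _))))

fork-not-prefix : ∀ {z p} s → ¬ Fork z p (p ++ s)
fork-not-prefix {z} s f with fork-onPath f
... | d , (r , refl) , o = opp-≢ d (onPath-functional {q = z} o (_ , ++-assoc z (d ∷ r) s))

data Meet (F : Formula) (k : Kind) (p q : Path) : Set where
  meet : ∀ z → Fork z p q → At F z k → Meet F k p q

meet-sym : ∀ {F k p q} → Meet F k p q → Meet F k q p
meet-sym (meet z f a) = meet z (fork-sym f) a

meet-functional : ∀ {F k l p q} → Meet F k p q → Meet F l p q → k ≡ l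
meet-functional (meet z f a) (meet z' f' a') with fork-functional f f'
... | refl = At-functional a a'

meet-neg : ∀ {F k p q} → Meet F k p q → Meet (neg F) (dualₖ k) (co p) (co q)
meet-neg {F} (meet z f a) = meet (co z) (fork-co f) (At-neg {F} {z} a)

meet-under : ∀ {k l A B} d {p q} → Meet (pick d A B) l p q → Meet (node k A B) l (d ∷ p) (d ∷ q)
meet-under {k} {l} {A} {B} d (meet z f a) = meet (d ∷ z) (fork-under d f) (at-under⁺ {k} {l} {A} {B} d a)

leaf-compare : ∀ {F p q} → Leaf F p → Leaf F q → p ≡ q ⊎ ∃[ k ] Meet F k p q
leaf-compare {F} {p} {q} lp lq with compare p q
... | below s refl with leaf-maximal s lp (proj₂ (leaf-subAt lq))
... | refl = inj₁ (sym (++-identityʳ p))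
leaf-compare {F} {p} {q} lp lq | above s refl with leaf-maximal s lq (proj₂ (leaf-subAt lp))
... | refl = inj₁ (++-identityʳ q)
leaf-compare {F} {p} {q} lp lq | apart z f with fork-onPath f
... | d , (s , refl) , _ with branching F z d s (proj₂ (leaf-subAt lp))
... | k , a = inj₂ (k , meet z f a)

-- Of the three separation points of three leaves, two coincide.
triangle : ∀ {F k₁ k₂ k₃ p q r} → Meet F k₁ p q → Meet F k₂ q r → Meet F k₃ p r →
  k₁ ≡ k₂ ⊎ k₁ ≡ k₃ ⊎ k₂ ≡ k₃
triangle {F} (meet z₁ f₁ a₁) (meet z₂ f₂ a₂) (meet z₃ f₃ a₃)
  with fork-onPath f₁ | fork-onPath f₂
... | d , p₁ , q₁@(_ , eq₁) | e , q₂@(_ , eq₂) , r₂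
  with ++-unsplit z₁ z₂ (trans (sym eq₁) eq₂)
... | inj₁ (refl , _) = inj₁ (At-functional a₁ a₂)
... | inj₂ (inj₁ (t , refl)) with r₂
...   | s , refl = inj₂ (inj₁ (At-functional a₁ (subst (λ z → At F z _) (fork-functional f₃
        (onPath-fork p₁ (t ++ opp e ∷ s , ++-assoc z₁ (opp d ∷ t) (opp e ∷ s)) (λ x → opp-≢ d (sym x)))) a₃)))
triangle {F} (meet z₁ f₁ a₁) (meet z₂ f₂ a₂) (meet z₃ f₃ a₃)
    | d , p₁ , q₁ | e , q₂ , r₂ | inj₂ (inj₂ (t , refl)) with p₁
...   | s , refl = inj₂ (inj₂ (At-functional a₂ (subst (λ z → At F z _) (fork-functional f₃
        (onPath-fork (t ++ d ∷ s , ++-assoc z₂ (e ∷ t) (d ∷ s)) r₂ (λ x → opp-≢ e (sym x)))) a₃)))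

-- Formulas as four-coloured graphs on their leaves

node-cong : ∀ k {A A' B B'} → A =AC A' → B =AC B' → node k A B =AC node k A' B'
node-cong ⊗ₖ = ⊗-cong
node-cong ⅋ₖ = ⅋-cong
node-cong &ₖ = &-cong
node-cong ⊕ₖ = ⊕-cong

node-assoc : ∀ k {A B C} → node k (node k A B) C =AC node k A (node k B C)
node-assoc ⊗ₖ = ⊗-assoc _ _ _
node-assoc ⅋ₖ = ⅋-assoc _ _ _
node-assoc &ₖ = &-assoc _ _ _
node-assoc ⊕ₖ = ⊕-assoc _ _ _

node-comm : ∀ k {A B} → node k A B =AC node k B A
node-comm ⊗ₖ = ⊗-comm _ _
node-comm ⅋ₖ = ⅋-comm _ _
node-comm &ₖ = &-comm _ _
node-comm ⊕ₖ = ⊕-comm _ _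

node-exchange : ∀ k {A B C} → node k A (node k B C) =AC node k B (node k A C)
node-exchange k = ac-trans (ac-sym (node-assoc k))
  (ac-trans (node-cong k (node-comm k) ac-refl) (node-assoc k))

node-exchangeʳ : ∀ k {A B C} → node k (node k A B) C =AC node k (node k A C) B
node-exchangeʳ k = ac-trans (node-assoc k)
  (ac-trans (node-cong k ac-refl (node-comm k)) (ac-sym (node-assoc k)))

node-interchange : ∀ k {A B C D} →
  node k (node k A B) (node k C D) =AC node k (node k A C) (node k B D)
node-interchange k = ac-trans (node-assoc k)
  (ac-trans (node-cong k ac-refl (node-exchange k)) (ac-sym (node-assoc k)))

data Tree (I : Set) : Set where
  tip : I → Tree I
  br  : Kind → Tree I → Tree I → Tree I

data _∈ₜ_ {I : Set} (i : I) : Tree I → Set where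
  tip : i ∈ₜ tip i
  inl : ∀ {k T U} → i ∈ₜ T → i ∈ₜ br k T U
  inr : ∀ {k T U} → i ∈ₜ U → i ∈ₜ br k T U

some-tip : ∀ {I : Set} (T : Tree I) → ∃[ i ] i ∈ₜ T
some-tip (tip i) = i , tip
some-tip (br k T U) with some-tip T
... | i , h = i , inl h

formula : ∀ {I : Set} → (I → Formula) → Tree I → Formula
formula ℓ (tip i) = ℓ i
formula ℓ (br k T U) = node k (formula ℓ T) (formula ℓ U)

-- A tree over `I` is a cotree of the coloured graph `G`. Colours form a relation rather than a
-- function because a vertex has no colour with itself.
module Graph (I : Set) (ℓ : I → Formula) (G : I → I → Kind → Set)
  (G-sym : ∀ {i j k} → G i j k → G j i k)
  (G-functional : ∀ {i j k l} → G i j k → G i j l → k ≡ l)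
  (G-irrefl : ∀ {i k} → ¬ G i i k) where

  Represents : Tree I → Set
  Represents (tip i) = ⊤
  Represents (br k T U) = Represents T × Represents U × (∀ {i j} → i ∈ₜ T → j ∈ₜ U → G i j k)

  -- nothing stands for the empty tree.
  data _∈ₘ_ (i : I) : Maybe (Tree I) → Set where
    is-in : ∀ {T} → i ∈ₜ T → i ∈ₘ just T

  RepresentsM : Maybe (Tree I) → Set
  RepresentsM nothing = ⊤
  RepresentsM (just T) = Represents T

  join : Kind → Maybe (Tree I) → Maybe (Tree I) → Maybe (Tree I)
  join k nothing U = U
  join k (just T) nothing = just T
  join k (just T) (just U) = just (br k T U)

  ∈-join⁻ : ∀ {k i} T U → i ∈ₘ join k T U → i ∈ₘ T ⊎ i ∈ₘ U
  ∈-join⁻ nothing U h = inj₂ h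
  ∈-join⁻ (just T) nothing h = inj₁ h
  ∈-join⁻ (just T) (just U) (is-in (inl h)) = inj₁ (is-in h)
  ∈-join⁻ (just T) (just U) (is-in (inr h)) = inj₂ (is-in h)

  ∈-joinˡ : ∀ {k i} T U → i ∈ₘ T → i ∈ₘ join k T U
  ∈-joinˡ (just T) nothing h = h
  ∈-joinˡ (just T) (just U) (is-in h) = is-in (inl h)

  ∈-joinʳ : ∀ {k i} T U → i ∈ₘ U → i ∈ₘ join k T U
  ∈-joinʳ nothing U h = h
  ∈-joinʳ (just T) (just U) (is-in h) = is-in (inr h)

  join-represents : ∀ k T U → RepresentsM T → RepresentsM U →
    (∀ {i j} → i ∈ₘ T → j ∈ₘ U → G i j k) → RepresentsM (join k T U)
  join-represents k nothing U rT rU g = rU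
  join-represents k (just T) nothing rT rU g = rT
  join-represents k (just T) (just U) rT rU g = rT , rU , λ h h' → g (is-in h) (is-in h')

  -- Restricting a tree to a set of indices may leave nothing, and no unit formula is available for
  -- the empty part; hence three cases.
  data Joined (k : Kind) : Maybe (Tree I) → Maybe (Tree I) → Formula → Set where
    only-left  : ∀ {T X} → X =AC formula ℓ T → Joined k (just T) nothing X
    only-right : ∀ {U X} → X =AC formula ℓ U → Joined k nothing (just U) X
    both : ∀ {T U X} → X =AC node k (formula ℓ T) (formula ℓ U) → Joined k (just T) (just U) X

  inhabited : ∀ {T U : Tree I} {P : Set} → (∀ {i j} → i ∈ₘ just T → j ∈ₘ just U → P) → P
  inhabited {T} {U} f = f (is-in (proj₂ (some-tip T))) (is-in (proj₂ (some-tip U)))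

  -- A pair with one element in each argument of the vertex has colour `l`; if it also crosses from
  -- one part to the other it has colour `k`. So either each argument lies in one and the same part,
  -- where `l` is kept, or `l` equals `k` and associativity and commutativity regroup the parts.
  joined-node : ∀ {k l T₁ T₂ U₁ U₂ X Y} →
    (∀ {i j} → i ∈ₘ T₁ → j ∈ₘ U₂ → l ≡ k) → (∀ {i j} → i ∈ₘ T₂ → j ∈ₘ U₁ → l ≡ k) →
    Joined k T₁ T₂ X → Joined k U₁ U₂ Y → Joined k (join l T₁ U₁) (join l T₂ U₂) (node l X Y)
  joined-node {k} {l} e₁ e₂ (only-left a) (only-left b) = only-left (node-cong l a b)
  joined-node {k} {l} e₁ e₂ (only-right a) (only-right b) = only-right (node-cong l a b)
  joined-node e₁ e₂ (only-left {T} a) (only-right {U} b)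
    with refl ← inhabited {T} {U} e₁ = both (node-cong _ a b)
  joined-node e₁ e₂ (only-right {T} a) (only-left {U} b)
    with refl ← inhabited {T} {U} e₂ =
    both (ac-trans (node-cong _ a b) (node-comm _))
  joined-node e₁ e₂ (only-left {T} a) (both {U = U} b)
    with refl ← inhabited {T} {U} e₁ =
    both (ac-trans (node-cong _ a b) (ac-sym (node-assoc _)))
  joined-node e₁ e₂ (only-right {T} a) (both {U} b)
    with refl ← inhabited {T} {U} e₂ =
    both (ac-trans (node-cong _ a b) (node-exchange _))
  joined-node e₁ e₂ (both {T₁} {T} a) (only-left {U} b)
    with refl ← inhabited {T} {U} e₂ =
    both (ac-trans (node-cong _ a b) (node-exchangeʳ _))
  joined-node e₁ e₂ (both {T} a) (only-right {U} b)
    with refl ← inhabited {T} {U} e₁ =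
    both (ac-trans (node-cong _ a b) (node-assoc _))
  joined-node e₁ e₂ (both {T} a) (both {U = U} b)
    with refl ← inhabited {T} {U} e₁ =
    both (ac-trans (node-cong _ a b) (node-interchange _))

  record Split (k : Kind) (P Q : I → Set) (T : Tree I) : Set where
    field
      left right : Maybe (Tree I)
      left-represents  : RepresentsM left
      right-represents : RepresentsM right
      left-sound     : ∀ {i} → i ∈ₘ left → i ∈ₜ T × P i
      right-sound    : ∀ {i} → i ∈ₘ right → i ∈ₜ T × Q i
      complete : ∀ {i} → i ∈ₜ T → i ∈ₘ left ⊎ i ∈ₘ right
      joined : Joined k left right (formula ℓ T)

  split : ∀ {k} {P Q : I → Set} T → Represents T → (∀ {i} → i ∈ₜ T → P i ⊎ Q i) →
    (∀ {i j} → P i → Q j → G i j k) → Split k P Q T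
  split (tip i) r pq g with pq tip
  ... | inj₁ p = record
    { left = just (tip i) ; right = nothing ; left-represents = tt ; right-represents = tt
    ; left-sound = λ { (is-in tip) → tip , p } ; right-sound = λ ()
    ; complete = λ { tip → inj₁ (is-in tip) } ; joined = only-left ac-refl }
  ... | inj₂ q = record
    { left = nothing ; right = just (tip i) ; left-represents = tt ; right-represents = tt
    ; left-sound = λ () ; right-sound = λ { (is-in tip) → tip , q }
    ; complete = λ { tip → inj₂ (is-in tip) } ; joined = only-right ac-refl }
  split {k} {P} {Q} (br l T U) (rT , rU , cross) pq g = record
    { left = join l S.left V.left
    ; right = join l S.right V.right
    ; left-represents = join-represents l S.left V.left S.left-represents V.left-represents
        λ h h' → cross (proj₁ (S.left-sound h)) (proj₁ (V.left-sound h'))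
    ; right-represents = join-represents l S.right V.right S.right-represents V.right-represents
        λ h h' → cross (proj₁ (S.right-sound h)) (proj₁ (V.right-sound h'))
    ; left-sound = λ h → case ∈-join⁻ S.left V.left h of λ where
        (inj₁ h) → inl (proj₁ (S.left-sound h)) , proj₂ (S.left-sound h)
        (inj₂ h) → inr (proj₁ (V.left-sound h)) , proj₂ (V.left-sound h)
    ; right-sound = λ h → case ∈-join⁻ S.right V.right h of λ where
        (inj₁ h) → inl (proj₁ (S.right-sound h)) , proj₂ (S.right-sound h)
        (inj₂ h) → inr (proj₁ (V.right-sound h)) , proj₂ (V.right-sound h)
    ; complete = λ where
        (inl h) → case S.complete h of λ where
          (inj₁ h) → inj₁ (∈-joinˡ S.left V.left h)
          (inj₂ h) → inj₂ (∈-joinˡ S.right V.right h)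
        (inr h) → case V.complete h of λ where
          (inj₁ h) → inj₁ (∈-joinʳ S.left V.left h)
          (inj₂ h) → inj₂ (∈-joinʳ S.right V.right h)
    ; joined = joined-node
        (λ h h' → G-functional (cross (proj₁ (S.left-sound h)) (proj₁ (V.right-sound h')))
                               (g (proj₂ (S.left-sound h)) (proj₂ (V.right-sound h'))))
        (λ h h' → G-functional (cross (proj₁ (S.right-sound h)) (proj₁ (V.left-sound h')))
                               (G-sym (g (proj₂ (V.left-sound h')) (proj₂ (S.right-sound h)))))
        S.joined V.joined
    }
    where
    module S = Split (split T rT (λ h → pq (inl h)) g)
    module V = Split (split U rU (λ h → pq (inr h)) g)

  -- The two arguments of the first tree partition the indices so that all crossing pairs have its
  -- root colour; `split` brings the second tree into a form with the same root and the same
  -- partition, and the induction continues on the arguments.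
  representation-unique : ∀ T T' → Represents T → Represents T' →
    (∀ {i} → i ∈ₜ T → i ∈ₜ T') → (∀ {i} → i ∈ₜ T' → i ∈ₜ T) → formula ℓ T =AC formula ℓ T'
  representation-unique (tip i) (tip j) r r' f f' with f' tip
  ... | tip = ac-refl
  representation-unique (tip i) (br k T U) r (_ , _ , cross) f f'
    with some-tip T | some-tip U
  ... | j , h | j' , h' with f' (inl h) | f' (inr h')
  ... | tip | tip = ⊥-elim (G-irrefl (cross h h'))
  representation-unique (br k T U) T' (rT , rU , cross) r' f f'
    with split T' r' (λ h → case f' h of λ { (inl p) → inj₁ p ; (inr q) → inj₂ q }) cross
  ... | record { left = l ; right = r ; left-represents = rl ; right-represents = rr
               ; left-sound = sl ; right-sound = sr ; complete = c ; joined = J } = finish l r rl rr sl sr c J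
    where
    finish : ∀ l r → RepresentsM l → RepresentsM r →
      (∀ {i} → i ∈ₘ l → i ∈ₜ T' × i ∈ₜ T) → (∀ {i} → i ∈ₘ r → i ∈ₜ T' × i ∈ₜ U) →
      (∀ {i} → i ∈ₜ T' → i ∈ₘ l ⊎ i ∈ₘ r) → Joined k l r (formula ℓ T') →
      node k (formula ℓ T) (formula ℓ U) =AC formula ℓ T'
    -- An empty part is impossible: a tip of `U` would then lie in `T` as well and have a colour
    -- with itself.
    finish .(just _) .nothing rl rr sl sr c (only-left e) with some-tip U
    ... | i , h with c (f (inr h))
    ... | inj₁ h' = ⊥-elim (G-irrefl (cross (proj₂ (sl h')) h))
    finish .nothing .(just _) rl rr sl sr c (only-right e) with some-tip T
    ... | i , h with c (f (inl h))
    ... | inj₂ h' = ⊥-elim (G-irrefl (cross h (proj₂ (sr h'))))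
    finish (just T₁) (just U₁) rl rr sl sr c (both e) = ac-trans
      (node-cong k
        (representation-unique T T₁ rT rl
          (λ h → case c (f (inl h)) of λ where
            (inj₁ (is-in h')) → h'
            (inj₂ h') → ⊥-elim (G-irrefl (cross h (proj₂ (sr h')))))
          (λ h → proj₂ (sl (is-in h))))
        (representation-unique U U₁ rU rr
          (λ h → case c (f (inr h)) of λ where
            (inj₁ h') → ⊥-elim (G-irrefl (cross (proj₂ (sl h')) h))
            (inj₂ (is-in h')) → h')
          (λ h → proj₂ (sr (is-in h)))))
      (ac-sym e)

  -- `Rel` names the leaves of `F` by indices. Taking equality for A and the partner relation for B
  -- puts both formulas over one index set, the leaves of A.
  record Realises (F : Formula) (Rel : Path → I → Set) : Set where
    field
      total      : ∀ {p} → Leaf F p → ∃[ i ] Rel p i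
      functional : ∀ {p i j} → Leaf F p → Rel p i → Rel p j → i ≡ j
      labels     : ∀ {p i} → Leaf F p → Rel p i → subAt F p ≡ just (ℓ i)
      colours    : ∀ {p q i j k} → Leaf F p → Leaf F q → Rel p i → Rel q j → Meet F k p q → G i j k

  record TreeFor (F : Formula) (Rel : Path → I → Set) : Set where
    field
      T : Tree I
      represents : Represents T
      formula-T  : formula ℓ T ≡ F
      sound      : ∀ {i} → i ∈ₜ T → ∃[ p ] (Leaf F p × Rel p i)
      complete   : ∀ {p i} → Leaf F p → Rel p i → i ∈ₜ T

  treeFor-atom : ∀ {X Rel} → Atom X → Realises X Rel → TreeFor X Rel
  treeFor-atom {X} {Rel} a r with Realises.total r (leaf a refl)
  ... | i , h = record
    { T = tip i
    ; represents = tt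
    ; formula-T = sym (just-injective (Realises.labels r (leaf a refl) h))
    ; sound = λ { tip → [] , leaf a refl , h }
    ; complete = λ { {[]} l h' → subst (_∈ₜ tip i) (Realises.functional r l h h') tip
                   ; {d ∷ p} (leaf b e) h' → contradiction (trans (sym (subAt-atom a d p)) e) λ () } }

  realises-under : ∀ {k A B Rel} d → Realises (node k A B) Rel →
    Realises (pick d A B) (λ p → Rel (d ∷ p))
  realises-under {k} {A} {B} d r = record
    { total = λ l → R.total (leaf-under⁺ {k} {A} {B} d l)
    ; functional = λ l → R.functional (leaf-under⁺ {k} {A} {B} d l)
    ; labels = λ {p} l h → trans (sym (subAt-node k d A B p)) (R.labels (leaf-under⁺ {k} {A} {B} d l) h)
    ; colours = λ l l' h h' m → R.colours (leaf-under⁺ {k} {A} {B} d l) (leaf-under⁺ {k} {A} {B} d l') h h'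
        (meet-under {k} {_} {A} {B} d m) }
    where module R = Realises r

  treeFor-node : ∀ k {A B Rel} → Realises (node k A B) Rel →
    TreeFor A (λ p → Rel (L ∷ p)) → TreeFor B (λ p → Rel (R ∷ p)) → TreeFor (node k A B) Rel
  treeFor-node k {A} {B} {Rel} r tA tB = record
    { T = br k SA.T SB.T
    ; represents = SA.represents , SB.represents , λ h h' → crossing (SA.sound h) (SB.sound h')
    ; formula-T = cong₂ (node k) SA.formula-T SB.formula-T
    ; sound = λ { (inl h) → under L (SA.sound h) ; (inr h) → under R (SB.sound h) }
    ; complete = complete
    }
    where
    module SA = TreeFor tA
    module SB = TreeFor tB
    under : ∀ d {i} → ∃[ p ] (Leaf (pick d A B) p × Rel (d ∷ p) i) → ∃[ p ] (Leaf (node k A B) p × Rel p i)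
    under d (p , l , h) = d ∷ p , leaf-under⁺ {k} {A} {B} d l , h
    crossing : ∀ {i j} → ∃[ p ] (Leaf A p × Rel (L ∷ p) i) → ∃[ p ] (Leaf B p × Rel (R ∷ p) j) → G i j k
    crossing (p , l , h) (q , l' , h') =
      Realises.colours r (leaf-under⁺ {k} {A} {B} L l) (leaf-under⁺ {k} {A} {B} R l') h h'
        (meet [] (fork L p q) (at A B refl))
    complete : ∀ {p i} → Leaf (node k A B) p → Rel p i → i ∈ₜ br k SA.T SB.T
    complete {[]} (leaf a e) h = ⊥-elim (node-not-atom a (just-injective e))
    complete {L ∷ p} (leaf a e) h = inl (SA.complete (leaf a (trans (sym (subAt-node k L A B p)) e)) h)
    complete {R ∷ p} (leaf a e) h = inr (SB.complete (leaf a (trans (sym (subAt-node k R A B p)) e)) h)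

  treeFor : ∀ F {Rel} → Realises F Rel → TreeFor F Rel
  treeFor (var x) r = treeFor-atom var⁺ r
  treeFor (dual x) r = treeFor-atom dual⁻ r
  treeFor (A ⊗ B) r = treeFor-node ⊗ₖ r (treeFor A (realises-under {⊗ₖ} L r)) (treeFor B (realises-under {⊗ₖ} R r))
  treeFor (A ⅋ B) r = treeFor-node ⅋ₖ r (treeFor A (realises-under {⅋ₖ} L r)) (treeFor B (realises-under {⅋ₖ} R r))
  treeFor (A & B) r = treeFor-node &ₖ r (treeFor A (realises-under {&ₖ} L r)) (treeFor B (realises-under {&ₖ} R r))
  treeFor (A ⊕ B) r = treeFor-node ⊕ₖ r (treeFor A (realises-under {⊕ₖ} L r)) (treeFor B (realises-under {⊕ₖ} R r))

-- From a bijection of leaves to equality up to AC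

record LeafIso (A B : Formula) (Rel : Path → Path → Set) : Set where
  field
    leafˡ  : ∀ {a b} → Rel a b → Leaf A a
    leafʳ  : ∀ {a b} → Rel a b → Leaf B b
    totalˡ : ∀ {a} → Leaf A a → ∃[ b ] Rel a b
    totalʳ : ∀ {b} → Leaf B b → ∃[ a ] Rel a b
    injective : ∀ {a a' b} → Rel a b → Rel a' b → a ≡ a'
    labels : ∀ {a b} → Rel a b → subAt A a ≡ subAt B b
    colours : ∀ {a a' b b' k k'} → Rel a b → Rel a' b' → Meet A k a a' → Meet B k' b b' → k ≡ k'
    functional : ∀ {a b b'} → Rel a b → Rel a b' → b ≡ b'

leafIso⇒AC : ∀ {A B Rel} → LeafIso A B Rel → A =AC B
leafIso⇒AC {A} {B} {Rel} iso = subst₂ _=AC_ TA.formula-T TB.formula-T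
  (representation-unique TA.T TB.T TA.represents TB.represents A⊆B B⊆A)
  where
  module I = LeafIso iso
  ℓ : Path → Formula
  -- The default `A` has no influence: the tips of both trees are leaves of A, where `subAt`
  -- succeeds.
  ℓ a = fromMaybe A (subAt A a)
  G : Path → Path → Kind → Set
  G a a' k = Meet A k a a'
  G-irrefl : ∀ {a k} → ¬ G a a k
  G-irrefl (meet z f _) = fork-irrefl f
  open Graph Path ℓ G meet-sym meet-functional G-irrefl
  ℓ-leaf : ∀ {a} → Leaf A a → subAt A a ≡ just (ℓ a)
  ℓ-leaf {a} (leaf _ e) = trans e (cong just (sym (cong (fromMaybe A) e)))
  treeA : TreeFor A _≡_
  treeA = treeFor A (record
    { total = λ {p} _ → p , refl
    ; functional = λ { _ refl refl → refl }
    ; labels = λ { l refl → ℓ-leaf l }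
    ; colours = λ { _ _ refl refl m → m } })
  colours : ∀ {p q a b k} → Rel a p → Rel b q → Meet B k p q → Meet A k a b
  colours h h' m@(meet z f _) with leaf-compare (I.leafˡ h) (I.leafˡ h')
  ... | inj₁ refl with refl ← I.functional h h' = ⊥-elim (fork-irrefl f)
  ... | inj₂ (k , m') with refl ← I.colours h h' m' m = m'
  treeB : TreeFor B (λ b a → Rel a b)
  treeB = treeFor B (record
    { total = I.totalʳ
    ; functional = λ _ → I.injective
    ; labels = λ l h → trans (sym (I.labels h)) (ℓ-leaf (I.leafˡ h))
    ; colours = λ _ _ → colours })
  module TA = TreeFor treeA
  module TB = TreeFor treeB
  A⊆B : ∀ {a} → a ∈ₜ TA.T → a ∈ₜ TB.T
  A⊆B h with TA.sound h
  ... | _ , l , refl with I.totalˡ l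
  ... | b , r = TB.complete (I.leafʳ r) r
  B⊆A : ∀ {a} → a ∈ₜ TB.T → a ∈ₜ TA.T
  B⊆A h with TB.sound h
  ... | b , _ , r = TA.complete (I.leafˡ r) refl

-- Links and leaves of a linking

-- Links are stored with the positive end first, while traces and cycles traverse them either way.
data Lk (κ : Linking) (u v : Pos) : Set where
  fwd : (u , v) ∈ κ → Lk κ u v
  bwd : (v , u) ∈ κ → Lk κ u v

lk-sym : ∀ {κ u v} → Lk κ u v → Lk κ v u
lk-sym (fwd h) = bwd h
lk-sym (bwd h) = fwd h

∈-leavesˡ : ∀ {κ a b} → (a , b) ∈ κ → a ∈ leaves κ
∈-leavesˡ (here refl) = here refl
∈-leavesˡ (there h) = there (there (∈-leavesˡ h))

∈-leavesʳ : ∀ {κ a b} → (a , b) ∈ κ → b ∈ leaves κ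
∈-leavesʳ (here refl) = there (here refl)
∈-leavesʳ (there h) = there (there (∈-leavesʳ h))

lk-leafˡ : ∀ {κ u v} → Lk κ u v → u ∈ leaves κ
lk-leafˡ (fwd h) = ∈-leavesˡ h
lk-leafˡ (bwd h) = ∈-leavesʳ h

lk-leafʳ : ∀ {κ u v} → Lk κ u v → v ∈ leaves κ
lk-leafʳ h = lk-leafˡ (lk-sym h)

lk-there : ∀ {a κ u v} → Lk κ u v → Lk (a ∷ κ) u v
lk-there (fwd h) = fwd (there h)
lk-there (bwd h) = bwd (there h)

leaf-linked : ∀ {κ u} → u ∈ leaves κ → ∃[ v ] Lk κ u v
leaf-linked {(a , b) ∷ κ} (here refl) = b , fwd (here refl)
leaf-linked {(a , b) ∷ κ} (there (here refl)) = a , bwd (here refl)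
leaf-linked {(a , b) ∷ κ} (there (there h)) with leaf-linked h
... | v , l = v , lk-there l

unique-head : ∀ {A : Set} {x : A} {xs} → Unique (x ∷ xs) → x ∉ xs
unique-head (h ∷ _) m = All.lookup h m refl

unique-tail : ∀ {A : Set} {x : A} {xs} → Unique (x ∷ xs) → Unique xs
unique-tail (_ ∷ u) = u

data LkCons (a b : Pos) (κ : Linking) (u v : Pos) : Set where
  head⁺ : u ≡ a → v ≡ b → LkCons a b κ u v
  head⁻ : u ≡ b → v ≡ a → LkCons a b κ u v
  tail  : Lk κ u v → LkCons a b κ u v

lk-cons : ∀ {a b κ u v} → Lk ((a , b) ∷ κ) u v → LkCons a b κ u v
lk-cons (fwd (here refl)) = head⁺ refl refl
lk-cons (bwd (here refl)) = head⁻ refl refl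
lk-cons (fwd (there h)) = tail (fwd h)
lk-cons (bwd (there h)) = tail (bwd h)

lk-functional : ∀ {κ u v w} → Unique (leaves κ) → Lk κ u v → Lk κ u w → v ≡ w
lk-functional {[]} u (fwd ())
lk-functional {[]} u (bwd ())
lk-functional {(a , b) ∷ κ} u l l' with lk-cons l | lk-cons l'
... | head⁺ refl refl | head⁺ _ refl = refl
... | head⁻ refl refl | head⁻ _ refl = refl
... | head⁺ refl refl | head⁻ e _ = ⊥-elim (unique-head u (here e))
... | head⁻ refl refl | head⁺ e _ = ⊥-elim (unique-head u (here (sym e)))
... | head⁺ refl _ | tail h = ⊥-elim (unique-head u (there (lk-leafˡ h)))
... | head⁻ refl _ | tail h = ⊥-elim (unique-head (unique-tail u) (lk-leafˡ h))
... | tail h | head⁺ refl _ = ⊥-elim (unique-head u (there (lk-leafˡ h)))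
... | tail h | head⁻ refl _ = ⊥-elim (unique-head (unique-tail u) (lk-leafˡ h))
... | tail h | tail h' = lk-functional (unique-tail (unique-tail u)) h h'

leaves-ren : ∀ f κ → leaves (renLinking f κ) ≡ map f (leaves κ)
leaves-ren f [] = refl
leaves-ren f ((a , b) ∷ κ) = cong (λ x → f a ∷ f b ∷ x) (leaves-ren f κ)

leaves-++ : ∀ κ κ' → leaves (κ ++ κ') ≡ leaves κ ++ leaves κ'
leaves-++ [] κ' = refl
leaves-++ ((a , b) ∷ κ) κ' = cong (λ x → a ∷ b ∷ x) (leaves-++ κ κ')

∈-ren⁺ : ∀ f {κ u} → u ∈ leaves κ → f u ∈ leaves (renLinking f κ)
∈-ren⁺ f {κ} h = subst (_ ∈_) (sym (leaves-ren f κ)) (∈-map⁺ f h)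

∈-ren⁻ : ∀ f {κ w} → w ∈ leaves (renLinking f κ) → ∃[ u ] (u ∈ leaves κ × w ≡ f u)
∈-ren⁻ f {κ} h = ∈-map⁻ f (subst (_ ∈_) (leaves-ren f κ) h)

lk-ren : ∀ f {κ u v} → Lk κ u v → Lk (renLinking f κ) (f u) (f v)
lk-ren f (fwd h) = fwd (∈-map⁺ (mapLink f) h)
lk-ren f (bwd h) = bwd (∈-map⁺ (mapLink f) h)

unique-map : ∀ {A B : Set} (f : A → B) {xs} → (∀ {u v} → u ∈ xs → v ∈ xs → f u ≡ f v → u ≡ v) →
  Unique xs → Unique (map f xs)
unique-map f inj [] = []
unique-map f {x ∷ xs} inj (h ∷ u) =
  All.tabulate (λ m e → case ∈-map⁻ f m of λ { (v , v∈ , refl) →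
    All.lookup h v∈ (inj (here refl) (there v∈) e) })
  ∷ unique-map f (λ a b → inj (there a) (there b)) u

leaves-↭ : ∀ {κ κ'} → κ ↭ κ' → leaves κ ↭ leaves κ'
leaves-↭ Perm.refl = Perm.refl
leaves-↭ (Perm.prep (a , b) p) = Perm.prep a (Perm.prep b (leaves-↭ p))
leaves-↭ (Perm.swap (a , b) (c , d) p) =
  Perm.trans (Perm.prep a (Perm.swap b c Perm.refl))
  (Perm.trans (Perm.swap a c (Perm.swap b d Perm.refl))
  (Perm.trans (Perm.prep c (Perm.swap a d Perm.refl))
              (Perm.prep c (Perm.prep d (Perm.prep a (Perm.prep b (leaves-↭ p)))))))
leaves-↭ (Perm.trans p q) = Perm.trans (leaves-↭ p) (leaves-↭ q)

unique-↭ : ∀ {A : Set} {xs ys : List A} → xs ↭ ys → Unique xs → Unique ys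
unique-↭ {A} p = Unique-resp-↭ (setoid A) (Perm.↭⇒↭ₛ p)

lk-↭ : ∀ {κ κ' u v} → κ ↭ κ' → Lk κ u v → Lk κ' u v
lk-↭ p (fwd h) = fwd (∈-resp-↭ p h)
lk-↭ p (bwd h) = bwd (∈-resp-↭ p h)

-- Cut elimination

data CutPair : Pos → Pos → Set where
  LR : ∀ {n p} → CutPair (cutL n , p) (cutR n , co p)
  RL : ∀ {n p} → CutPair (cutR n , p) (cutL n , co p)

cutPair-functional : ∀ {u v w} → CutPair u v → CutPair u w → v ≡ w
cutPair-functional LR LR = refl
cutPair-functional RL RL = refl

cutPair-sym : ∀ {u v} → CutPair u v → CutPair v u
cutPair-sym (LR {n} {p}) = subst (λ q → CutPair (cutR n , co p) (cutL n , q)) (co-co p) RL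
cutPair-sym (RL {n} {p}) = subst (λ q → CutPair (cutL n , co p) (cutR n , q)) (co-co p) LR

-- For linkings of a composite this says that the additive choices on the two trees of the cut are
-- dual. Such linkings survive every deletion, and every linking of the cut-free result comes from
-- one.
Matched : Linking → Set
Matched κ = ∀ u v → CutPair u v → u ∈ leaves κ → v ∈ leaves κ

-- Traces through at most one cut suffice, and are closed under reduction.
data Conn (κ : Linking) (u v : Pos) : Set where
  direct : Lk κ u v → Conn κ u v
  via    : ∀ {w w'} → CutPair w w' → Lk κ u w → Lk κ w' v → Conn κ u v

-- Leaves are compared in both directions because choices are pulled back from an identity linking
-- to the composite; connections are only ever pushed forward, to be read off in the identity.
record _⊑_ (κ κ' : Linking) : Set where
  field
    leaves-⇒ : ∀ {i p} → (concl i , p) ∈ leaves κ → (concl i , p) ∈ leaves κ'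
    leaves-⇐ : ∀ {i p} → (concl i , p) ∈ leaves κ' → (concl i , p) ∈ leaves κ
    conn-⇒   : ∀ {i p j q} → Conn κ (concl i , p) (concl j , q) → Conn κ' (concl i , p) (concl j , q)
open _⊑_

⊑-refl : ∀ {κ} → κ ⊑ κ
⊑-refl = record { leaves-⇒ = id ; leaves-⇐ = id ; conn-⇒ = id }

⊑-trans : ∀ {κ κ' κ''} → κ ⊑ κ' → κ' ⊑ κ'' → κ ⊑ κ''
⊑-trans s t = record
  { leaves-⇒ = leaves-⇒ t ∘ leaves-⇒ s
  ; leaves-⇐ = leaves-⇐ s ∘ leaves-⇐ t
  ; conn-⇒ = conn-⇒ t ∘ conn-⇒ s }

-- What an additive resolution leaves on one tree of a cut. The property passes to both premises
-- when the cut is split, also to a premise on which the linking has no leaf at all.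
data Slice (C : Formula) (P : Path → Set) : Set where
  slice : (∀ {p} → P p → Leaf C p) → (∀ {p q k} → P p → P q → Meet C k p q → ¬ Additive k) → Slice C P

slice-⊆ : ∀ {C} {P Q : Path → Set} → (∀ p → Q p → P p) → Slice C P → Slice C Q
slice-⊆ f (slice l m) = slice (l ∘ f _) (λ x y → m (f _ x) (f _ y))

slice-root : ∀ {k A B P} → Slice (node k A B) P → ¬ P []
slice-root {k} (slice l m) x = node-root {k} (l x)

slice-premise : ∀ k {A B P} d → Slice (node k A B) P → Slice (pick d A B) (λ p → P (d ∷ p))
slice-premise k {A} {B} d (slice l m) = slice (λ x → leaf-under⁻ {k} {A} {B} d (l x))
  (λ x y n → m x y (meet-under {k} {_} {A} {B} d n))

data SplitOf : Formula → Formula → Formula → Set where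
  split-of : ∀ k A B → SplitOf (node k A B) A B

multSplit : ∀ {C A B} → MultSplit C A B → SplitOf C A B
multSplit (tens A B) = split-of ⊗ₖ A B
multSplit (par A B) = split-of ⅋ₖ A B

addSplit : ∀ {C A B} → AddSplit C A B → SplitOf C A B
addSplit (with' A B) = split-of &ₖ A B
addSplit (plus A B) = split-of ⊕ₖ A B

slice-split : ∀ {C A B P} → SplitOf C A B → Slice C P →
  ¬ P [] × Slice A (λ p → P (L ∷ p)) × Slice B (λ p → P (R ∷ p))
slice-split (split-of k A B) s = slice-root {k} s , slice-premise k L s , slice-premise k R s

split-neg : ∀ {C A B} → SplitOf C A B → SplitOf (neg C) (neg B) (neg A)
split-neg (split-of k A B) = subst (λ G → SplitOf G (neg B) (neg A)) (sym (neg-node k A B)) (split-of _ _ _)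

Cuts : Set
Cuts = List (ℕ × Formula)

-- The invariant of reduction. Slices show that matched linkings are not deleted; `coverL` and
-- `coverR` turn an empty list of cuts into the absence of leaves on cut trees.
record Good (Γ : Cuts) (κ : Linking) : Set where
  field
    unique : Unique (leaves κ)
    sliceL : ∀ {n C} → (n , C) ∈ Γ → Slice C (λ p → (cutL n , p) ∈ leaves κ)
    sliceR : ∀ {n C} → (n , C) ∈ Γ → Slice (neg C) (λ p → (cutR n , p) ∈ leaves κ)
    coverL : ∀ {n p} → (cutL n , p) ∈ leaves κ → n ∈ names Γ
    coverR : ∀ {n p} → (cutR n , p) ∈ leaves κ → n ∈ names Γ

names-∈ : ∀ {Γ n C} → (n , C) ∈ Γ → n ∈ names Γ
names-∈ h = ∈-map⁺ proj₁ h

-- Splitting a compound cut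

unsplit : ℕ → ℕ → Pos → Pos
unsplit n m (cutL k , p) with k ≟ℕ n | k ≟ℕ m
... | yes _ | _     = (cutL n , L ∷ p)
... | no _  | yes _ = (cutL n , R ∷ p)
... | no _  | no _  = (cutL k , p)
unsplit n m (cutR k , p) with k ≟ℕ n | k ≟ℕ m
... | yes _ | _     = (cutR n , R ∷ p)
... | no _  | yes _ = (cutR n , L ∷ p)
... | no _  | no _  = (cutR k , p)
unsplit n m (concl i , p) = (concl i , p)

-- `splitPos` is not injective: the name `m` may collide with an old one, and the root of cut `n`
-- stays in place while a premise moves onto it. Away from these two cases `unsplit` inverts it.
Splittable : ℕ → ℕ → Pos → Set
Splittable n m (cutL k , p) = k ≢ m × (k ≡ n → p ≢ [])
Splittable n m (cutR k , p) = k ≢ m × (k ≡ n → p ≢ [])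
Splittable n m (concl i , p) = ⊤

≟-refl : ∀ n → (n ≟ℕ n) ≡ yes refl
≟-refl n with n ≟ℕ n
... | yes refl = refl
... | no ne = ⊥-elim (ne refl)

module _ {n m : ℕ} where

  unsplit-nL : ∀ {p} → unsplit n m (cutL n , p) ≡ (cutL n , L ∷ p)
  unsplit-nL rewrite ≟-refl n = refl

  unsplit-nR : ∀ {p} → unsplit n m (cutR n , p) ≡ (cutR n , R ∷ p)
  unsplit-nR rewrite ≟-refl n = refl

  unsplit-mL : ∀ {p} → n ≢ m → unsplit n m (cutL m , p) ≡ (cutL n , R ∷ p)
  unsplit-mL ne with m ≟ℕ n
  ... | yes e = ⊥-elim (ne (sym e))
  ... | no _ rewrite ≟-refl m = refl

  unsplit-mR : ∀ {p} → n ≢ m → unsplit n m (cutR m , p) ≡ (cutR n , L ∷ p)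
  unsplit-mR ne with m ≟ℕ n
  ... | yes e = ⊥-elim (ne (sym e))
  ... | no _ rewrite ≟-refl m = refl

  unsplit-kL : ∀ {k p} → k ≢ n → k ≢ m → unsplit n m (cutL k , p) ≡ (cutL k , p)
  unsplit-kL {k} k≢n k≢m with k ≟ℕ n | k ≟ℕ m
  ... | yes e | _ = ⊥-elim (k≢n e)
  ... | no _ | yes e = ⊥-elim (k≢m e)
  ... | no _ | no _ = refl

  unsplit-kR : ∀ {k p} → k ≢ n → k ≢ m → unsplit n m (cutR k , p) ≡ (cutR k , p)
  unsplit-kR {k} k≢n k≢m with k ≟ℕ n | k ≟ℕ m
  ... | yes e | _ = ⊥-elim (k≢n e)
  ... | no _ | yes e = ⊥-elim (k≢m e)
  ... | no _ | no _ = refl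

  unsplit-split : n ≢ m → ∀ u → Splittable n m u → unsplit n m (splitPos n m u) ≡ u
  unsplit-split n≢m (concl i , p) s = refl
  unsplit-split n≢m (cutL k , []) (k≢m , ne) = unsplit-kL (λ e → ne e refl) k≢m
  unsplit-split n≢m (cutR k , []) (k≢m , ne) = unsplit-kR (λ e → ne e refl) k≢m
  unsplit-split n≢m (cutL k , L ∷ p) (k≢m , _) with k ≟ℕ n
  ... | yes refl = unsplit-nL
  ... | no k≢n = unsplit-kL k≢n k≢m
  unsplit-split n≢m (cutL k , R ∷ p) (k≢m , _) with k ≟ℕ n
  ... | yes refl = unsplit-mL n≢m
  ... | no k≢n = unsplit-kL k≢n k≢m
  unsplit-split n≢m (cutR k , R ∷ p) (k≢m , _) with k ≟ℕ n
  ... | yes refl = unsplit-nR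
  ... | no k≢n = unsplit-kR k≢n k≢m
  unsplit-split n≢m (cutR k , L ∷ p) (k≢m , _) with k ≟ℕ n
  ... | yes refl = unsplit-mR n≢m
  ... | no k≢n = unsplit-kR k≢n k≢m

-- The dual formula lists its arguments in reverse, so the premise `L` of the left tree and the
-- premise `R` of the right tree go to the same new cut, as `co` requires.
cutPair-split : ∀ n m {u v} → CutPair u v → CutPair (splitPos n m u) (splitPos n m v)
cutPair-split n m (LR {k} {[]}) = LR
cutPair-split n m (RL {k} {[]}) = RL
cutPair-split n m (LR {k} {L ∷ p}) with k ≟ℕ n
... | yes _ = LR
... | no _ = LR {k} {L ∷ p}
cutPair-split n m (LR {k} {R ∷ p}) with k ≟ℕ n
... | yes _ = LR
... | no _ = LR {k} {R ∷ p}
cutPair-split n m (RL {k} {L ∷ p}) with k ≟ℕ n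
... | yes _ = RL
... | no _ = RL {k} {L ∷ p}
cutPair-split n m (RL {k} {R ∷ p}) with k ≟ℕ n
... | yes _ = RL
... | no _ = RL {k} {R ∷ p}

cutPair-left : ∀ {n m u w} → CutPair (splitPos n m u) w → ∃[ v ] CutPair u v
cutPair-left {u = cutL k , p} c = _ , LR
cutPair-left {u = cutR k , p} c = _ , RL
cutPair-left {u = concl i , p} ()

module SplitCut {Σ₁ Σ₂ : Cuts} {n m C A B}
  (sp : SplitOf C A B) (fresh : m ∉ names (Σ₁ ++ (n , C) ∷ Σ₂))
  (uniq : Unique (names (Σ₁ ++ (n , C) ∷ Σ₂))) where

  Γ Γ' : Cuts
  Γ = Σ₁ ++ (n , C) ∷ Σ₂
  Γ' = Σ₁ ++ (n , A) ∷ (m , B) ∷ Σ₂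

  f : Pos → Pos
  f = splitPos n m

  n∈Γ : (n , C) ∈ Γ
  n∈Γ = ∈-++⁺ʳ Σ₁ (here refl)

  n≢m : n ≢ m
  n≢m refl = fresh (names-∈ n∈Γ)

  names-↭ : names Γ ↭ n ∷ names (Σ₁ ++ Σ₂)
  names-↭ = ↭-map⁺ proj₁ (shift (n , C) Σ₁ Σ₂)

  names'-↭ : names Γ' ↭ m ∷ names Γ
  names'-↭ = Perm.trans
    (↭-map⁺ proj₁ (Perm.trans (shift (n , A) Σ₁ ((m , B) ∷ Σ₂))
      (Perm.trans (Perm.prep (n , A) (shift (m , B) Σ₁ Σ₂)) (Perm.swap (n , A) (m , B) Perm.refl))))
    (Perm.prep m (Perm.↭-sym names-↭))

  uniq' : Unique (names Γ')
  uniq' = unique-↭ (Perm.↭-sym names'-↭)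
    (All.tabulate (λ h e → fresh (subst (_∈ names Γ) (sym e) h)) ∷ uniq)

  module _ {κ} (g : Good Γ κ) where
    open Good g

    splittable : ∀ {u} → u ∈ leaves κ → Splittable n m u
    splittable {cutL k , p} h = (λ { refl → fresh (coverL h) }) ,
      λ { refl refl → proj₁ (slice-split sp (sliceL n∈Γ)) h }
    splittable {cutR k , p} h = (λ { refl → fresh (coverR h) }) ,
      λ { refl refl → proj₁ (slice-split (split-neg sp) (sliceR n∈Γ)) h }
    splittable {concl i , p} h = tt

    back : ∀ {w} → w ∈ leaves (renLinking f κ) → unsplit n m w ∈ leaves κ
    back h with ∈-ren⁻ f {κ} h
    ... | u , u∈ , refl = subst (_∈ leaves κ) (sym (unsplit-split n≢m u (splittable u∈))) u∈

    partner-splittable : ∀ {u v} → CutPair u v → Splittable n m u → Splittable n m v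
    partner-splittable (LR {p = []}) (a , b) = a , λ e → ⊥-elim (b e refl)
    partner-splittable (LR {p = x ∷ p}) (a , b) = a , λ _ ()
    partner-splittable (RL {p = []}) (a , b) = a , λ e → ⊥-elim (b e refl)
    partner-splittable (RL {p = x ∷ p}) (a , b) = a , λ _ ()

    matched⁺ : Matched κ → Matched (renLinking f κ)
    matched⁺ M _ _ c h with ∈-ren⁻ f {κ} h
    ... | u , u∈ , refl with cutPair-left {n} {m} {u} c
    ... | v , c' = subst (_∈ leaves (renLinking f κ))
      (cutPair-functional (cutPair-split n m c') c) (∈-ren⁺ f {κ} (M _ _ c' u∈))

    matched⁻ : Matched (renLinking f κ) → Matched κ
    matched⁻ M u v c h = subst (_∈ leaves κ)
      (unsplit-split n≢m v (partner-splittable c (splittable h)))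
      (back (M _ _ (cutPair-split n m c) (∈-ren⁺ f {κ} h)))

    ⊑-split : κ ⊑ renLinking f κ
    ⊑-split = record
      { leaves-⇒ = ∈-ren⁺ f {κ}
      ; leaves-⇐ = back
      ; conn-⇒ = λ { (direct l) → direct (lk-ren f l)
                   ; (via c l l') → via (cutPair-split n m c) (lk-ren f l) (lk-ren f l') } }

    unique' : Unique (leaves (renLinking f κ))
    unique' = subst Unique (sym (leaves-ren f κ)) (unique-map f
      (λ {u} {v} u∈ v∈ e → trans (sym (unsplit-split n≢m u (splittable u∈)))
        (trans (cong (unsplit n m) e) (unsplit-split n≢m v (splittable v∈)))) unique)

    back-to : ∀ {w u} → unsplit n m w ≡ u → w ∈ leaves (renLinking f κ) → u ∈ leaves κ
    back-to e h = subst (_∈ leaves κ) e (back h)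

    data New (k : ℕ) (D : Formula) : Set where
      is-n  : k ≡ n → D ≡ A → New k D
      is-m  : k ≡ m → D ≡ B → New k D
      other : k ≢ n → k ≢ m → (k , D) ∈ Γ → New k D

    old : ∀ {k D} → (k , D) ∈ Σ₁ ++ Σ₂ → (k , D) ∈ Γ → New k D
    old o h = other (λ { refl → unique-head (unique-↭ names-↭ uniq) (names-∈ o) })
                    (λ { refl → fresh (names-∈ h) }) h

    classify : ∀ {k D} → (k , D) ∈ Γ' → New k D
    classify h with ∈-++⁻ Σ₁ h
    ... | inj₂ (here refl) = is-n refl refl
    ... | inj₂ (there (here refl)) = is-m refl refl
    ... | inj₁ h₁ = old (∈-++⁺ˡ h₁) (∈-++⁺ˡ h₁)
    ... | inj₂ (there (there h₂)) = old (∈-++⁺ʳ Σ₁ h₂) (∈-++⁺ʳ Σ₁ (there h₂))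

    names-new : ∀ {k} → (k ≢ n → k ≢ m → k ∈ names Γ) → k ∈ names Γ'
    names-new {k} h with k ≟ℕ n | k ≟ℕ m
    ... | yes refl | _ = ∈-resp-↭ (Perm.↭-sym names'-↭) (there (names-∈ n∈Γ))
    ... | no _ | yes refl = ∈-resp-↭ (Perm.↭-sym names'-↭) (here refl)
    ... | no a | no b = ∈-resp-↭ (Perm.↭-sym names'-↭) (there (h a b))

    good' : Good Γ' (renLinking f κ)
    good' = record
      { unique = unique'
      ; sliceL = λ h → case classify h of λ where
          (is-n refl refl) → slice-⊆ (λ _ → back-to unsplit-nL) (proj₁ (proj₂ (slice-split sp (sliceL n∈Γ))))
          (is-m refl refl) → slice-⊆ (λ _ → back-to (unsplit-mL n≢m)) (proj₂ (proj₂ (slice-split sp (sliceL n∈Γ))))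
          (other a b h) → slice-⊆ (λ _ → back-to (unsplit-kL a b)) (sliceL h)
      ; sliceR = λ h → case classify h of λ where
          (is-n refl refl) → slice-⊆ (λ _ → back-to unsplit-nR) (proj₂ (proj₂ (slice-split (split-neg sp) (sliceR n∈Γ))))
          (is-m refl refl) → slice-⊆ (λ _ → back-to (unsplit-mR n≢m)) (proj₁ (proj₂ (slice-split (split-neg sp) (sliceR n∈Γ))))
          (other a b h) → slice-⊆ (λ _ → back-to (unsplit-kR a b)) (sliceR h)
      ; coverL = λ h → names-new (λ a b → coverL (back-to (unsplit-kL a b) h))
      ; coverR = λ h → names-new (λ a b → coverR (back-to (unsplit-kR a b) h)) }

-- Atomic cuts

data AtomicEnds (n : ℕ) : Formula → Pos → Pos → Set where
  at-var : ∀ {x} → AtomicEnds n (var x) (cutL n , []) (cutR n , [])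
  at-dual : ∀ {x} → AtomicEnds n (dual x) (cutR n , []) (cutL n , [])

atomicEnds : ∀ n C {p q} → atomicPN n C ≡ just (p , q) → AtomicEnds n C p q
atomicEnds n (var x) refl = at-var
atomicEnds n (dual x) refl = at-dual

module _ {n : ℕ} {C : Formula} {p q : Pos} where

  ends-pair : AtomicEnds n C p q → CutPair p q
  ends-pair at-var = LR
  ends-pair at-dual = RL

  endL : AtomicEnds n C p q → (cutL n , []) ≡ p ⊎ (cutL n , []) ≡ q
  endL at-var = inj₁ refl
  endL at-dual = inj₂ refl

  endR : AtomicEnds n C p q → (cutR n , []) ≡ p ⊎ (cutR n , []) ≡ q
  endR at-var = inj₂ refl
  endR at-dual = inj₁ refl

  atomic-formula : AtomicEnds n C p q → Atom C
  atomic-formula at-var = var⁺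
  atomic-formula at-dual = dual⁻

slice-atom : ∀ {X P} → Atom X → Slice X P → ∀ r → P r → r ≡ []
slice-atom a (slice l _) r x = leaf-atom a (l x)

cutPair-concl : ∀ {i r u v} → CutPair u v → (concl i , r) ≢ u
cutPair-concl LR ()
cutPair-concl RL ()

module AtomicCut {Σ₁ Σ₂ : Cuts} {n C p₀ q₀} (at-n : atomicPN n C ≡ just (p₀ , q₀)) where

  Γ Γ' : Cuts
  Γ = Σ₁ ++ (n , C) ∷ Σ₂
  Γ' = Σ₁ ++ Σ₂

  ends-pq : AtomicEnds n C p₀ q₀
  ends-pq = atomicEnds n C at-n

  pair-pq : CutPair p₀ q₀
  pair-pq = ends-pair ends-pq

  weaken : ∀ {x} → x ∈ Γ' → x ∈ Γ
  weaken h with ∈-++⁻ Σ₁ h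
  ... | inj₁ a = ∈-++⁺ˡ a
  ... | inj₂ a = ∈-++⁺ʳ Σ₁ (there a)

  n∈Γ : (n , C) ∈ Γ
  n∈Γ = ∈-++⁺ʳ Σ₁ (here refl)

  names-↭ : names Γ ↭ n ∷ names Γ'
  names-↭ = ↭-map⁺ proj₁ (shift (n , C) Σ₁ Σ₂)

  uniq' : Unique (names Γ) → Unique (names Γ')
  uniq' u = unique-tail (unique-↭ names-↭ u)

  other-name : ∀ {k} → k ∈ names Γ → k ≢ n → k ∈ names Γ'
  other-name h ne with ∈-resp-↭ names-↭ h
  ... | here e = ⊥-elim (ne e)
  ... | there h' = h'

  good-⊆ : ∀ {κ κ'} → Good Γ κ → Unique (leaves κ') → (∀ {u} → u ∈ leaves κ' → u ∈ leaves κ) →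
    (∀ {p} → (cutL n , p) ∉ leaves κ') → (∀ {p} → (cutR n , p) ∉ leaves κ') → Good Γ' κ'
  good-⊆ g u f nl nr = record
    { unique = u
    ; sliceL = λ h → slice-⊆ (λ _ → f) (sliceL (weaken h))
    ; sliceR = λ h → slice-⊆ (λ _ → f) (sliceR (weaken h))
    ; coverL = λ h → other-name (coverL (f h)) λ { refl → nl h }
    ; coverR = λ h → other-name (coverR (f h)) λ { refl → nr h } }
    where open Good g

  module Merge {κ l m rest} (perm : κ ↭ (p₀ , m) ∷ (l , q₀) ∷ rest) (g : Good Γ κ) where
    open Good g

    κ' : Linking
    κ' = (l , m) ∷ rest

    u : Unique (p₀ ∷ m ∷ l ∷ q₀ ∷ leaves rest)
    u = unique-↭ (leaves-↭ perm) unique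

    p∉ : p₀ ∉ m ∷ l ∷ q₀ ∷ leaves rest
    p∉ = unique-head u

    q∉rest : q₀ ∉ leaves rest
    q∉rest = unique-head (unique-tail (unique-tail (unique-tail u)))

    q≢m : q₀ ≢ m
    q≢m e = unique-head (unique-tail u) (there (here (sym e)))

    q≢l : q₀ ≢ l
    q≢l e = unique-head (unique-tail (unique-tail u)) (here (sym e))

    p∉κ' : p₀ ∉ leaves κ'
    p∉κ' (here e) = p∉ (there (here e))
    p∉κ' (there (here e)) = p∉ (here e)
    p∉κ' (there (there h)) = p∉ (there (there (there h)))

    q∉κ' : q₀ ∉ leaves κ'
    q∉κ' (here e) = q≢l e
    q∉κ' (there (here e)) = q≢m e
    q∉κ' (there (there h)) = q∉rest h

    u' : Unique (leaves κ')
    u' with u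
    ... | _ ∷ (m∉ ∷ (l∉ ∷ (_ ∷ ur))) =
      All.tabulate (λ { (here refl) e → All.lookup m∉ (here refl) (sym e)
                      ; (there h) e → All.lookup l∉ (there h) e })
      ∷ (All.tabulate (λ h e → All.lookup m∉ (there (there h)) e) ∷ ur)

    data Where (w : Pos) : Set where
      at-p : w ≡ p₀ → Where w
      at-q : w ≡ q₀ → Where w
      kept : w ∈ leaves κ' → Where w

    locate : ∀ {w} → w ∈ leaves κ → Where w
    locate h with ∈-resp-↭ (leaves-↭ perm) h
    ... | here e = at-p e
    ... | there (here e) = kept (there (here e))
    ... | there (there (here e)) = kept (here e)
    ... | there (there (there (here e))) = at-q e
    ... | there (there (there (there r))) = kept (there (there r))

    leaf-old : ∀ {w} → w ∈ p₀ ∷ m ∷ l ∷ q₀ ∷ leaves rest → w ∈ leaves κ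
    leaf-old = ∈-resp-↭ (Perm.↭-sym (leaves-↭ perm))

    old : ∀ {w} → w ∈ leaves κ' → w ∈ leaves κ
    old (here e) = leaf-old (there (there (here e)))
    old (there (here e)) = leaf-old (there (here e))
    old (there (there h)) = leaf-old (there (there (there (there h))))

    matched⁺ : Matched κ → Matched κ'
    matched⁺ M _ _ c h with locate (M _ _ c (old h))
    ... | kept h' = h'
    ... | at-p refl = ⊥-elim (q∉κ' (subst (_∈ leaves κ') (cutPair-functional (cutPair-sym c) pair-pq) h))
    ... | at-q refl = ⊥-elim (p∉κ'
          (subst (_∈ leaves κ') (cutPair-functional (cutPair-sym c) (cutPair-sym pair-pq)) h))

    matched⁻ : Matched κ' → Matched κ
    matched⁻ M _ _ c h with locate h
    ... | kept h' = old (M _ _ c h')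
    ... | at-p refl = leaf-old (there (there (there (here (cutPair-functional c pair-pq)))))
    ... | at-q refl = leaf-old (here (cutPair-functional c (cutPair-sym pair-pq)))

    good' : Good Γ' κ'
    good' = good-⊆ g u' old
      (λ {p} h → absurd (subst (λ p → (cutL n , p) ∈ leaves κ') (slice-atom (atomic-formula ends-pq) (sliceL n∈Γ) p (old h)) h)
        (endL ends-pq))
      (λ {p} h → absurd (subst (λ p → (cutR n , p) ∈ leaves κ') (slice-atom (neg-atom (atomic-formula ends-pq)) (sliceR n∈Γ) p (old h)) h)
        (endR ends-pq))
      where
      absurd : ∀ {w} → w ∈ leaves κ' → w ≡ p₀ ⊎ w ≡ q₀ → ⊥
      absurd h (inj₁ refl) = p∉κ' h
      absurd h (inj₂ refl) = q∉κ' h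

    data Link' (w v : Pos) : Set where
      pm : w ≡ p₀ → v ≡ m → Link' w v
      mp : w ≡ m → v ≡ p₀ → Link' w v
      lq : w ≡ l → v ≡ q₀ → Link' w v
      ql : w ≡ q₀ → v ≡ l → Link' w v
      rs : Lk rest w v → Link' w v

    find : ∀ {w v} → Lk κ w v → Link' w v
    find h with lk-↭ perm h
    ... | fwd (here refl) = pm refl refl
    ... | bwd (here refl) = mp refl refl
    ... | fwd (there (here refl)) = lq refl refl
    ... | bwd (there (here refl)) = ql refl refl
    ... | fwd (there (there r)) = rs (fwd r)
    ... | bwd (there (there r)) = rs (bwd r)

    conn : ∀ {i p j q} → Conn κ (concl i , p) (concl j , q) → Conn κ' (concl i , p) (concl j , q)
    conn (direct h) with find h
    ... | pm e _ = ⊥-elim (cutPair-concl pair-pq e)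
    ... | mp _ e = ⊥-elim (cutPair-concl pair-pq e)
    ... | lq _ e = ⊥-elim (cutPair-concl (cutPair-sym pair-pq) e)
    ... | ql e _ = ⊥-elim (cutPair-concl (cutPair-sym pair-pq) e)
    ... | rs r = direct (lk-there r)
    conn (via c h h') with find h
    ... | pm e _ = ⊥-elim (cutPair-concl pair-pq e)
    ... | ql e _ = ⊥-elim (cutPair-concl (cutPair-sym pair-pq) e)
    -- The trace enters the cut from `m` at `p₀` and resumes at `q₀`, whose only partner is `l`;
    -- merging has turned exactly this trace into a link. The case `lq` is the same trace run
    -- backwards.
    ... | mp refl refl with cutPair-functional c pair-pq
    ...   | refl with find h'
    ...     | pm e _ = ⊥-elim (p∉ (there (there (here (sym e)))))
    ...     | mp e _ = ⊥-elim (q≢m e)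
    ...     | lq e _ = ⊥-elim (q≢l e)
    ...     | ql _ refl = direct (bwd (here refl))
    ...     | rs r = ⊥-elim (q∉rest (lk-leafˡ r))
    conn (via c h h') | lq refl refl with cutPair-functional c (cutPair-sym pair-pq)
    ...   | refl with find h'
    ...     | pm _ refl = direct (fwd (here refl))
    ...     | mp e _ = ⊥-elim (p∉ (here e))
    ...     | lq e _ = ⊥-elim (p∉ (there (here e)))
    ...     | ql e _ = ⊥-elim (p∉ (there (there (here e))))
    ...     | rs r = ⊥-elim (p∉ (there (there (there (lk-leafˡ r)))))
    conn (via c h h') | rs r with find h'
    ...   | pm refl _ = ⊥-elim (q∉rest (subst (_∈ leaves rest)
            (cutPair-functional (cutPair-sym c) pair-pq) (lk-leafʳ r)))
    ...   | mp _ e = ⊥-elim (cutPair-concl pair-pq e)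
    ...   | lq _ e = ⊥-elim (cutPair-concl (cutPair-sym pair-pq) e)
    ...   | ql refl _ = ⊥-elim (p∉ (there (there (there (subst (_∈ leaves rest)
            (cutPair-functional (cutPair-sym c) (cutPair-sym pair-pq)) (lk-leafʳ r))))))
    ...   | rs r' = via c (lk-there r) (lk-there r')

    ⊑-merge : κ ⊑ κ'
    ⊑-merge = record
      { leaves-⇒ = λ h → case locate h of λ where
          (at-p e) → ⊥-elim (cutPair-concl pair-pq e)
          (at-q e) → ⊥-elim (cutPair-concl (cutPair-sym pair-pq) e)
          (kept h) → h
      ; leaves-⇐ = old
      ; conn-⇒ = conn }

  record AtomStep (κ κ' : Linking) : Set where
    field
      good : Good Γ' κ'
      m⁺ : Matched κ → Matched κ'
      m⁻ : Matched κ' → Matched κ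
      ⊑' : κ ⊑ κ'

  atom-step : ∀ {κ κ'} → Good Γ κ → AtomR n p₀ q₀ κ κ' → AtomStep κ κ'
  atom-step g (untouched nt) = record
    { good = good-⊆ g (Good.unique g) id
        (λ h → nt (_ , h , inj₁ refl)) (λ h → nt (_ , h , inj₂ refl))
    ; m⁺ = id ; m⁻ = id ; ⊑' = ⊑-refl }
  atom-step g (merge perm) = record
    { good = good' ; m⁺ = matched⁺ ; m⁻ = matched⁻ ; ⊑' = ⊑-merge }
    where open Merge perm g

-- Matched linkings under reduction

GoodConfig : Config → Set
GoodConfig (S , Θ) = Unique (names (cuts S)) × (∀ {κ} → κ ∈ Θ → Good (cuts S) κ)

-- Only matched linkings are followed, since an unmatched one may be deleted at an additive cut.
record Simulates (Θ Θ' : Net) : Set where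
  field
    forth : ∀ {κ} → κ ∈ Θ → Matched κ → ∃[ κ' ] (κ' ∈ Θ' × Matched κ' × κ ⊑ κ')
    back  : ∀ {κ'} → κ' ∈ Θ' → Matched κ' → ∃[ κ ] (κ ∈ Θ × Matched κ × κ ⊑ κ')

pointwise-forth : ∀ {A B : Set} {R : A → B → Set} {xs ys x} → Pointwise R xs ys → x ∈ xs → ∃[ y ] (y ∈ ys × R x y)
pointwise-forth (r ∷ rs) (here refl) = _ , here refl , r
pointwise-forth (r ∷ rs) (there h) with pointwise-forth rs h
... | y , y∈ , r' = y , there y∈ , r'

pointwise-back : ∀ {A B : Set} {R : A → B → Set} {xs ys y} → Pointwise R xs ys → y ∈ ys → ∃[ x ] (x ∈ xs × R x y)
pointwise-back (r ∷ rs) (here refl) = _ , here refl , r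
pointwise-back (r ∷ rs) (there h) with pointwise-back rs h
... | x , x∈ , r' = x , there x∈ , r'

dropped-∈ : ∀ {n θ θ' κ} → DropNonDual n θ θ' → κ ∈ θ' → κ ∈ θ
dropped-∈ (drop _ d) h = there (dropped-∈ d h)
dropped-∈ (keep _ d) (here e) = here e
dropped-∈ (keep _ d) (there h) = there (dropped-∈ d h)

∈-dropped : ∀ {n θ θ' κ} → DropNonDual n θ θ' → κ ∈ θ → ¬ NonDual n κ → κ ∈ θ'
∈-dropped (drop nd d) (here refl) h = ⊥-elim (h nd)
∈-dropped (drop nd d) (there k) h = ∈-dropped d k h
∈-dropped (keep _ d) (here e) h = here e
∈-dropped (keep _ d) (there k) h = there (∈-dropped d k h)

pruned-∈ : ∀ {Θ Γ Γ' x} → Prune Θ Γ Γ' → x ∈ Γ' → x ∈ Γ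
pruned-∈ (keep _ d) (here e) = here e
pruned-∈ (keep _ d) (there h) = there (pruned-∈ d h)
pruned-∈ (drop _ d) h = there (pruned-∈ d h)

pruned-names : ∀ {Θ Γ Γ' k} → Prune Θ Γ Γ' → k ∈ names Γ' → k ∈ names Γ
pruned-names (keep _ d) (here e) = here e
pruned-names (keep _ d) (there h) = there (pruned-names d h)
pruned-names (drop _ d) h = there (pruned-names d h)

used-kept : ∀ {Θ Γ Γ' k} → Prune Θ Γ Γ' → k ∈ names Γ → Used Θ k → k ∈ names Γ'
used-kept (keep _ d) (here e) u = here e
used-kept (keep _ d) (there h) u = there (used-kept d h u)
used-kept (drop n d) (here refl) u = ⊥-elim (n u)
used-kept (drop n d) (there h) u = used-kept d h u

pruned-unique : ∀ {Θ Γ Γ'} → Prune Θ Γ Γ' → Unique (names Γ) → Unique (names Γ')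
pruned-unique [] u = u
pruned-unique (keep _ d) (h ∷ u) = All.tabulate (λ m → All.lookup h (pruned-names d m)) ∷ pruned-unique d u
pruned-unique (drop _ d) (h ∷ u) = pruned-unique d u

-- Matching carries the leaf on the right tree to the opposite premise of the left tree; together
-- with the leaf already there it would occupy both premises of an additive vertex, which a slice
-- forbids.
matched-dual : ∀ {C A B n Γ κ} → AddSplit C A B → (n , C) ∈ Γ → Good Γ κ → Matched κ → ¬ NonDual n κ
matched-dual {n = n} {κ = κ} a h g M (d , (p , l) , (q , r)) = both d l (M _ _ RL r)
  where
  apart-sides : ∀ {C A B P} → AddSplit C A B → Slice C P → ∀ {p q} → P (L ∷ p) → ¬ P (R ∷ q)
  apart-sides (with' A B) (slice _ ne) x y = ne x y (meet [] (fork L _ _) (at A B refl)) add-&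
  apart-sides (plus A B) (slice _ ne) x y = ne x y (meet [] (fork L _ _) (at A B refl)) add-⊕
  both : ∀ d → (cutL n , d ∷ p) ∈ leaves κ → (cutL n , opp d ∷ co q) ∈ leaves κ → ⊥
  both L x y = apart-sides a (Good.sliceL g h) x y
  both R x y = apart-sides a (Good.sliceL g h) y x

step-simulates : ∀ {c c'} → Step c c' → GoodConfig c → GoodConfig c' × Simulates (proj₂ c) (proj₂ c')
step-simulates (atomic {Σ₁} {Σ₂} {n = n} {C = C} at-n pw) (u , g) =
  (AC.uniq' u , λ h → case pointwise-back pw h of λ { (κ , κ∈ , r) →
    AC.AtomStep.good (AC.atom-step (g κ∈) r) }) ,
  record
    { forth = λ κ∈ M → case pointwise-forth pw κ∈ of λ { (κ' , κ'∈ , r) →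
        κ' , κ'∈ , AC.AtomStep.m⁺ (AC.atom-step (g κ∈) r) M , AC.AtomStep.⊑' (AC.atom-step (g κ∈) r) }
    ; back = λ κ'∈ M → case pointwise-back pw κ'∈ of λ { (κ , κ∈ , r) →
        κ , κ∈ , AC.AtomStep.m⁻ (AC.atom-step (g κ∈) r) M , AC.AtomStep.⊑' (AC.atom-step (g κ∈) r) } }
  where module AC = AtomicCut {Σ₁} {Σ₂} {n} {C} at-n
step-simulates (multiplicative {Σ₁} {Σ₂} {n = n} {m = m} {θ = θ} sp fresh) (u , g) =
  (SC.uniq' , λ h → case ∈-map⁻ (renLinking SC.f) h of λ { (κ , κ∈ , refl) → SC.good' (g κ∈) }) ,
  record
    { forth = λ κ∈ M → _ , ∈-map⁺ (renLinking SC.f) κ∈ , SC.matched⁺ (g κ∈) M , SC.⊑-split (g κ∈)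
    ; back = λ κ'∈ M → case ∈-map⁻ (renLinking SC.f) κ'∈ of λ { (κ , κ∈ , refl) →
        κ , κ∈ , SC.matched⁻ (g κ∈) M , SC.⊑-split (g κ∈) } }
  where module SC = SplitCut {Σ₁} {Σ₂} (multSplit sp) fresh u
step-simulates (additive {Σ₁} {Σ₂} {n = n} {m = m} {C = C} sp fresh dr pr) (u , g) =
  (pruned-unique pr SC.uniq' , λ h → case ∈-map⁻ (renLinking SC.f) h of λ { (κ , κ∈ , refl) →
    prune-good pr h (SC.good' (g (dropped-∈ dr κ∈))) }) ,
  record
    { forth = λ κ∈ M → _ , ∈-map⁺ (renLinking SC.f) (∈-dropped dr κ∈ (matched-dual sp SC.n∈Γ (g κ∈) M)) ,
        SC.matched⁺ (g κ∈) M , SC.⊑-split (g κ∈)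
    ; back = λ κ'∈ M → case ∈-map⁻ (renLinking SC.f) κ'∈ of λ { (κ , κ∈ , refl) →
        κ , dropped-∈ dr κ∈ , SC.matched⁻ (g (dropped-∈ dr κ∈)) M , SC.⊑-split (g (dropped-∈ dr κ∈)) } }
  where
  module SC = SplitCut {Σ₁} {Σ₂} (addSplit sp) fresh u
  prune-good : ∀ {Θ Γ Γ' κ} → Prune Θ Γ Γ' → κ ∈ Θ → Good Γ κ → Good Γ' κ
  prune-good pr h g = record
    { unique = Good.unique g
    ; sliceL = λ x → Good.sliceL g (pruned-∈ pr x)
    ; sliceR = λ x → Good.sliceR g (pruned-∈ pr x)
    ; coverL = λ x → used-kept pr (Good.coverL g x) (_ , h , _ , x , inj₁ refl)
    ; coverR = λ x → used-kept pr (Good.coverR g x) (_ , h , _ , x , inj₂ refl) }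

steps-simulate : ∀ {c c'} → Star Step c c' → GoodConfig c → GoodConfig c' × Simulates (proj₂ c) (proj₂ c')
steps-simulate ε g = g , record
  { forth = λ h M → _ , h , M , ⊑-refl ; back = λ h M → _ , h , M , ⊑-refl }
steps-simulate (s ◅ ss) g with step-simulates s g
... | g' , sim with steps-simulate ss g'
... | g'' , sim' = g'' , record
  { forth = λ h M → case Simulates.forth sim h M of λ { (κ , κ∈ , M' , r) →
      case Simulates.forth sim' κ∈ M' of λ { (κ' , κ'∈ , M'' , r') → κ' , κ'∈ , M'' , ⊑-trans r r' } }
  ; back = λ h M → case Simulates.back sim' h M of λ { (κ , κ∈ , M' , r) →
      case Simulates.back sim κ∈ M' of λ { (κ' , κ'∈ , M'' , r') → κ' , κ'∈ , M'' , ⊑-trans r' r } } }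

open Equivalence using (to; from)

⇔-trans : {A B C : Set} → A ⇔ B → B ⇔ C → A ⇔ C
⇔-trans e f = f ⇔-∘ e

-- Additive choices

-- Unlike a &-resolution, `f` also decides at ⊕, so the leaves that follow it are those of a single
-- additive resolution of `F`.
record Follows (F : Formula) (f : Path → Dir) (p : Path) : Set where
  constructor follows
  field
    is-leaf : Leaf F p
    chosen  : ∀ {z d k} → OnPath p z d → At F z k → Additive k → f z ≡ d
open Follows

onPath-under : ∀ {p z d} e → OnPath p z d → OnPath (e ∷ p) (e ∷ z) d
onPath-under e (s , refl) = s , refl

follows-node⁻ : ∀ {k A B f d p} → Follows (node k A B) f (d ∷ p) →
  Follows (pick d A B) (λ z → f (d ∷ z)) p × (Additive k → f [] ≡ d)
follows-node⁻ {k} {A} {B} {f} {d} {p} (follows l c) =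
  follows (leaf-under⁻ {k} {A} {B} d l) (λ o a → c (onPath-under d o) (at-under⁺ {k} {_} {A} {B} d a)) ,
  c (p , refl) (at A B refl)

follows-node⁺ : ∀ k {A B f} d {p} → Follows (pick d A B) (λ z → f (d ∷ z)) p →
  (Additive k → f [] ≡ d) → Follows (node k A B) f (d ∷ p)
follows-node⁺ k {A} {B} {f} d {p} (follows l c) r = follows (leaf-under⁺ {k} {A} {B} d l) go
  where
  go : ∀ {z e k'} → OnPath (d ∷ p) z e → At (node k A B) z k' → Additive k' → f z ≡ e
  go {[]} (s , refl) a h with At-functional a (at A B refl)
  ... | refl = r h
  go {x ∷ z} (s , refl) a h = c (s , refl) (at-under⁻ {k} {_} {A} {B} d a) h

follows-atom : ∀ {X f} → Atom X → Follows X f []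
follows-atom a = follows (leaf a refl) λ { {z} (s , e) → ⊥-elim (nonempty z s e) }
  where
  nonempty : ∀ z {d} s → [] ≡ z ++ d ∷ s → ⊥
  nonempty [] s ()
  nonempty (x ∷ z) s ()

slice-follows : ∀ {C} {P : Path → Set} f → (∀ {p} → P p → Follows C f p) → Slice C P
slice-follows f h = slice (is-leaf ∘ h) λ { x y (meet z g a) add → case fork-onPath g of λ { (d , o , o') →
  opp-≢ d (trans (sym (chosen (h y) o' a add)) (chosen (h x) o a add)) } }

coChoice : (Path → Dir) → Path → Dir
coChoice f z = opp (f (co z))

onPath-co : ∀ {p z d} → OnPath p z d → OnPath (co p) (co z) (opp d)
onPath-co {z = z} {d} (s , refl) = co s , map-++ opp z (d ∷ s)

additive-dual : ∀ {k} → Additive k → Additive (dualₖ k)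
additive-dual add-& = add-⊕
additive-dual add-⊕ = add-&

at-neg⁻ : ∀ {A z k} → At (neg A) z k → At A (co z) (dualₖ k)
at-neg⁻ {A} {z} a = subst (λ G → At G (co z) _) (neg-neg A) (At-neg {neg A} {z} a)

leaf-neg⁻ : ∀ {A p} → Leaf (neg A) p → Leaf A (co p)
leaf-neg⁻ {A} {p} l = subst (λ G → Leaf G (co p)) (neg-neg A) (Leaf-neg {neg A} {p} l)

follows-neg : ∀ {A f p} → Follows A f p → Follows (neg A) (coChoice f) (co p)
follows-neg {A} {f} {p} (follows l c) = follows (Leaf-neg l) λ {z} {d} o a h →
  trans (cong opp (c (subst (λ q → OnPath q (co z) (opp d)) (co-co p) (onPath-co o)) (at-neg⁻ a)
    (additive-dual h))) (opp-opp d)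

follows-resp : ∀ {A f g p} → (∀ z → f z ≡ g z) → Follows A f p → Follows A g p
follows-resp e (follows l c) = follows l λ {z} o a h → trans (sym (e z)) (c o a h)

follows-neg⁻ : ∀ {A f p} → Follows (neg A) f p → Follows A (coChoice f) (co p)
follows-neg⁻ {A} {f} {p} h = subst (λ G → Follows G (coChoice f) (co p)) (neg-neg A) (follows-neg h)

coChoice-co : ∀ f z → coChoice (coChoice f) z ≡ f z
coChoice-co f z = trans (opp-opp _) (cong f (co-co z))

-- Linkings on sequents with two conclusions

con : Dir → ℕ
con L = 0
con R = 1

-- Indexing the two conclusions by `Dir` makes `opp` exchange them, so that an argument with a
-- parameter `t` covers both.
pos : Dir → Path → Pos
pos t p = (concl (con t) , p)

pos-injective : ∀ {t p q} → pos t p ≡ pos t q → p ≡ q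
pos-injective refl = refl

pos-side : ∀ {t s p q} → pos t p ≡ pos s q → t ≡ s
pos-side {L} {L} e = refl
pos-side {R} {R} e = refl

_≟R_ : (r s : Root) → Dec (r ≡ s)
cutL n ≟R cutL m with n ≟ℕ m
... | yes refl = yes refl
... | no ne = no λ { refl → ne refl }
cutR n ≟R cutR m with n ≟ℕ m
... | yes refl = yes refl
... | no ne = no λ { refl → ne refl }
concl n ≟R concl m with n ≟ℕ m
... | yes refl = yes refl
... | no ne = no λ { refl → ne refl }
cutL _ ≟R cutR _ = no λ ()
cutL _ ≟R concl _ = no λ ()
cutR _ ≟R cutL _ = no λ ()
cutR _ ≟R concl _ = no λ ()
concl _ ≟R cutL _ = no λ ()
concl _ ≟R cutR _ = no λ ()

_≟Pos_ : (u v : Pos) → Dec (u ≡ v)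
_≟Pos_ = ×-≡-dec _≟R_ _≟ᴾ_

below? : ∀ u v → Dec (Below u v)
below? (r , q) (r' , q') with r ≟R r'
... | no ne = no λ { (e , _) → ne e }
... | yes e with compare q q'
...   | below s eq = yes (e , s , eq)
...   | above [] eq = yes (e , [] , trans (trans (sym (++-identityʳ q')) (sym eq)) (sym (++-identityʳ q)))
...   | above (d ∷ s) refl = no λ { (_ , s' , e') → longer q' e' }
  where
  longer : ∀ (z : Path) {d s s'} → z ≢ (z ++ d ∷ s) ++ s'
  longer [] ()
  longer (x ∷ z) eq = longer z (∷-injectiveʳ eq)
...   | apart z f = no λ { (_ , s' , refl) → fork-not-prefix s' f }

res? : ∀ κ v → Dec (Res κ v)
res? κ v with Any.any? (below? v) (leaves κ)
... | yes a = yes (find a)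
  where
  find : ∀ {xs} → Any (Below v) xs → ∃[ l ] (l ∈ xs × Below v l)
  find (here b) = _ , here refl , b
  find (there a) with find a
  ... | l , h , b = l , there h , b
... | no n = no λ { (l , h , b) → n (lose h b) }
  where
  lose : ∀ {xs l} → l ∈ xs → Below v l → Any (Below v) xs
  lose (here refl) b = here b
  lose (there h) b = there (lose h b)

two : (Dir → Formula) → CutSeq
two F = cutFree (F L ∷ F R ∷ [])

∷ʳ-++ : ∀ (q : Path) d s → (q ∷ʳ d) ++ s ≡ q ++ d ∷ s
∷ʳ-++ q d s = ++-assoc q (d ∷ []) s

module TwoSided (F : Dir → Formula) where

  formAt⁺ : ∀ t p {X} → subAt (F t) p ≡ just X → FormAt (two F) (pos t p) X
  formAt⁺ L p e = F L , rC (s≤s z≤n) refl , e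
  formAt⁺ R p e = F R , rC (s≤s (s≤s z≤n)) refl , e

  formAt⁻ : ∀ t p {X} → FormAt (two F) (pos t p) X → subAt (F t) p ≡ just X
  formAt⁻ L p (_ , rC _ refl , e) = e
  formAt⁻ R p (_ , rC _ refl , e) = e

  formAt-side : ∀ {u X} → FormAt (two F) u X → ∃[ t ] ∃[ p ] u ≡ pos t p
  formAt-side {concl 0 , p} h = L , p , refl
  formAt-side {concl 1 , p} h = R , p , refl
  formAt-side {concl (suc (suc i)) , p} (_ , rC (s≤s (s≤s ())) _ , e)
  formAt-side {cutL n , p} (_ , rL () , e)
  formAt-side {cutR n , p} (_ , rR () , e)

  isWith⁻ : ∀ {u} → IsWith (two F) u → ∃[ t ] ∃[ p ] (u ≡ pos t p × At (F t) p &ₖ)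
  isWith⁻ {u} (A , B , h) with formAt-side {u} h
  ... | t , p , refl = t , p , refl , at A B (formAt⁻ t p h)

  isWith⁺ : ∀ t {p} → At (F t) p &ₖ → IsWith (two F) (pos t p)
  isWith⁺ t {p} (at A B e) = A , B , formAt⁺ t p e

  isPar⁻ : ∀ t {p} → IsPar (two F) (pos t p) → At (F t) p ⅋ₖ
  isPar⁻ t {p} (A , B , h) = at A B (formAt⁻ t p h)

  isWith-at : ∀ t {p} → IsWith (two F) (pos t p) → At (F t) p &ₖ
  isWith-at t {p} (A , B , h) = at A B (formAt⁻ t p h)

  Visits : Linking → Dir → Path → Set
  Visits κ t q = Res κ (pos t q)

  visits-leaf : ∀ {κ t q s} → pos t (q ++ s) ∈ leaves κ → Visits κ t q
  visits-leaf h = _ , h , refl , _ , refl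

  visits-prefix : ∀ {κ t q} s → Visits κ t (q ++ s) → Visits κ t q
  visits-prefix {q = q} s ((r , _) , h , refl , s' , refl) = _ , h , refl , s ++ s' , ++-assoc q s s'

  visits-onPath : ∀ κ t {p q d} → OnPath p q d → Visits κ t p → Visits κ t (q ∷ʳ d)
  visits-onPath κ t {q = q} {d} (s , refl) v = visits-prefix {κ} {t} s (subst (Visits κ t) (sym (∷ʳ-++ q d s)) v)

  leaf-visited : ∀ κ t {p} → pos t p ∈ leaves κ → Visits κ t p
  leaf-visited κ t {p} h = _ , h , refl , [] , sym (++-identityʳ p)

  visits-elim : ∀ {κ t q} → Visits κ t q → ∃[ s ] pos t (q ++ s) ∈ leaves κ
  visits-elim (_ , h , refl , s , refl) = s , h

  module OneLinking {κ} (lin : IsLinking (two F) κ) where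

    unique-leaves : Unique (leaves κ)
    unique-leaves = proj₁ (proj₂ lin)

    link-typed : ∀ {u v} → Lk κ u v → ∃[ x ]
      ((FormAt (two F) u (var x) × FormAt (two F) v (dual x)) ⊎ (FormAt (two F) u (dual x) × FormAt (two F) v (var x)))
    link-typed (fwd h) with proj₁ lin _ h
    ... | x , a , b = x , inj₁ (a , b)
    link-typed (bwd h) with proj₁ lin _ h
    ... | x , a , b = x , inj₂ (b , a)

    link-labels : ∀ t s {a b} → Lk κ (pos t a) (pos s b) →
      ∃[ X ] (Atom X × subAt (F t) a ≡ just X × subAt (F s) b ≡ just (neg X))
    link-labels t s {a} {b} l with link-typed l
    ... | x , inj₁ (f , g) = var x , var⁺ , formAt⁻ t a f , formAt⁻ s b g
    ... | x , inj₂ (f , g) = dual x , dual⁻ , formAt⁻ t a f , formAt⁻ s b g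

    leaf-side : ∀ {u} → u ∈ leaves κ → ∃[ t ] ∃[ p ] (u ≡ pos t p × Leaf (F t) p)
    leaf-side {u} h with leaf-linked h
    ... | v , l with link-typed l
    ... | x , inj₁ (f , _) with formAt-side {u} f
    ...   | t , p , refl = t , p , refl , leaf var⁺ (formAt⁻ t p f)
    leaf-side {u} h | v , l | x , inj₂ (f , _) with formAt-side {u} f
    ...   | t , p , refl = t , p , refl , leaf dual⁻ (formAt⁻ t p f)

    leaf-of : ∀ t {p} → pos t p ∈ leaves κ → Leaf (F t) p
    leaf-of t h with leaf-side h
    ... | s , q , e , l with pos-side {t} {s} e
    ... | refl with pos-injective {t} e
    ... | refl = l

    visits-root : ∀ t → Visits κ t []
    visits-root L = proj₁ (proj₂ (proj₂ lin)) 0 (s≤s z≤n)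
    visits-root R = proj₁ (proj₂ (proj₂ lin)) 1 (s≤s (s≤s z≤n))

    visits-both : ∀ t {q k} → At (F t) q k → Multiplicative k → Visits κ t q → ∀ d → Visits κ t (q ∷ʳ d)
    visits-both t {q} (at A B e) m v d = side d (proj₁ (proj₂ (proj₂ (proj₂ (proj₂ lin)))) (pos t q) A B v (form m (formAt⁺ t q e)))
      where
      form : ∀ {k} → Multiplicative k → FormAt (two F) (pos t q) (node k A B) →
        FormAt (two F) (pos t q) (A ⊗ B) ⊎ FormAt (two F) (pos t q) (A ⅋ B)
      form mul-⊗ f = inj₁ f
      form mul-⅋ f = inj₂ f
      side : ∀ d → Visits κ t (q ∷ʳ L) × Visits κ t (q ∷ʳ R) → Visits κ t (q ∷ʳ d)
      side L = proj₁
      side R = proj₂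

    visits-one : ∀ t {q k} → At (F t) q k → Additive k → Visits κ t q →
      ∃[ d ] (Visits κ t (q ∷ʳ d) × ¬ Visits κ t (q ∷ʳ opp d))
    visits-one t {q} (at A B e) m v
      with proj₁ (proj₂ (proj₂ (proj₂ (proj₂ (proj₂ lin))))) (pos t q) A B v (form m (formAt⁺ t q e))
      where
      form : ∀ {k} → Additive k → FormAt (two F) (pos t q) (node k A B) →
        FormAt (two F) (pos t q) (A & B) ⊎ FormAt (two F) (pos t q) (A ⊕ B)
      form add-& f = inj₁ f
      form add-⊕ f = inj₂ f
    ... | inj₁ (a , b) = L , a , b
    ... | inj₂ (a , b) = R , a , b

    visits-not-both : ∀ t {q k d} → At (F t) q k → Additive k →
      Visits κ t (q ∷ʳ d) → Visits κ t (q ∷ʳ opp d) → ⊥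
    visits-not-both t {d = d} a h v w with visits-one t a h (visits-prefix {κ} {t} _ v)
    ... | e , x , y with d ≟ᴰ e
    ... | yes refl = y w
    ... | no ne with ≢⇒opp ne
    ... | refl = y (subst (λ d → Visits κ t (_ ∷ʳ d)) (sym (opp-opp d)) v)

    visited-leaf : ∀ t {p} → Leaf (F t) p → Visits κ t p → pos t p ∈ leaves κ
    visited-leaf t {p} (leaf a e) v = proj₂ (proj₂ (proj₂ (proj₂ (proj₂ (proj₂ lin))))) (pos t p) v (form a (formAt⁺ t p e))
      where
      form : ∀ {X} → Atom X → FormAt (two F) (pos t p) X → IsAtomPos (two F) (pos t p)
      form var⁺ f = _ , inj₁ f
      form dual⁻ f = _ , inj₂ f

    -- Unvisited vertices receive `R`; a leaf that follows `choice` is reached through visited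
    -- vertices alone, so this value is never consulted for it.
    choice : Dir → Path → Dir
    choice t z with res? κ (pos t (z ∷ʳ L))
    ... | yes _ = L
    ... | no _ = R

    choice-unique : ∀ t {z k d} → At (F t) z k → Additive k → Visits κ t (z ∷ʳ d) → choice t z ≡ d
    choice-unique t {z} {d = L} a h v with res? κ (pos t (z ∷ʳ L))
    ... | yes _ = refl
    ... | no n = ⊥-elim (n v)
    choice-unique t {z} {d = R} a h v with res? κ (pos t (z ∷ʳ L))
    ... | yes v' = ⊥-elim (visits-not-both t a h v' v)
    ... | no n = refl

    choice-visits : ∀ t {z k} → At (F t) z k → Additive k → Visits κ t z → Visits κ t (z ∷ʳ choice t z)
    choice-visits t a h v with visits-one t a h v
    ... | d , x , _ = subst (λ d → Visits κ t (_ ∷ʳ d)) (sym (choice-unique t a h x)) x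

    leaves-follow : ∀ t {p} → pos t p ∈ leaves κ → Follows (F t) (choice t) p
    leaves-follow t h = follows (leaf-of t h) λ o a m → choice-unique t a m (visits-onPath κ t o (leaf-visited κ t h))

    -- Descend from the root: a visited multiplicative vertex passes the visit on to both premises,
    -- a visited additive one to the premise chosen, which is the one that `p` takes.
    follow-leaves : ∀ t {p} → Follows (F t) (choice t) p → pos t p ∈ leaves κ
    follow-leaves t {p} (follows l c) = visited-leaf t l (descend [] p refl (visits-root t))
      where
      descend : ∀ z s → p ≡ z ++ s → Visits κ t z → Visits κ t p
      descend z [] refl v = subst (Visits κ t) (sym (++-identityʳ z)) v
      descend z (d ∷ s) eq v with branching (F t) z d s (trans (cong (subAt (F t)) (sym eq)) (proj₂ (leaf-subAt l)))
      ... | k , a with polarity k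
      ... | inj₂ m = descend (z ∷ʳ d) s (trans eq (sym (∷ʳ-++ z d s))) (visits-both t a m v d)
      ... | inj₁ h = descend (z ∷ʳ d) s (trans eq (sym (∷ʳ-++ z d s)))
              (subst (λ d → Visits κ t (z ∷ʳ d)) (c (s , eq) a h) (choice-visits t a h v))

-- Identity proof-nets

data IdPair : Pos → Pos → Set where
  right : ∀ p → IdPair (pos R p) (pos L (co p))
  left  : ∀ p → IdPair (pos L (co p)) (pos R p)

idPair-sym : ∀ {u v} → IdPair u v → IdPair v u
idPair-sym (right p) = left p
idPair-sym (left p) = right p

idPair-reloc : ∀ d {u v} → IdPair u v → IdPair (reloc d (opp d) u) (reloc d (opp d) v)
idPair-reloc d (right p) = right (d ∷ p)
idPair-reloc d (left p) = left (d ∷ p)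

place : Dir → Linking → Linking
place d = renLinking (reloc d (opp d))

placed-links : ∀ d ν → (∀ {u v} → (u , v) ∈ ν → IdPair u v) → ∀ {u v} → (u , v) ∈ place d ν → IdPair u v
placed-links d ν h m with ∈-map⁻ (mapLink (reloc d (opp d))) m
... | (u , v) , m' , refl = idPair-reloc d (h m')

pairwise-∈⁻ : ∀ {Θ Ψ κ} → κ ∈ pairwiseUnion Θ Ψ → ∃[ ν ] ∃[ ξ ] (ν ∈ Θ × ξ ∈ Ψ × κ ≡ ν ++ ξ)
pairwise-∈⁻ {ν ∷ Θ} {Ψ} h with ∈-++⁻ (map (ν ++_) Ψ) h
... | inj₁ m with ∈-map⁻ (ν ++_) m
...   | ξ , ξ∈ , refl = ν , ξ , here refl , ξ∈ , refl
pairwise-∈⁻ {ν ∷ Θ} {Ψ} h | inj₂ m with pairwise-∈⁻ {Θ} m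
... | ν' , ξ , a , b , c = ν' , ξ , there a , b , c

pairwise-∈⁺ : ∀ {Θ Ψ ν ξ} → ν ∈ Θ → ξ ∈ Ψ → (ν ++ ξ) ∈ pairwiseUnion Θ Ψ
pairwise-∈⁺ (here refl) h = ∈-++⁺ˡ (∈-map⁺ (_ ++_) h)
pairwise-∈⁺ {ν ∷ Θ} (there m) h = ∈-++⁺ʳ (map (ν ++_) _) (pairwise-∈⁺ m h)

IdNet : Net → Set
IdNet Θ = ∀ {ν} → ν ∈ Θ → ∀ {u v} → (u , v) ∈ ν → IdPair u v

idNet-map : ∀ d {Θ} → IdNet Θ → IdNet (map (place d) Θ)
idNet-map d h m with ∈-map⁻ (place d) m
... | ν , ν∈ , refl = placed-links d ν (h ν∈)

idNet-union : ∀ {Θ Ψ} → IdNet Θ → IdNet Ψ → IdNet (pairwiseUnion Θ Ψ)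
idNet-union f g m l with pairwise-∈⁻ m
... | ν , ξ , ν∈ , ξ∈ , refl with ∈-++⁻ ν l
... | inj₁ a = f ν∈ a
... | inj₂ b = g ξ∈ b

idNet-sum : ∀ {Θ Ψ} → IdNet Θ → IdNet Ψ → IdNet (Θ ++ Ψ)
idNet-sum {Θ} f g m with ∈-++⁻ Θ m
... | inj₁ a = f a
... | inj₂ b = g b

idNet-links : ∀ A → IdNet (idNet A)
idNet-links (var x) (here refl) (here refl) = right []
idNet-links (dual x) (here refl) (here refl) = left []
idNet-links (A ⊗ B) = idNet-union (idNet-map L (idNet-links A)) (idNet-map R (idNet-links B))
idNet-links (A ⅋ B) = idNet-union (idNet-map L (idNet-links A)) (idNet-map R (idNet-links B))
idNet-links (A & B) = idNet-sum (idNet-map L (idNet-links A)) (idNet-map R (idNet-links B))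
idNet-links (A ⊕ B) = idNet-sum (idNet-map L (idNet-links A)) (idNet-map R (idNet-links B))

idNet-lk : ∀ A {ν u v} → ν ∈ idNet A → Lk ν u v → IdPair u v
idNet-lk A h (fwd l) = idNet-links A h l
idNet-lk A h (bwd l) = idPair-sym (idNet-links A h l)

idPair-right : ∀ {p v} → IdPair (pos R p) v → v ≡ pos L (co p)
idPair-right (right p) = refl

idPair-left : ∀ {q v} → IdPair (pos L q) v → v ≡ pos R (co q)
idPair-left (left p) = cong (pos R) (sym (co-co p))

idNet-leaves : ∀ A {ν} → ν ∈ idNet A → ∀ p → pos R p ∈ leaves ν ⇔ pos L (co p) ∈ leaves ν
idNet-leaves A {ν} h p = mk⇔
  (λ m → case leaf-linked m of λ { (v , l) →
    subst (_∈ leaves ν) (idPair-right (idNet-lk A h l)) (lk-leafʳ l) })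
  (λ m → case leaf-linked m of λ { (v , l) →
    subst (_∈ leaves ν) (trans (idPair-left (idNet-lk A h l)) (cong (pos R) (co-co p))) (lk-leafʳ l) })

FollowedBy : Formula → (Path → Dir) → Linking → Set
FollowedBy A f ν = ∀ p → pos R p ∈ leaves ν ⇔ Follows A f p

place-leaves : ∀ d A {ν p} → ν ∈ idNet A → pos R p ∈ leaves (place d ν) → ∃[ q ] (p ≡ d ∷ q × pos R q ∈ leaves ν)
place-leaves d A {ν} h m with ∈-ren⁻ (reloc d (opp d)) {ν} m
... | u , u∈ , e with leaf-linked u∈
... | v , l with idNet-lk A h l
place-leaves d A h m | .(pos R p) , u∈ , refl | _ | right p = p , refl , u∈

follows-head : ∀ k {A B f p} → Follows (node k A B) f p → ∃[ d ] ∃[ q ] p ≡ d ∷ q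
follows-head k {p = []} h = ⊥-elim (node-root {k} (is-leaf h))
follows-head k {p = d ∷ q} h = d , q , refl

union-follows : ∀ k {A B f ν ξ} → Multiplicative k → ν ∈ idNet A → ξ ∈ idNet B →
  FollowedBy A (λ z → f (L ∷ z)) ν → FollowedBy B (λ z → f (R ∷ z)) ξ →
  FollowedBy (node k A B) f (place L ν ++ place R ξ)
union-follows k {A} {B} {f} {ν} {ξ} m ν∈ ξ∈ fν fξ p = mk⇔ there-and back-again
  where
  there-and : pos R p ∈ leaves (place L ν ++ place R ξ) → Follows (node k A B) f p
  there-and h with ∈-++⁻ (leaves (place L ν)) (subst (pos R p ∈_) (leaves-++ (place L ν) (place R ξ)) h)
  ... | inj₁ a with place-leaves L A ν∈ a
  ...   | q , refl , q∈ = follows-node⁺ k L (to (fν q) q∈) (λ a → ⊥-elim (mul-not-add m a))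
  there-and h | inj₂ b with place-leaves R B ξ∈ b
  ...   | q , refl , q∈ = follows-node⁺ k R (to (fξ q) q∈) (λ a → ⊥-elim (mul-not-add m a))
  back-again : Follows (node k A B) f p → pos R p ∈ leaves (place L ν ++ place R ξ)
  back-again h with follows-head k h
  ... | L , q , refl = subst (pos R p ∈_) (sym (leaves-++ (place L ν) (place R ξ)))
    (∈-++⁺ˡ (∈-ren⁺ (reloc L R) {ν} (from (fν q) (proj₁ (follows-node⁻ {k} h)))))
  ... | R , q , refl = subst (pos R p ∈_) (sym (leaves-++ (place L ν) (place R ξ)))
    (∈-++⁺ʳ (leaves (place L ν)) (∈-ren⁺ (reloc R L) {ξ} (from (fξ q) (proj₁ (follows-node⁻ {k} h)))))

place-follows : ∀ k d {A B f ν} → Additive k → f [] ≡ d → ν ∈ idNet (pick d A B) →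
  FollowedBy (pick d A B) (λ z → f (d ∷ z)) ν → FollowedBy (node k A B) f (place d ν)
place-follows k d {A} {B} {f} {ν} a e ν∈ fν p = mk⇔
  (λ h → case place-leaves d (pick d A B) ν∈ h of λ { (q , refl , q∈) → follows-node⁺ k d (to (fν q) q∈) (λ _ → e) })
  back-again
  where
  back-again : Follows (node k A B) f p → pos R p ∈ leaves (place d ν)
  back-again h with follows-head k h
  ... | d' , q , refl with follows-node⁻ {k} h
  ... | h' , c with trans (sym e) (c a)
  ... | refl = ∈-ren⁺ (reloc d (opp d)) {ν} (from (fν q) h')

-- At an additive vertex the summand named by `f []` is taken. Only the leaves on A are controlled
-- here; those on the dual formula are then determined by `idNet-leaves`.
idNet-follows : ∀ A f → ∃[ ν ] (ν ∈ idNet A × FollowedBy A f ν)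
idNet-follows (var x) f = _ , here refl , λ p → mk⇔
  (λ { (here refl) → follows-atom var⁺ ; (there (here ())) ; (there (there ())) })
  (λ h → subst (λ q → pos R q ∈ _) (sym (leaf-atom var⁺ (is-leaf h))) (here refl))
idNet-follows (dual x) f = _ , here refl , λ p → mk⇔
  (λ { (here ()) ; (there (here refl)) → follows-atom dual⁻ ; (there (there ())) })
  (λ h → subst (λ q → pos R q ∈ _) (sym (leaf-atom dual⁻ (is-leaf h))) (there (here refl)))
idNet-follows (A ⊗ B) f with idNet-follows A (λ z → f (L ∷ z)) | idNet-follows B (λ z → f (R ∷ z))
... | ν , ν∈ , fν | ξ , ξ∈ , fξ = _ , pairwise-∈⁺ (∈-map⁺ (place L) ν∈) (∈-map⁺ (place R) ξ∈) ,
  union-follows ⊗ₖ mul-⊗ ν∈ ξ∈ fν fξ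
idNet-follows (A ⅋ B) f with idNet-follows A (λ z → f (L ∷ z)) | idNet-follows B (λ z → f (R ∷ z))
... | ν , ν∈ , fν | ξ , ξ∈ , fξ = _ , pairwise-∈⁺ (∈-map⁺ (place L) ν∈) (∈-map⁺ (place R) ξ∈) ,
  union-follows ⅋ₖ mul-⅋ ν∈ ξ∈ fν fξ
idNet-follows (A & B) f with f [] in e
... | L with idNet-follows A (λ z → f (L ∷ z))
...   | ν , ν∈ , fν = _ , ∈-++⁺ˡ (∈-map⁺ (place L) ν∈) , place-follows &ₖ L add-& e ν∈ fν
idNet-follows (A & B) f | R with idNet-follows B (λ z → f (R ∷ z))
...   | ν , ν∈ , fν = _ , ∈-++⁺ʳ (map (place L) (idNet A)) (∈-map⁺ (place R) ν∈) , place-follows &ₖ R add-& e ν∈ fν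
idNet-follows (A ⊕ B) f with f [] in e
... | L with idNet-follows A (λ z → f (L ∷ z))
...   | ν , ν∈ , fν = _ , ∈-++⁺ˡ (∈-map⁺ (place L) ν∈) , place-follows ⊕ₖ L add-⊕ e ν∈ fν
idNet-follows (A ⊕ B) f | R with idNet-follows B (λ z → f (R ∷ z))
...   | ν , ν∈ , fν = _ , ∈-++⁺ʳ (map (place L) (idNet A)) (∈-map⁺ (place R) ν∈) , place-follows ⊕ₖ R add-⊕ e ν∈ fν

-- Composition

sides : Formula → Formula → Dir → Formula
sides X Y L = X
sides X Y R = Y

LinkingsOf : (Dir → Formula) → Net → Set
LinkingsOf F θ = ∀ {κ} → κ ∈ θ → IsLinking (two F) κ

MatchedOver : Linking → Linking → Set
MatchedOver κ μ = ∀ p → pos R p ∈ leaves κ ⇔ pos L (co p) ∈ leaves μ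

-- `linkLL` and `linkRR` serve to exclude links within one conclusion. Once these are excluded,
-- every trace consists of one link of each net, which is what `linkLR` records.
record Traces (κ μ ν : Linking) : Set where
  field
    leavesL : ∀ p → pos L p ∈ leaves κ ⇔ pos L p ∈ leaves ν
    leavesR : ∀ p → pos R p ∈ leaves μ ⇔ pos R p ∈ leaves ν
    linkLL : ∀ {p q} → Lk κ (pos L p) (pos L q) → Lk ν (pos L p) (pos L q)
    linkRR : ∀ {p q} → Lk μ (pos R p) (pos R q) → Lk ν (pos R p) (pos R q)
    linkLR : ∀ {p b q} → Lk κ (pos L p) (pos R b) → Lk μ (pos L (co b)) (pos R q) → Lk ν (pos L p) (pos R q)

module Compose (X C Y : Formula) (θ ψ : Net) (lθ : LinkingsOf (sides X C) θ) (lψ : LinkingsOf (sides (neg C) Y) ψ) where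

  module Tθ = TwoSided (sides X C)
  module Tψ = TwoSided (sides (neg C) Y)

  _∙_ : Linking → Linking → Linking
  κ ∙ μ = renLinking compLeft κ ++ renLinking compRight μ

  compose-∈⁻ : ∀ {Θ ξ} → ξ ∈ composeNet Θ ψ → ∃[ κ ] ∃[ μ ] (κ ∈ Θ × μ ∈ ψ × ξ ≡ κ ∙ μ)
  compose-∈⁻ {κ ∷ Θ} h with ∈-++⁻ (map (λ μ → κ ∙ μ) ψ) h
  ... | inj₁ m with ∈-map⁻ (λ μ → κ ∙ μ) m
  ...   | μ , μ∈ , refl = κ , μ , here refl , μ∈ , refl
  compose-∈⁻ {κ ∷ Θ} h | inj₂ m with compose-∈⁻ {Θ} m
  ... | κ' , μ , a , b , e = κ' , μ , there a , b , e

  compose-∈⁺ : ∀ {Θ κ μ} → κ ∈ Θ → μ ∈ ψ → (κ ∙ μ) ∈ composeNet Θ ψ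
  compose-∈⁺ {κ = κ} (here refl) h = ∈-++⁺ˡ (∈-map⁺ (λ μ → κ ∙ μ) h)
  compose-∈⁺ {κ' ∷ Θ} (there m) h = ∈-++⁺ʳ (map (λ μ → κ' ∙ μ) ψ) (compose-∈⁺ m h)

  module Pair {κ μ} (κ∈ : κ ∈ θ) (μ∈ : μ ∈ ψ) where
    module Oκ = Tθ.OneLinking (lθ κ∈)
    module Oμ = Tψ.OneLinking (lψ μ∈)

    data Origin (w : Pos) : Set where
      fromθL : ∀ p → pos L p ∈ leaves κ → w ≡ pos L p → Origin w
      fromθR : ∀ p → pos R p ∈ leaves κ → w ≡ (cutL 0 , p) → Origin w
      fromψL : ∀ p → pos L p ∈ leaves μ → w ≡ (cutR 0 , p) → Origin w
      fromψR : ∀ p → pos R p ∈ leaves μ → w ≡ pos R p → Origin w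

    origin : ∀ {w} → w ∈ leaves (κ ∙ μ) → Origin w
    origin {w} h with ∈-++⁻ (leaves (renLinking compLeft κ)) (subst (w ∈_) (leaves-++ (renLinking compLeft κ) _) h)
    ... | inj₁ a with ∈-ren⁻ compLeft {κ} a
    ...   | u , u∈ , e with Oκ.leaf-side u∈
    ...   | L , p , refl , _ = fromθL p u∈ e
    ...   | R , p , refl , _ = fromθR p u∈ e
    origin h | inj₂ b with ∈-ren⁻ compRight {μ} b
    ...   | u , u∈ , e with Oμ.leaf-side u∈
    ...   | L , p , refl , _ = fromψL p u∈ e
    ...   | R , p , refl , _ = fromψR p u∈ e

    inθ : ∀ {u} → u ∈ leaves κ → compLeft u ∈ leaves (κ ∙ μ)
    inθ h = subst (_ ∈_) (sym (leaves-++ (renLinking compLeft κ) _)) (∈-++⁺ˡ (∈-ren⁺ compLeft {κ} h))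

    inψ : ∀ {u} → u ∈ leaves μ → compRight u ∈ leaves (κ ∙ μ)
    inψ h = subst (_ ∈_) (sym (leaves-++ (renLinking compLeft κ) _))
      (∈-++⁺ʳ (leaves (renLinking compLeft κ)) (∈-ren⁺ compRight {μ} h))

    atθL : ∀ {p} → pos L p ∈ leaves (κ ∙ μ) → pos L p ∈ leaves κ
    atθL h with origin h
    ... | fromθL p m refl = m

    atθR : ∀ {p} → (cutL 0 , p) ∈ leaves (κ ∙ μ) → pos R p ∈ leaves κ
    atθR h with origin h
    ... | fromθR p m refl = m

    atψL : ∀ {p} → (cutR 0 , p) ∈ leaves (κ ∙ μ) → pos L p ∈ leaves μ
    atψL h with origin h
    ... | fromψL p m refl = m

    atψR : ∀ {p} → pos R p ∈ leaves (κ ∙ μ) → pos R p ∈ leaves μ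
    atψR h with origin h
    ... | fromψR p m refl = m

    lkθ : ∀ {u v} → Lk κ u v → Lk (κ ∙ μ) (compLeft u) (compLeft v)
    lkθ (fwd h) = fwd (∈-++⁺ˡ (∈-map⁺ (mapLink compLeft) h))
    lkθ (bwd h) = bwd (∈-++⁺ˡ (∈-map⁺ (mapLink compLeft) h))

    lkψ : ∀ {u v} → Lk μ u v → Lk (κ ∙ μ) (compRight u) (compRight v)
    lkψ (fwd h) = fwd (∈-++⁺ʳ (renLinking compLeft κ) (∈-map⁺ (mapLink compRight) h))
    lkψ (bwd h) = bwd (∈-++⁺ʳ (renLinking compLeft κ) (∈-map⁺ (mapLink compRight) h))

    unique-composite : Unique (leaves (κ ∙ μ))
    unique-composite = subst Unique (sym (leaves-++ (renLinking compLeft κ) _)) (Unique-++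
      (subst Unique (sym (leaves-ren compLeft κ)) (unique-map compLeft injθ Oκ.unique-leaves))
      (subst Unique (sym (leaves-ren compRight μ)) (unique-map compRight injψ Oμ.unique-leaves))
      λ { (a , b) → disjoint a b })
      where
      decodeθ decodeψ : Pos → Pos
      decodeθ (cutL n , p) = pos R p
      decodeθ v = v
      decodeψ (cutR n , p) = pos L p
      decodeψ v = v
      retractθ : ∀ {u} → u ∈ leaves κ → decodeθ (compLeft u) ≡ u
      retractθ u∈ with Oκ.leaf-side u∈
      ... | L , p , refl , _ = refl
      ... | R , p , refl , _ = refl
      retractψ : ∀ {u} → u ∈ leaves μ → decodeψ (compRight u) ≡ u
      retractψ u∈ with Oμ.leaf-side u∈
      ... | L , p , refl , _ = refl
      ... | R , p , refl , _ = refl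
      injθ : ∀ {u v} → u ∈ leaves κ → v ∈ leaves κ → compLeft u ≡ compLeft v → u ≡ v
      injθ u∈ v∈ e = trans (sym (retractθ u∈)) (trans (cong decodeθ e) (retractθ v∈))
      injψ : ∀ {u v} → u ∈ leaves μ → v ∈ leaves μ → compRight u ≡ compRight v → u ≡ v
      injψ u∈ v∈ e = trans (sym (retractψ u∈)) (trans (cong decodeψ e) (retractψ v∈))
      disjoint : ∀ {w} → w ∈ leaves (renLinking compLeft κ) → w ∈ leaves (renLinking compRight μ) → ⊥
      disjoint a b with ∈-ren⁻ compLeft {κ} a | ∈-ren⁻ compRight {μ} b
      ... | u , u∈ , e | v , v∈ , e' with Oκ.leaf-side u∈ | Oμ.leaf-side v∈
      disjoint a b | u , u∈ , refl | v , v∈ , () | L , p , refl , _ | L , q , refl , _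
      disjoint a b | u , u∈ , refl | v , v∈ , () | L , p , refl , _ | R , q , refl , _
      disjoint a b | u , u∈ , refl | v , v∈ , () | R , p , refl , _ | L , q , refl , _
      disjoint a b | u , u∈ , refl | v , v∈ , () | R , p , refl , _ | R , q , refl , _

    good-composite : Good ((0 , C) ∷ []) (κ ∙ μ)
    good-composite = record
      { unique = unique-composite
      ; sliceL = λ { (here refl) → slice-follows (Oκ.choice R) (λ h → Oκ.leaves-follow R (atθR h)) }
      ; sliceR = λ { (here refl) → slice-follows (Oμ.choice L) (λ h → Oμ.leaves-follow L (atψL h)) }
      ; coverL = λ h → case origin h of λ { (fromθR p _ refl) → here refl }
      ; coverR = λ h → case origin h of λ { (fromψL p _ refl) → here refl } }

    matched⁺ : MatchedOver κ μ → Matched (κ ∙ μ)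
    matched⁺ M _ _ (LR {n} {p}) h with origin h
    ... | fromθR p m refl = inψ (to (M p) m)
    matched⁺ M _ _ (RL {n} {p}) h with origin h
    ... | fromψL p m refl = inθ (from (M (co p)) (subst (λ q → pos L q ∈ leaves μ) (sym (co-co p)) m))

    matched⁻ : Matched (κ ∙ μ) → MatchedOver κ μ
    matched⁻ M p = mk⇔ (λ h → atψL (M _ _ LR (inθ h)))
      (λ h → subst (λ q → pos R q ∈ leaves κ) (co-co p) (atθR (M _ _ RL (inψ h))))

  good-config : GoodConfig (composeSeq X C Y , composeNet θ ψ)
  good-config = ([] ∷ []) , λ h → case compose-∈⁻ h of λ { (κ , μ , κ∈ , μ∈ , refl) → Pair.good-composite κ∈ μ∈ }

  module Reduced (red : ReducesTo (composeSeq X C Y , composeNet θ ψ) (cutFree (neg Y ∷ Y ∷ []) , idNet Y)) where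

    final : Net
    final = proj₁ red

    sim : GoodConfig (cutFree (neg Y ∷ Y ∷ []) , final) × Simulates (composeNet θ ψ) final
    sim = steps-simulate (proj₁ (proj₂ red)) good-config

    no-cutL : ∀ {ν n p} → ν ∈ final → (cutL n , p) ∉ leaves ν
    no-cutL h m with Good.coverL (proj₂ (proj₁ sim) h) m
    ... | ()

    no-cutR : ∀ {ν n p} → ν ∈ final → (cutR n , p) ∉ leaves ν
    no-cutR h m with Good.coverR (proj₂ (proj₁ sim) h) m
    ... | ()

    -- Vacuous, since no cut remains for a leaf to lie on. This is what starts the pull-back from
    -- the identity to the composite.
    matched-final : ∀ {ν} → ν ∈ final → Matched ν
    matched-final h _ _ LR m = ⊥-elim (no-cutL h m)
    matched-final h _ _ RL m = ⊥-elim (no-cutR h m)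

    conn-final : ∀ {ν u v} → ν ∈ final → Conn ν u v → Lk ν u v
    conn-final h (direct l) = l
    conn-final h (via LR l _) = ⊥-elim (no-cutL h (lk-leafʳ l))
    conn-final h (via RL l _) = ⊥-elim (no-cutR h (lk-leafʳ l))

    lk-≈ : ∀ {ν ν' u v} → ν ≈L ν' → Lk ν u v → Lk ν' u v
    lk-≈ e (fwd h) = fwd (to (e _) h)
    lk-≈ e (bwd h) = bwd (to (e _) h)

    leaves-≈ : ∀ {ν ν' u} → ν ≈L ν' → u ∈ leaves ν → u ∈ leaves ν'
    leaves-≈ e h = lk-leafˡ (lk-≈ e (proj₂ (leaf-linked h)))

    ≈-sym : ∀ {ν ν'} → ν ≈L ν' → ν' ≈L ν
    ≈-sym e a = ⇔-sym (e a)

    traces : ∀ {κ μ ν ν'} → κ ∈ θ → μ ∈ ψ → ν ∈ final → (κ ∙ μ) ⊑ ν → ν ≈L ν' → Traces κ μ ν'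
    traces {κ} {μ} {ν} {ν'} κ∈ μ∈ ν∈ r e = record
      { leavesL = λ p → mk⇔ (λ h → leaves-≈ e (leaves-⇒ r (inθ h))) (λ h → atθL (leaves-⇐ r (leaves-≈ (≈-sym e) h)))
      ; leavesR = λ p → mk⇔ (λ h → leaves-≈ e (leaves-⇒ r (inψ h))) (λ h → atψR (leaves-⇐ r (leaves-≈ (≈-sym e) h)))
      ; linkLL = λ l → lk-≈ e (conn-final ν∈ (conn-⇒ r (direct (lkθ l))))
      ; linkRR = λ l → lk-≈ e (conn-final ν∈ (conn-⇒ r (direct (lkψ l))))
      ; linkLR = λ l l' → lk-≈ e (conn-final ν∈ (conn-⇒ r (via LR (lkθ l) (lkψ l')))) }
      where open Pair κ∈ μ∈

    forth : ∀ {κ μ} → κ ∈ θ → μ ∈ ψ → MatchedOver κ μ → ∃[ ν ] (ν ∈ idNet Y × Traces κ μ ν)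
    forth κ∈ μ∈ M with Simulates.forth (proj₂ sim) (compose-∈⁺ κ∈ μ∈) (Pair.matched⁺ κ∈ μ∈ M)
    ... | ν , ν∈ , _ , r with proj₁ (proj₂ (proj₂ red)) ν ν∈
    ... | ν' , ν'∈ , e = ν' , ν'∈ , traces κ∈ μ∈ ν∈ r e

    back : ∀ {ν} → ν ∈ idNet Y → ∃[ κ ] ∃[ μ ] (κ ∈ θ × μ ∈ ψ × MatchedOver κ μ × Traces κ μ ν)
    back {ν'} h with proj₂ (proj₂ (proj₂ red)) ν' h
    ... | ν , ν∈ , e with Simulates.back (proj₂ sim) ν∈ (matched-final ν∈)
    ... | ξ , ξ∈ , M , r with compose-∈⁻ ξ∈
    ... | κ , μ , κ∈ , μ∈ , refl = κ , μ , κ∈ , μ∈ , Pair.matched⁻ κ∈ μ∈ M , traces κ∈ μ∈ ν∈ r e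

-- Mutually inverse proof-nets

Bipartite : Net → Set
Bipartite θ = ∀ {κ} → κ ∈ θ → ∀ t {a b} → ¬ Lk κ (pos t a) (pos t b)

Inverse : Linking → Linking → Set
Inverse κ μ = ∀ t {a b} → Lk κ (pos t a) (pos (opp t) b) ⇔ Lk μ (pos (opp t) (co a)) (pos t (co b))

inverse-sym : ∀ {κ μ} → Inverse κ μ → Inverse μ κ
inverse-sym {κ} {μ} i t {a} {b} = mk⇔
  (λ l → lk-sym (from (i t) (lk-sym (subst₂ (λ x y → Lk μ (pos t x) (pos (opp t) y)) (sym (co-co a)) (sym (co-co b)) l))))
  (λ l → lk-sym (subst₂ (λ x y → Lk μ (pos (opp t) x) (pos t y)) (co-co b) (co-co a) (to (i t) (lk-sym l))))

Inverses : Net → Net → Set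
Inverses θ ψ = ∀ {κ} → κ ∈ θ → ∃[ μ ] (μ ∈ ψ × Inverse κ μ)

RealisesChoices : (Dir → Formula) → Net → Set
RealisesChoices F θ = ∀ t f → ∃[ κ ] (κ ∈ θ × (∀ p → pos t p ∈ leaves κ ⇔ Follows (F t) f p))

follows-co : ∀ {A f p} → Follows A (coChoice f) p ⇔ Follows (neg A) f (co p)
follows-co {A} {f} {p} = mk⇔ (λ h → follows-resp (coChoice-co f) (follows-neg h))
  (λ h → subst (Follows A (coChoice f)) (co-co p) (follows-neg⁻ h))

module Matching (A B : Formula) (θ ψ : Net)
  (lθ : LinkingsOf (sides (neg A) B) θ) (lψ : LinkingsOf (sides (neg B) A) ψ)
  (red₁ : ReducesTo (composeSeq (neg A) B A , composeNet θ ψ) (cutFree (neg A ∷ A ∷ []) , idNet A))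
  (red₂ : ReducesTo (composeSeq (neg B) A B , composeNet ψ θ) (cutFree (neg B ∷ B ∷ []) , idNet B)) where

  module T = TwoSided (sides (neg A) B)
  module C₁ = Compose (neg A) B A θ ψ lθ lψ
  module C₂ = Compose (neg B) A B ψ θ lψ lθ
  module R₁ = C₁.Reduced red₁
  module R₂ = C₂.Reduced red₂

  -- The choices of `κ` on B are those of some identity linking of B, which comes from a matched
  -- pair of ψ and θ. The member in θ may differ from `κ`, but the member in ψ has the dual leaves
  -- on B^⊥.
  match-B : ∀ {κ} → κ ∈ θ → ∃[ μ ] (μ ∈ ψ × MatchedOver κ μ)
  match-B {κ} κ∈ with idNet-follows B (T.OneLinking.choice (lθ κ∈) R)
  ... | ν , ν∈ , fν with R₂.back ν∈
  ... | μ , κ' , μ∈ , _ , _ , tr = μ , μ∈ , λ p →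
    ⇔-trans (mk⇔ (O.leaves-follow R) (O.follow-leaves R))
    (⇔-trans (⇔-sym (fν p)) (⇔-trans (idNet-leaves B ν∈ p) (⇔-sym (Traces.leavesL tr (co p)))))
    where module O = T.OneLinking (lθ κ∈)

  match-A : ∀ {κ} → κ ∈ θ → ∃[ μ ] (μ ∈ ψ × MatchedOver μ κ)
  match-A {κ} κ∈ with idNet-follows A (coChoice (T.OneLinking.choice (lθ κ∈) L))
  ... | ν , ν∈ , fν with R₁.back ν∈
  ... | κ' , μ , _ , μ∈ , _ , tr = μ , μ∈ , λ p →
    ⇔-trans (Traces.leavesR tr p) (⇔-trans (fν p) (⇔-trans follows-co
      (mk⇔ (O.follow-leaves L) (O.leaves-follow L))))
    where module O = T.OneLinking (lθ κ∈)

  -- Composed with a matching linking, a link within one conclusion would survive unchanged in an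
  -- identity linking, all of whose links cross.
  bipartite : Bipartite θ
  bipartite κ∈ L l with match-B κ∈
  ... | μ , μ∈ , M with R₁.forth κ∈ μ∈ M
  ... | ν , ν∈ , tr with idNet-lk A ν∈ (Traces.linkLL tr l)
  ... | ()
  bipartite κ∈ R l with match-A κ∈
  ... | μ , μ∈ , M with R₂.forth μ∈ κ∈ M
  ... | ν , ν∈ , tr with idNet-lk B ν∈ (Traces.linkRR tr l)
  ... | ()

  realises-choices : RealisesChoices (sides (neg A) B) θ
  realises-choices R f with idNet-follows B f
  ... | ν , ν∈ , fν with R₂.back ν∈
  ... | μ , κ , _ , κ∈ , _ , tr = κ , κ∈ , λ p → ⇔-trans (Traces.leavesR tr p) (fν p)
  realises-choices L f with idNet-follows A (coChoice f)
  ... | ν , ν∈ , fν with R₁.back ν∈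
  ... | κ , μ , κ∈ , _ , _ , tr = κ , κ∈ , λ p → ⇔-trans (Traces.leavesL tr p)
    (subst (λ q → pos L q ∈ leaves ν ⇔ Follows (neg A) f q) (co-co p)
      (⇔-trans (⇔-sym (idNet-leaves A ν∈ (co p))) (⇔-trans (fν (co p)) follows-co)))

  -- A link of `κ` arrives at a leaf of B, whose dual is linked in `μ` to some leaf of A by
  -- bipartiteness of ψ; the identity identifies that leaf as the dual of the starting one.
  inverses : Bipartite ψ → Inverses θ ψ
  inverses bψ {κ} κ∈ with match-B κ∈
  ... | μ , μ∈ , M with R₁.forth κ∈ μ∈ M
  ... | ν , ν∈ , tr = μ , μ∈ , inverse
    where
    module Oκ = T.OneLinking (lθ κ∈)
    module Oμ = TwoSided.OneLinking (sides (neg B) A) (lψ μ∈)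
    forward : ∀ {a b} → Lk κ (pos L a) (pos R b) → Lk μ (pos L (co b)) (pos R (co a))
    forward {a} {b} l with leaf-linked (to (M b) (lk-leafʳ l))
    ... | v , m with Oμ.leaf-side (lk-leafʳ m)
    ... | L , q , refl , _ = ⊥-elim (bψ μ∈ L m)
    ... | R , q , refl , _ =
      subst (Lk μ (pos L (co b))) (idPair-left (idNet-lk A ν∈ (Traces.linkLR tr l m))) m
    backward : ∀ {a b} → Lk μ (pos L (co b)) (pos R (co a)) → Lk κ (pos L a) (pos R b)
    backward {a} {b} m with leaf-linked (from (M b) (lk-leafˡ m))
    ... | v , l with Oκ.leaf-side (lk-leafʳ l)
    ... | R , q , refl , _ = ⊥-elim (bipartite κ∈ R l)
    ... | L , q , refl , _ = subst (λ x → Lk κ (pos L x) (pos R b))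
      (co-injective (pos-injective {R} (lk-functional Oμ.unique-leaves (forward (lk-sym l)) m))) (lk-sym l)
    inverse : Inverse κ μ
    inverse L = mk⇔ (λ l → lk-sym (forward l)) (λ m → backward (lk-sym m))
    inverse R = mk⇔ (λ l → forward (lk-sym l)) (λ m → lk-sym (backward m))

-- Cycles through two branches of a syntax tree

down up : Root → Path → Path → List EKey
down r z [] = []
down r z (d ∷ s) = tree r z d ∷ down r (z ∷ʳ d) s
up r z [] = []
up r z (d ∷ s) = up r (z ∷ʳ d) s ++ tree r z d ∷ []

OnBranch : Path → Path → Path → Dir → Set
OnBranch z s q e = ∃[ s₁ ] ∃[ s₂ ] (s ≡ s₁ ++ e ∷ s₂ × q ≡ z ++ s₁)

branch-here : ∀ {z d s} → OnBranch z (d ∷ s) z d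
branch-here {z} {d} {s} = [] , s , refl , sym (++-identityʳ z)

branch-there : ∀ {z d s q e} → OnBranch (z ∷ʳ d) s q e → OnBranch z (d ∷ s) q e
branch-there {z} {d} (s₁ , s₂ , refl , refl) = d ∷ s₁ , s₂ , refl , ∷ʳ-++ z d s₁

branch-proper : ∀ {z d s q e} → OnBranch (z ∷ʳ d) s q e → q ≢ z
branch-proper {z} {d} (s₁ , _ , _ , refl) eq
  with ++-cancelˡ z _ _ (trans (sym (∷ʳ-++ z d s₁)) (trans eq (sym (++-identityʳ z))))
... | ()

down-member : ∀ r z s {k} → k ∈ down r z s → ∃[ q ] ∃[ e ] (k ≡ tree r q e × OnBranch z s q e)
down-member r z (d ∷ s) (here refl) = _ , d , refl , branch-here
down-member r z (d ∷ s) (there h) with down-member r (z ∷ʳ d) s h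
... | q , e , eq , b = q , e , eq , branch-there b

up-member : ∀ r z s {k} → k ∈ up r z s → ∃[ q ] ∃[ e ] (k ≡ tree r q e × OnBranch z s q e)
up-member r z (d ∷ s) h with ∈-++⁻ (up r (z ∷ʳ d) s) h
... | inj₂ (here refl) = z , d , refl , branch-here
... | inj₁ h' with up-member r (z ∷ʳ d) s h'
...   | q , e , eq , b = q , e , eq , branch-there b

down-unique : ∀ r z s → Unique (down r z s)
down-unique r z [] = []
down-unique r z (d ∷ s) =
  All.tabulate (λ { h refl → case down-member r (z ∷ʳ d) s h of λ { (_ , _ , refl , b) → branch-proper b refl } })
  ∷ down-unique r (z ∷ʳ d) s

up-unique : ∀ r z s → Unique (up r z s)
up-unique r z [] = []
up-unique r z (d ∷ s) = Unique-++ (up-unique r (z ∷ʳ d) s) ([] ∷ [])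
  λ { (h , here refl) → case up-member r (z ∷ʳ d) s h of λ { (_ , _ , refl , b) → branch-proper b refl } }

walk-++ : ∀ {E u v w ks ls} → Walk E u v ks → Walk E v w ls → Walk E u w (ks ++ ls)
walk-++ nil w' = w'
walk-++ (cons e a w) w' = cons e a (walk-++ w w')

walk-down : ∀ {E r} z s → (∀ {q e} → OnBranch z s q e → E (tree r q e)) → Walk E (r , z) (r , z ++ s) (down r z s)
walk-down {E} {r} z [] h = subst (λ q → Walk E (r , z) (r , q) []) (sym (++-identityʳ z)) nil
walk-down {E} {r} z (d ∷ s) h = cons (h branch-here) (inj₂ (refl , refl))
  (subst (λ q → Walk E (r , z ∷ʳ d) (r , q) (down r (z ∷ʳ d) s)) (∷ʳ-++ z d s)
    (walk-down (z ∷ʳ d) s (h ∘ branch-there)))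

walk-up : ∀ {E r} z s → (∀ {q e} → OnBranch z s q e → E (tree r q e)) → Walk E (r , z ++ s) (r , z) (up r z s)
walk-up {E} {r} z [] h = subst (λ q → Walk E (r , q) (r , z) []) (sym (++-identityʳ z)) nil
walk-up {E} {r} z (d ∷ s) h = walk-++
  (subst (λ q → Walk E (r , q) (r , z ∷ʳ d) (up r (z ∷ʳ d) s)) (∷ʳ-++ z d s)
    (walk-up (z ∷ʳ d) s (h ∘ branch-there)))
  (cons (h branch-here) (inj₁ (refl , refl)) nil)

branch-onPath : ∀ {z s q e} → OnBranch z s q e → OnPath (z ++ s) q e
branch-onPath {z} {e = e} (s₁ , s₂ , refl , refl) = s₂ , sym (++-assoc z s₁ (e ∷ s₂))

record InFork (z p p' q : Path) (e : Dir) : Set where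
  constructor inFork
  field
    on-path : OnPath p q e ⊎ OnPath p' q e
    suffix  : Path
    below-z : q ≡ z ++ suffix

not-both-branches : ∀ {z p p' q e e' t} → Fork z p p' → q ≡ z ++ t → OnPath p q e → OnPath p' q e' → q ≡ z
not-both-branches {z} {t = []} f eq a b = trans eq (++-identityʳ z)
not-both-branches {z} {t = x ∷ t} f refl (s , refl) (s' , refl) = ⊥-elim (apart' f)
  where
  apart' : ∀ {e e' s s'} → ¬ Fork z ((z ++ x ∷ t) ++ e ∷ s) ((z ++ x ∷ t) ++ e' ∷ s')
  apart' f with fork-onPath f
  ... | d , (r , eq) , (r' , eq')
    with ∷-injectiveˡ (++-cancelˡ z _ _ (trans (sym (++-assoc z (x ∷ t) _)) eq))
       | ∷-injectiveˡ (++-cancelˡ z _ _ (trans (sym (++-assoc z (x ∷ t) _)) eq'))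
  ... | refl | e = opp-≢ x (sym e)

-- Only the top vertex `z` can be entered through both premises, so a path over a fork respects
-- switchings as soon as `z` is neither ⅋ nor &.
inFork-direction : ∀ {z p p' q e e'} → Fork z p p' → InFork z p p' q e → InFork z p p' q e' → q ≡ z ⊎ e ≡ e'
inFork-direction f (inFork (inj₁ a) _ _) (inFork (inj₁ b) _ _) = inj₂ (onPath-functional a b)
inFork-direction f (inFork (inj₂ a) _ _) (inFork (inj₂ b) _ _) = inj₂ (onPath-functional a b)
inFork-direction f (inFork (inj₁ a) _ eq) (inFork (inj₂ b) _ _) = inj₁ (not-both-branches f eq a b)
inFork-direction f (inFork (inj₂ a) _ eq) (inFork (inj₁ b) _ _) = inj₁ (not-both-branches f eq b a)

-- The edge set is left open because the same path is used in a ⅋-switching for (P2) and in the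
-- graph with jumps for (P3).
record TreePath (r : Root) (z p p' : Path) : Set₁ where
  field
    keys   : List EKey
    walk   : ∀ {E : EKey → Set} → (∀ {q e} → InFork z p p' q e → E (tree r q e)) → Walk E (r , p) (r , p') keys
    unique : Unique keys
    member : ∀ {k} → k ∈ keys → ∃[ q ] ∃[ e ] (k ≡ tree r q e × InFork z p p' q e)

treePath : ∀ r {z p p'} → Fork z p p' → TreePath r z p p'
treePath r {z} (fork d s s') = record
  { keys = up r z (d ∷ s) ++ down r z (opp d ∷ s')
  ; walk = λ h → walk-++ (walk-up z (d ∷ s) (h ∘ left-branch)) (walk-down z (opp d ∷ s') (h ∘ right-branch))
  ; unique = Unique-++ (up-unique r z (d ∷ s)) (down-unique r z (opp d ∷ s')) λ { (a , b) →
      clash (up-member r z (d ∷ s) a) (down-member r z (opp d ∷ s') b) }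
  ; member = λ h → case ∈-++⁻ (up r z (d ∷ s)) h of λ where
      (inj₁ a) → case up-member r z (d ∷ s) a of λ { (q , e , eq , b) → q , e , eq , left-branch b }
      (inj₂ a) → case down-member r z (opp d ∷ s') a of λ { (q , e , eq , b) → q , e , eq , right-branch b }
  }
  where
  left-branch : ∀ {q e} → OnBranch z (d ∷ s) q e → InFork z (z ++ d ∷ s) (z ++ opp d ∷ s') q e
  left-branch b@(t , _ , _ , eq) = inFork (inj₁ (branch-onPath b)) t eq
  right-branch : ∀ {q e} → OnBranch z (opp d ∷ s') q e → InFork z (z ++ d ∷ s) (z ++ opp d ∷ s') q e
  right-branch b@(t , _ , _ , eq) = inFork (inj₂ (branch-onPath b)) t eq
  disjoint : ∀ {q e} → OnBranch z (d ∷ s) q e → OnBranch z (opp d ∷ s') q e → ⊥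
  disjoint (t , _ , eq₁ , eq) (t' , _ , eq₂ , eq') with ++-cancelˡ z _ _ (trans (sym eq) eq')
  disjoint ([] , _ , eq₁ , eq) ([] , _ , eq₂ , eq') | refl = opp-≢ d (trans (∷-injectiveˡ eq₂) (sym (∷-injectiveˡ eq₁)))
  disjoint (x ∷ t , _ , eq₁ , eq) (.(x ∷ t) , _ , eq₂ , eq') | refl =
    opp-≢ d (trans (∷-injectiveˡ eq₂) (sym (∷-injectiveˡ eq₁)))
  clash : ∀ {k} → ∃[ q ] ∃[ e ] (k ≡ tree r q e × OnBranch z (d ∷ s) q e) →
    ∃[ q ] ∃[ e ] (k ≡ tree r q e × OnBranch z (opp d ∷ s') q e) → ⊥
  clash (q , e , refl , x) (.q , .e , refl , y) = disjoint x y

data LinkKey (u v : Pos) : EKey → Set where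
  as-is   : LinkKey u v (link u v)
  flipped : LinkKey u v (link v u)

linkKey-adj : ∀ {u v k} → LinkKey u v k → Adj k u v
linkKey-adj as-is = inj₁ (refl , refl)
linkKey-adj flipped = inj₂ (refl , refl)

linkKey-no-target : ∀ {u v k W} → LinkKey u v k → inTarget k ≢ just W
linkKey-no-target as-is ()
linkKey-no-target flipped ()

linkKey : ∀ {κ u v} → Lk κ u v → ∃[ k ] (LinkKey u v k × (∀ {E : EKey → Set} → (∀ {a b} → (a , b) ∈ κ → E (link a b)) → E k))
linkKey (fwd h) = _ , as-is , λ f → f h
linkKey (bwd h) = _ , flipped , λ f → f h

concl-side : ∀ t → concl (con t) ≢ concl (con (opp t))
concl-side L ()
concl-side R ()

next : Path → Path → Maybe Dir
next [] q = nothing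
next (d ∷ p) [] = just d
next (d ∷ p) (e ∷ q) with d ≟ᴰ e
... | yes _ = next p q
... | no _ = nothing

next-complete : ∀ p q {e} → OnPath p q e → next p q ≡ just e
next-complete (d ∷ p) [] (s , refl) = refl
next-complete [] [] (s , ())
next-complete [] (x ∷ q) (s , ())
next-complete (d ∷ p) (.d ∷ q) (s , refl) with d ≟ᴰ d
... | yes _ = next-complete p q (s , refl)
... | no ne = ⊥-elim (ne refl)

next-sound : ∀ p q {e} → next p q ≡ just e → OnPath p q e
next-sound (d ∷ p) [] refl = p , refl
next-sound (d ∷ p) (e ∷ q) h with d ≟ᴰ e
... | yes refl with next-sound p q h
...   | s , refl = s , refl
next-sound (d ∷ p) (e ∷ q) () | no _

-- It leads towards `p` wherever `p` passes, otherwise towards `p'`. The function is used as a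
-- ⅋-switching, as an additive choice and as a &-resolution; off both paths the value `L` is
-- arbitrary.
dirTo : Path → Path → Path → Dir
dirTo p p' q with next p q | next p' q
... | just d | _ = d
... | nothing | just d = d
... | nothing | nothing = L

dirTo-first : ∀ p p' {q d} → OnPath p q d → dirTo p p' q ≡ d
dirTo-first p p' {q} o with next p q | next-complete p q o
... | just d | refl = refl

dirTo-second : ∀ p p' {q d} → OnPath p' q d → ¬ Fork q p p' → dirTo p p' q ≡ d
dirTo-second p p' {q} {d} o nf with next p q in e | next p' q | next-complete p' q o
... | nothing | just .d | refl = refl
... | just d' | just .d | refl with d' ≟ᴰ d
...   | yes eq = eq
...   | no ne = ⊥-elim (nf (onPath-fork (next-sound p q e) o ne))

dirTo-swap : ∀ p p' q → ¬ Fork q p p' → dirTo p p' q ≡ dirTo p' p q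
dirTo-swap p p' q nf with next p q in e | next p' q in e'
... | nothing | nothing = refl
... | nothing | just d = refl
... | just d | nothing = refl
... | just d | just d' with d ≟ᴰ d'
...   | yes eq = eq
...   | no ne = ⊥-elim (nf (onPath-fork (next-sound p q e) (next-sound p' q e') ne))

-- (P2) is applied to the switching that deletes, at every ⅋ on the two branches, the unused premise.
unused-correct : ∀ {z p p' q e} → Fork z p p' → InFork z p p' q e → q ≢ z → e ≢ opp (dirTo p p' q)
unused-correct {p = p} {p'} {e = e} f (inFork (inj₁ a) _ _) ne h = opp-≢ e (sym (trans h (cong opp (dirTo-first p p' a))))
unused-correct {p = p} {p'} {e = e} f (inFork (inj₂ b) _ _) ne h =
  opp-≢ e (sym (trans h (cong opp (dirTo-second p p' b (λ g → ne (fork-functional g f))))))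

-- The cycle runs from `p` up to `z` and down to `p'`, along `k` to `q`, up to `z'` and down to
-- `q'`, and back by `last`, which is a link for (P2) and a jump for (P3).
module Square {r r' z z' p p' q q' k last} (f : Fork z p p') (f' : Fork z' q q') (r≢r' : r ≢ r')
  (lk : LinkKey (r , p') (r' , q) k) (not-tree : ∀ {r q e} → last ≢ tree r q e) (k≢last : k ≢ last) where

  module T = TreePath (treePath r f)
  module U = TreePath (treePath r' f')

  keys : List EKey
  keys = T.keys ++ k ∷ U.keys ++ last ∷ []

  walk : ∀ {E : EKey → Set} → (∀ {q e} → InFork z p p' q e → E (tree r q e)) → E k →
    (∀ {t e} → InFork z' q q' t e → E (tree r' t e)) → E last → Adj last (r' , q') (r , p) → Walk E (r , p) (r , p) keys
  walk {E} eT ek eU el adj = walk-++ (T.walk {E} eT) (cons ek (linkKey-adj lk) (walk-++ (U.walk {E} eU) (cons el adj nil)))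

  nonempty : keys ≢ []
  nonempty e = case ++-conicalʳ T.keys _ e of λ ()

  not-tree-k : ∀ {r q e} → k ≢ tree r q e
  not-tree-k refl = case lk of λ ()

  unique : Unique keys
  unique = Unique-++ T.unique
    (All.tabulate (λ h e → case ∈-++⁻ U.keys h of λ where
        (inj₁ m) → case U.member m of λ { (_ , _ , refl , _) → not-tree-k e }
        (inj₂ (here refl)) → k≢last e)
      ∷ Unique-++ U.unique ([] ∷ []) λ { (m , here refl) → case U.member m of λ { (_ , _ , e , _) → not-tree e } })
    λ { (m , here refl) → case T.member m of λ { (_ , _ , e , _) → not-tree-k e }
      ; (m , there h) → case T.member m of λ { (_ , _ , refl , _) → case ∈-++⁻ U.keys h of λ where
          (inj₁ m') → case U.member m' of λ { (_ , _ , refl , _) → r≢r' refl }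
          (inj₂ (here e)) → not-tree (sym e) } }

-- Cycles excluded by (P2) and (P3)

module Cycles (F : Dir → Formula) where
  open TwoSided F

  inFork-visited : ∀ {κ t z p p' q e} → Visits κ t p → Visits κ t p' → InFork z p p' q e → Visits κ t (q ∷ʳ e)
  inFork-visited {κ} {t} v v' (inFork (inj₁ o) _ _) = visits-onPath κ t o v
  inFork-visited {κ} {t} v v' (inFork (inj₂ o) _ _) = visits-onPath κ t o v'

  -- The two links and the two tree paths form a square in which only the two ⊗ at the tops are
  -- entered twice, so a single ⅋-switching contains it.
  no-tensor-square : ∀ {κ a a' b b'} → IsLinking (two F) κ →
    (∀ s → IsTree (Res κ) (switchEdges (two F) κ s)) →
    Lk κ (pos L a) (pos R b) → Lk κ (pos L a') (pos R b') →
    Meet (F L) ⊗ₖ a a' → Meet (F R) ⊗ₖ b b' → ⊥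
  no-tensor-square {κ} {a} {a'} {b} {b'} lin p2 l l' (meet z f at-z) (meet z' f' at-z')
    with linkKey l' | linkKey (lk-sym l)
  ... | k₁ , lk₁ , e₁ | k₂ , lk₂ , e₂ =
    proj₂ (p2 s) (pos L a) S.keys
      (S.walk {E} ET (e₁ {E} id) EU (e₂ {E} id) (linkKey-adj lk₂) , S.nonempty , S.unique)
    where
    not-tree : ∀ {u v k r q d} → LinkKey u v k → k ≢ tree r q d
    not-tree as-is ()
    not-tree flipped ()
    keys-differ : ∀ {k k'} → LinkKey (pos L a') (pos R b') k → LinkKey (pos R b) (pos L a) k' → k ≢ k'
    keys-differ as-is flipped refl = fork-irrefl f
    keys-differ flipped as-is refl = fork-irrefl f
    module S = Square f (fork-sym f') (concl-side L) lk₁ (not-tree lk₂) (keys-differ lk₁ lk₂)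
    s : Pos → Dir
    s (concl 0 , q) = opp (dirTo a a' q)
    s (concl 1 , q) = opp (dirTo b' b q)
    s _ = L
    E : EKey → Set
    E = switchEdges (two F) κ s
    not-par : ∀ t {q z} → At (F t) z ⊗ₖ → IsPar (two F) (pos t q) → q ≢ z
    not-par t a isp refl with At-functional a (isPar⁻ t isp)
    ... | ()
    ET : ∀ {q e} → InFork z a a' q e → E (tree (concl 0) q e)
    ET i = inFork-visited {κ} {L} (leaf-visited κ L (lk-leafˡ l)) (leaf-visited κ L (lk-leafˡ l')) i ,
      λ isp → unused-correct f i (not-par L at-z isp)
    EU : ∀ {q e} → InFork z' b' b q e → E (tree (concl 1) q e)
    EU i = inFork-visited {κ} {R} (leaf-visited κ R (lk-leafʳ l')) (leaf-visited κ R (lk-leafʳ l)) i ,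
      λ isp → unused-correct (fork-sym f') i (not-par R at-z' isp)

  data Unswitched : Kind → Set where
    free-⊗ : Unswitched ⊗ₖ
    free-⊕ : Unswitched ⊕ₖ

  Acyclic : List Linking → Pos → Set
  Acyclic Λ W = ∀ v ks → IsSwitchingCycle (two F) (GEdges (two F) Λ) v ks → ¬ OnCycle W ks

  unswitched : ∀ t {z k} → At (F t) z k → Unswitched k → ¬ (IsPar (two F) (pos t z) ⊎ IsWith (two F) (pos t z))
  unswitched t a u (inj₁ isp) with At-functional a (isPar⁻ t isp)
  unswitched t a () (inj₁ isp) | refl
  unswitched t a u (inj₂ w) with At-functional a (isWith-at t w)
  unswitched t a () (inj₂ w) | refl

  module _ {Λ : List Linking} where

    G : EKey → Set
    G = GEdges (two F) Λ

    Seen : Dir → Path → Set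
    Seen t p = UnionRes Λ (pos t p)

    inFork-seen : ∀ {t z p p' q e} → Seen t p → Seen t p' → InFork z p p' q e → Seen t (q ∷ʳ e)
    inFork-seen {t} (κ , h , v) _ (inFork (inj₁ o) _ _) = κ , h , visits-onPath κ t o v
    inFork-seen {t} _ (κ , h , v) (inFork (inj₂ o) _ _) = κ , h , visits-onPath κ t o v

    off-path : ∀ {z w y q e} → Fork z w y → InFork z w y q e → q ≢ w
    off-path {w = w} f (inFork (inj₁ (s , eq)) _ _) refl with ++-cancelˡ w _ _ (trans (++-identityʳ w) eq)
    ... | ()
    off-path f (inFork (inj₂ (s , refl)) _ _) refl = fork-not-prefix _ f

    -- The cycle climbs from `w` to `z`, descends to `y` and returns by the jump. It enters `w`
    -- through the jump only, and `z` is free of switching.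
    acyclic-jump : ∀ t {w y z k} → Acyclic Λ (pos t w) → Fork z w y → At (F t) z k → Unswitched k →
      Seen t w → Seen t y → ¬ G (jump (pos t y) (pos t w))
    acyclic-jump t {w} {y} {z} acyclic f a free sw sy j =
      acyclic (pos t w) (T.keys ++ J ∷ []) ((walk , nonempty , unique) , switching)
        (J , ∈-++⁺ʳ T.keys (here refl) , inj₂ refl)
      where
      module T = TreePath (treePath (concl (con t)) f)
      J : EKey
      J = jump (pos t y) (pos t w)
      walk : Walk G (pos t w) (pos t w) (T.keys ++ J ∷ [])
      walk = walk-++ (T.walk {G} (inFork-seen {t} sw sy)) (cons j (inj₁ (refl , refl)) nil)
      nonempty : T.keys ++ J ∷ [] ≢ []
      nonempty e = case ++-conicalʳ T.keys _ e of λ ()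
      unique : Unique (T.keys ++ J ∷ [])
      unique = Unique-++ T.unique ([] ∷ []) λ { (m , here refl) → case T.member m of λ { (_ , _ , () , _) } }
      switching : ∀ V → (IsPar (two F) V ⊎ IsWith (two F) V) → ∀ k₁ k₂ → k₁ ∈ T.keys ++ J ∷ [] → k₂ ∈ T.keys ++ J ∷ [] →
        inTarget k₁ ≡ just V → inTarget k₂ ≡ just V → k₁ ≡ k₂
      switching V pw k₁ k₂ h₁ h₂ e₁ e₂ with ∈-++⁻ T.keys h₁ | ∈-++⁻ T.keys h₂
      ... | inj₂ (here refl) | inj₂ (here refl) = refl
      ... | inj₁ m | inj₂ (here refl) with T.member m
      ...   | q , e , refl , i with trans e₁ (sym e₂)
      ...     | refl = ⊥-elim (off-path f i refl)
      switching V pw k₁ k₂ h₁ h₂ e₁ e₂ | inj₂ (here refl) | inj₁ m with T.member m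
      ...   | q , e , refl , i with trans e₁ (sym e₂)
      ...     | refl = ⊥-elim (off-path f i refl)
      switching V pw k₁ k₂ h₁ h₂ e₁ e₂ | inj₁ m₁ | inj₁ m₂ with T.member m₁ | T.member m₂
      ...   | q , e , refl , i | q' , e' , refl , i' with trans e₁ (sym e₂)
      ...     | refl with inFork-direction f i i'
      ...       | inj₂ refl = refl
      switching V pw k₁ k₂ h₁ h₂ refl e₂ | inj₁ m₁ | inj₁ m₂
            | q , e , refl , i | q' , e' , refl , i' | refl | inj₁ refl = ⊥-elim (unswitched t a free pw)

    -- A detour through the other conclusion: from `w` over `z` to `d`, along the link to `e`, over
    -- the ⊗ at `z'` to `x`, and back by the jump. The visits to `w` and `x` and the link may come
    -- from different linkings of `Λ`.
    acyclic-square : ∀ t {w d e x z z' k} → Acyclic Λ (pos t w) → Fork z w d → At (F t) z k → Unswitched k →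
      Fork z' e x → At (F (opp t)) z' ⊗ₖ → Seen t w → Seen (opp t) x →
      ∀ {κ} → κ ∈ Λ → Lk κ (pos t d) (pos (opp t) e) → ¬ G (jump (pos (opp t) x) (pos t w))
    acyclic-square t {w} {d} {e} {x} {z} {z'} acyclic f a free f' a' sw sx {κ} κ∈ l j with linkKey l
    ... | k , lk , ek =
      acyclic (pos t w) ks ((walk , S.nonempty , S.unique) , switching)
        (J , ∈-++⁺ʳ T.keys (there (∈-++⁺ʳ U.keys (here refl))) , inj₂ refl)
      where
      J : EKey
      J = jump (pos (opp t) x) (pos t w)
      not-jump : ∀ {u v k} → LinkKey u v k → k ≢ J
      not-jump as-is ()
      not-jump flipped ()
      J-not-tree : ∀ {r q e} → J ≢ tree r q e
      J-not-tree ()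
      module S = Square f f' (concl-side t) lk J-not-tree (not-jump lk)
      open S using (module T; module U) renaming (keys to ks)
      walk : Walk G (pos t w) (pos t w) ks
      walk = S.walk {G} (inFork-seen {t} sw (κ , κ∈ , leaf-visited κ t (lk-leafˡ l))) (ek {G} (λ h → κ , κ∈ , h))
        (inFork-seen {opp t} (κ , κ∈ , leaf-visited κ (opp t) (lk-leafʳ l)) sx) j (inj₁ (refl , refl))
      data Part : EKey → Set where
        inT : ∀ {q e} → InFork z w d q e → Part (tree (concl (con t)) q e)
        inU : ∀ {q e'} → InFork z' e x q e' → Part (tree (concl (con (opp t))) q e')
        isL : ∀ {k} → (∀ {V} → inTarget k ≢ just V) → Part k
        isJ : Part J
      part : ∀ {k} → k ∈ ks → Part k
      part h with ∈-++⁻ T.keys h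
      ... | inj₁ m with T.member m
      ...   | _ , _ , refl , i = inT i
      part h | inj₂ (here refl) = isL (linkKey-no-target lk)
      part h | inj₂ (there m) with ∈-++⁻ U.keys m
      ...   | inj₂ (here refl) = isJ
      ...   | inj₁ m' with U.member m'
      ...     | _ , _ , refl , i = inU i
      same-target : ∀ {V W : Pos} → just V ≡ just W → V ≡ W
      same-target refl = refl
      compare-parts : ∀ {V k₁ k₂} → (IsPar (two F) V ⊎ IsWith (two F) V) → Part k₁ → Part k₂ →
        inTarget k₁ ≡ just V → inTarget k₂ ≡ just V → k₁ ≡ k₂
      compare-parts pw (isL n) _ e₁ _ = ⊥-elim (n e₁)
      compare-parts pw _ (isL n) _ e₂ = ⊥-elim (n e₂)
      compare-parts pw isJ isJ _ _ = refl
      compare-parts pw (inT i) isJ refl e₂ = ⊥-elim (off-path f i (sym (pos-injective {t} (same-target e₂))))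
      compare-parts pw isJ (inT i) refl e₂ = ⊥-elim (off-path f i (pos-injective {t} (same-target e₂)))
      compare-parts pw (inU i) isJ refl e₂ = ⊥-elim (concl-side t (cong proj₁ (same-target e₂)))
      compare-parts pw isJ (inU i) refl e₂ = ⊥-elim (concl-side t (sym (cong proj₁ (same-target e₂))))
      compare-parts pw (inT i) (inU i') refl e₂ = ⊥-elim (concl-side t (sym (cong proj₁ (same-target e₂))))
      compare-parts pw (inU i) (inT i') refl e₂ = ⊥-elim (concl-side t (cong proj₁ (same-target e₂)))
      compare-parts pw (inT i) (inT i') refl e₂ with pos-injective {t} (same-target e₂)
      ... | refl with inFork-direction f i i'
      ...   | inj₂ refl = refl
      ...   | inj₁ refl = ⊥-elim (unswitched t a free pw)
      compare-parts pw (inU i) (inU i') refl e₂ with pos-injective {opp t} (same-target e₂)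
      ... | refl with inFork-direction f' i i'
      ...   | inj₂ refl = refl
      ...   | inj₁ refl = ⊥-elim (unswitched (opp t) a' free-⊗ pw)
      switching : ∀ V → (IsPar (two F) V ⊎ IsWith (two F) V) → ∀ k₁ k₂ → k₁ ∈ ks → k₂ ∈ ks →
        inTarget k₁ ≡ just V → inTarget k₂ ≡ just V → k₁ ≡ k₂
      switching V pw k₁ k₂ h₁ h₂ = compare-parts pw (part h₁) (part h₂)

-- The uniqueness of partners is decidable, so it may be proved by contradiction.

¬¬-em : (P : Set) → ¬ ¬ (P ⊎ ¬ P)
¬¬-em P k = k (inj₂ (k ∘ inj₁))

¬¬-filter : ∀ {A : Set} (P : A → Set) xs → ¬ ¬ (∃[ ys ] (∀ a → a ∈ ys ⇔ (a ∈ xs × P a)))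
¬¬-filter P [] k = k ([] , λ a → mk⇔ (λ ()) λ { (() , _) })
¬¬-filter P (x ∷ xs) k = ¬¬-filter P xs λ { (ys , e) → ¬¬-em (P x) λ where
  (inj₁ p) → k (x ∷ ys , λ a → mk⇔
    (λ { (here refl) → here refl , p ; (there h) → there (proj₁ (to (e a) h)) , proj₂ (to (e a) h) })
    (λ { (here refl , _) → here refl ; (there h , q) → there (from (e a) (h , q)) }))
  (inj₂ n) → k (ys , λ a → mk⇔
    (λ h → there (proj₁ (to (e a) h)) , proj₂ (to (e a) h))
    (λ { (here refl , q) → ⊥-elim (n q) ; (there h , q) → from (e a) (h , q) })) }

_∈?_ : (v : Pos) (vs : List Pos) → Dec (v ∈ vs)
v ∈? vs = Any.any? (v ≟Pos_) vs

lk? : ∀ κ u v → Dec (Lk κ u v)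
lk? κ u v with Any.any? (×-≡-dec _≟Pos_ _≟Pos_ (u , v)) κ | Any.any? (×-≡-dec _≟Pos_ _≟Pos_ (v , u)) κ
... | yes h | _ = yes (fwd h)
... | no _ | yes h = yes (bwd h)
... | no a | no b = no λ { (fwd h) → a h ; (bwd h) → b h }

lk-resp-≈ : ∀ {κ κ' u v} → κ ≈L κ' → Lk κ u v → Lk κ' u v
lk-resp-≈ e (fwd h) = fwd (to (e _) h)
lk-resp-≈ e (bwd h) = bwd (to (e _) h)

res-resp-≈ : ∀ {κ κ' v} → κ ≈L κ' → Res κ v → Res κ' v
res-resp-≈ e (l , h , b) = l , lk-leafˡ (lk-resp-≈ e (proj₂ (leaf-linked h))) , b

vertices : Formula → List Path
vertices (var x) = [] ∷ []
vertices (dual x) = [] ∷ []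
vertices (A ⊗ B) = [] ∷ map (L ∷_) (vertices A) ++ map (R ∷_) (vertices B)
vertices (A ⅋ B) = [] ∷ map (L ∷_) (vertices A) ++ map (R ∷_) (vertices B)
vertices (A & B) = [] ∷ map (L ∷_) (vertices A) ++ map (R ∷_) (vertices B)
vertices (A ⊕ B) = [] ∷ map (L ∷_) (vertices A) ++ map (R ∷_) (vertices B)

vertices-node : ∀ k A B → vertices (node k A B) ≡ [] ∷ map (L ∷_) (vertices A) ++ map (R ∷_) (vertices B)
vertices-node ⊗ₖ A B = refl
vertices-node ⅋ₖ A B = refl
vertices-node &ₖ A B = refl
vertices-node ⊕ₖ A B = refl

∈-vertices : ∀ F p {G} → subAt F p ≡ just G → p ∈ vertices F
∈-vertices F p e with shape F
∈-vertices F [] e | atom var⁺ = here refl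
∈-vertices F [] e | atom dual⁻ = here refl
∈-vertices F (d ∷ p) e | atom a = contradiction (trans (sym (subAt-atom a d p)) e) λ ()
∈-vertices F [] e | bin k A B rewrite vertices-node k A B = here refl
∈-vertices F (L ∷ p) e | bin k A B rewrite vertices-node k A B = there (∈-++⁺ˡ (∈-map⁺ (L ∷_)
  (∈-vertices A p (trans (sym (subAt-node k L A B p)) e))))
∈-vertices F (R ∷ p) e | bin k A B rewrite vertices-node k A B = there (∈-++⁺ʳ (map (L ∷_) (vertices A)) (∈-map⁺ (R ∷_)
  (∈-vertices B p (trans (sym (subAt-node k R A B p)) e))))

-- Proof-nets whose links all join the two conclusions

record BipartiteNet : Set where
  field
    F   : Dir → Formula
    θ   : Net
    pn  : IsProofNet (two F) θ
    bip : Bipartite θ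

module NetFacts (N : BipartiteNet) where

  open BipartiteNet N
  open TwoSided F
  open Cycles F

  On : (Pos → Dir) → Linking → Set
  On = OnWithRes (two F)

  linking : ∀ {κ} → κ ∈ θ → IsLinking (two F) κ
  linking = proj₁ pn _

  on-choice : ∀ c → ∃[ κ ] (κ ∈ θ × On c κ)
  on-choice c = proj₁ (proj₁ (proj₂ (proj₂ pn)) c)

  on-unique : ∀ {c κ κ'} → κ ∈ θ → κ' ∈ θ → On c κ → On c κ' → κ ≈L κ'
  on-unique {c} a b = proj₂ (proj₁ (proj₂ (proj₂ pn)) c) _ _ a b

  p2 : ∀ {κ} → κ ∈ θ → ∀ s → IsTree (Res κ) (switchEdges (two F) κ s)
  p2 h = proj₁ (proj₂ (proj₂ (proj₂ pn))) _ h

  p3 : ∀ Λ → (∀ κ → κ ∈ Λ → κ ∈ θ) → ∀ {κ κ'} → κ ∈ Λ → κ' ∈ Λ → ¬ κ ≈L κ' →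
    ∃[ W ] (Toggles (two F) Λ W × Acyclic Λ W)
  p3 Λ s a b n = proj₂ (proj₂ (proj₂ (proj₂ pn))) Λ s (_ , _ , a , b , n)

  choiceOf : ∀ {κ} → IsLinking (two F) κ → Pos → Dir
  choiceOf l (concl 0 , q) = OneLinking.choice l L q
  choiceOf l (concl 1 , q) = OneLinking.choice l R q
  choiceOf l _ = L

  choiceOf-pos : ∀ {κ} (l : IsLinking (two F) κ) t q → choiceOf l (pos t q) ≡ OneLinking.choice l t q
  choiceOf-pos l L q = refl
  choiceOf-pos l R q = refl

  on-choiceOf : ∀ {κ} (l : IsLinking (two F) κ) → On (choiceOf l) κ
  on-choiceOf l W d w r with isWith⁻ {W} w
  ... | t , q , refl , a = sym (trans (choiceOf-pos l t q) (OneLinking.choice-unique l t a add-& r))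

  not-both-premises : ∀ {κ W} → κ ∈ θ → IsWith (two F) W → Res κ (child W L) → Res κ (child W R) → ⊥
  not-both-premises {W = W} h w a b with isWith⁻ {W} w
  ... | t , q , refl , at-q = OneLinking.visits-not-both (linking h) t {d = L} at-q add-& a b

  module _ {c c' W} (same-off : ∀ v → v ≢ W → c v ≡ c' v)
           {κ κ'} (κ∈ : κ ∈ θ) (κ'∈ : κ' ∈ θ) (o : On c κ) (o' : On c' κ') where

    toggled-at-W : ∀ V → Toggles (two F) (κ ∷ κ' ∷ []) V → V ≡ W
    toggled-at-W V (w , (κ₁ , h₁ , r₁) , (κ₂ , h₂ , r₂)) with V ≟Pos W
    ... | yes e = e
    ... | no ne = ⊥-elim (go h₁ h₂ r₁ r₂)
      where
      go : ∀ {κ₁ κ₂} → κ₁ ∈ κ ∷ κ' ∷ [] → κ₂ ∈ κ ∷ κ' ∷ [] → Res κ₁ (child V L) → Res κ₂ (child V R) → ⊥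
      go (here refl) (here refl) a b = not-both-premises κ∈ w a b
      go (there (here refl)) (there (here refl)) a b = not-both-premises κ'∈ w a b
      go (here refl) (there (here refl)) a b
        with trans (o V L w a) (trans (same-off V ne) (sym (o' V R w b)))
      ... | ()
      go (there (here refl)) (here refl) a b
        with trans (o V R w b) (trans (same-off V ne) (sym (o' V L w a)))
      ... | ()

    -- (P3) provides some toggled vertex off all switching cycles; two resolutions that differ at
    -- most at `W` leave `W` as the only candidate.
    pair-toggle : ¬ κ ≈L κ' → OnlyToggle (two F) (κ ∷ κ' ∷ []) W × Acyclic (κ ∷ κ' ∷ []) W
    pair-toggle n with p3 (κ ∷ κ' ∷ []) (λ { _ (here refl) → κ∈ ; _ (there (here refl)) → κ'∈ })
                       (here refl) (there (here refl)) n
    ... | V , t , a with toggled-at-W V t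
    ... | refl = (t , toggled-at-W) , a

    toggles-left : OnlyToggle (two F) (κ ∷ κ' ∷ []) W → Res κ W
    toggles-left ((w , (κ₁ , h₁ , r₁) , (κ₂ , h₂ , r₂)) , _) = go h₁ h₂ r₁ r₂
      where
      parent : ∀ κ {d} → Res κ (child W d) → Res κ W
      parent κ ((r , _) , h , refl , s , refl) = _ , h , refl , _ , ++-assoc (proj₂ W) _ s
      go : ∀ {κ₁ κ₂} → κ₁ ∈ κ ∷ κ' ∷ [] → κ₂ ∈ κ ∷ κ' ∷ [] → Res κ₁ (child W L) → Res κ₂ (child W R) → Res κ W
      go (here refl) _ a b = parent κ {L} a
      go _ (here refl) a b = parent κ {R} b
      go (there (here refl)) (there (here refl)) a b = ⊥-elim (not-both-premises κ'∈ w a b)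

  jump-edge : ∀ {Λ κ κ' W u v} → κ ∈ Λ → κ' ∈ Λ → OnlyToggle (two F) (κ ∷ κ' ∷ []) W →
    Lk κ u v → ¬ Lk κ' u v → GEdges (two F) Λ (jump u W)
  jump-edge h h' o (fwd a) n = _ , (_ , _ , h , h' , a , n ∘ fwd , o) , here refl
  jump-edge h h' o (bwd a) n = _ , (_ , _ , h , h' , a , n ∘ bwd , o) , there (here refl)

  partner : ∀ {κ} t {p} → κ ∈ θ → pos t p ∈ leaves κ → ∃[ q ] Lk κ (pos t p) (pos (opp t) q)
  partner {κ} t {p} h m with leaf-linked m
  ... | v , l with OneLinking.leaf-side (linking h) (lk-leafʳ l)
  ... | s , q , refl , _ with s ≟ᴰ t
  ...   | yes refl = ⊥-elim (bip h t l)
  ...   | no ne with ≢⇒opp (ne ∘ sym)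
  ...     | refl = q , l

  fork-visits : ∀ {κ t z p p'} → Fork z p p' → Visits κ t p → Visits κ t p' →
    ∃[ d ] (Visits κ t (z ∷ʳ d) × Visits κ t (z ∷ʳ opp d))
  fork-visits {κ} {t} f v v' with fork-onPath f
  ... | d , o , o' = d , visits-onPath κ t o v , visits-onPath κ t o' v'

  no-additive-fork : ∀ {κ} t {z p p' k} → κ ∈ θ → Fork z p p' → At (F t) z k → Additive k →
    Visits κ t p → Visits κ t p' → ⊥
  no-additive-fork {κ} t h f a add v v' with fork-visits {κ} {t} f v v'
  ... | d , x , y = OneLinking.visits-not-both (linking h) t {d = d} a add x y

  no-additive-meet : ∀ {κ} t {p p' k} → κ ∈ θ → Meet (F t) k p p' → Additive k →
    pos t p ∈ leaves κ → pos t p' ∈ leaves κ → ⊥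
  no-additive-meet {κ} t h (meet z f a) add m m' =
    no-additive-fork t h f a add (leaf-visited κ t m) (leaf-visited κ t m')

  tensor-square : ∀ t {κ a a' b b'} → κ ∈ θ → Lk κ (pos t a) (pos (opp t) b) → Lk κ (pos t a') (pos (opp t) b') →
    Meet (F t) ⊗ₖ a a' → Meet (F (opp t)) ⊗ₖ b b' → ⊥
  tensor-square L h l l' m m' = no-tensor-square (linking h) (p2 h) l l' m m'
  tensor-square R h l l' m m' = no-tensor-square (linking h) (p2 h) (lk-sym l) (lk-sym l') m' m

  allVertices : List Pos
  allVertices = map (pos L) (vertices (F L)) ++ map (pos R) (vertices (F R))

  vertex-∈ : ∀ t {n k} → At (F t) n k → pos t n ∈ allVertices
  vertex-∈ L {n} a = ∈-++⁺ˡ (∈-map⁺ (pos L) (∈-vertices (F L) n (proj₂ (at-subAt a))))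
  vertex-∈ R {n} a =
    ∈-++⁺ʳ (map (pos L) (vertices (F L))) (∈-map⁺ (pos R) (∈-vertices (F R) n (proj₂ (at-subAt a))))

-- Uniqueness of the partner of a leaf

-- Distributedness enters here: between a ⅋ and a & below it, the path leaves the ⅋ through a ⊗ or a ⊕.
record Guard (F : Formula) (z : Path) (d : Dir) (s : Path) : Set₁ where
  field
    kind : Kind
    upper : Path
    side : Dir
    lower : Path
    position : s ≡ upper ++ side ∷ lower
    at-guard : At F (z ++ d ∷ upper) kind
    free : kind ≡ ⊗ₖ ⊎ kind ≡ ⊕ₖ
    chain : ∀ (V : Path → Set) → V z → (∀ {q} → At F q ⅋ₖ → V q → ∀ e → V (q ∷ʳ e)) → V (z ++ d ∷ upper)

child-subAt : ∀ {F z k A B} d → subAt F z ≡ just (node k A B) → subAt F (z ∷ʳ d) ≡ just (pick d A B)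
child-subAt {F} {z} {k} {A} {B} d e = trans (subAt-++ F z (d ∷ []) e) (subAt-node k d A B [])

no-&-under-⅋ : ∀ {F z d} → Distributed F → At F z ⅋ₖ → At F (z ∷ʳ d) &ₖ → ⊥
no-&-under-⅋ {F} {z} {L} D (at A B e) (at C C' e') with just-injective (trans (sym (child-subAt {F} {z} {⅋ₖ} L e)) e')
... | refl = D z _ e (&⅋ _ _ _)
no-&-under-⅋ {F} {z} {R} D (at A B e) (at C C' e') with just-injective (trans (sym (child-subAt {F} {z} {⅋ₖ} R e)) e')
... | refl = D z _ e (⅋& _ _ _)

-- Follow the path down from the ⅋ as long as only ⅋ are met. The first other connective has a ⅋ as
-- parent and so is no &, by distributedness. `chain` records that whatever passes from a ⅋ to its
-- premises reaches this vertex.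
guard : ∀ {F} z d s → Distributed F → At F z ⅋ₖ → At F (z ++ d ∷ s) &ₖ → Guard F z d s
guard z d [] D a w = ⊥-elim (no-&-under-⅋ D a w)
guard {F} z d (e ∷ s) D a w@(at C C' eq) with branching F (z ∷ʳ d) e s (trans (cong (subAt F) (∷ʳ-++ z d (e ∷ s))) eq)
... | &ₖ , b = ⊥-elim (no-&-under-⅋ D a b)
... | ⊗ₖ , b = record { kind = ⊗ₖ ; upper = [] ; side = e ; lower = s ; position = refl ; at-guard = b
                      ; free = inj₁ refl ; chain = λ V v h → h a v d }
... | ⊕ₖ , b = record { kind = ⊕ₖ ; upper = [] ; side = e ; lower = s ; position = refl ; at-guard = b
                      ; free = inj₂ refl ; chain = λ V v h → h a v d }
... | ⅋ₖ , b with guard (z ∷ʳ d) e s D b (subst (λ q → At F q &ₖ) (sym (∷ʳ-++ z d (e ∷ s))) w)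
...   | g = record
  { kind = G.kind ; upper = e ∷ G.upper ; side = G.side ; lower = G.lower
  ; position = cong (e ∷_) G.position
  ; at-guard = subst (λ q → At F q G.kind) (∷ʳ-++ z d (e ∷ G.upper)) G.at-guard
  ; free = G.free
  ; chain = λ V v h → subst V (∷ʳ-++ z d (e ∷ G.upper)) (G.chain V (h a v d) h) }
  where module G = Guard g

-- Neither net is preferred: exchanging them dualises every connective, so a fact about ⊕ in one net
-- becomes a fact about & in the other.
record InversePair : Set where
  field
    net net' : BipartiteNet
  open BipartiteNet net public using (F; θ; bip)
  open BipartiteNet net' public using () renaming (F to F'; θ to ψ; bip to bip')
  field
    nF  : ∀ t → F' (opp t) ≡ neg (F t)
    nF' : ∀ t → F' t ≡ neg (F (opp t))
    inverse  : Inverses θ ψ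
    inverse' : Inverses ψ θ

module Pair (P : InversePair) where

  open InversePair P
  open TwoSided F
  open Cycles F
  open NetFacts net
  module Tψ = TwoSided F'
  module Cψ = Cycles F'
  module Nψ = NetFacts net'

  at-dual-side : ∀ t {z k} → At (F t) z k → At (F' (opp t)) (co z) (dualₖ k)
  at-dual-side t {z} {k} a = subst (λ G → At G (co z) (dualₖ k)) (sym (nF t)) (At-neg a)

  meet-dual : ∀ t {k p q} → Meet (F t) k p q → Meet (F' (opp t)) (dualₖ k) (co p) (co q)
  meet-dual t {k} {p} {q} m = subst (λ G → Meet G (dualₖ k) (co p) (co q)) (sym (nF t)) (meet-neg m)

  meet-dual' : ∀ t {k p q} → Meet (F (opp t)) k p q → Meet (F' t) (dualₖ k) (co p) (co q)
  meet-dual' t {k} {p} {q} m = subst (λ G → Meet G (dualₖ k) (co p) (co q)) (sym (nF' t)) (meet-neg m)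

  -- On the two ends of a linking, ⅋ faces ⊗: the other three combinations close a cycle in θ or ψ
  -- or contradict additivity.
  facing : ∀ t {κ a a' b b'} → κ ∈ θ → Lk κ (pos t a) (pos (opp t) b) → Lk κ (pos t a') (pos (opp t) b') →
    Meet (F t) ⅋ₖ a a' → Meet (F (opp t)) ⊗ₖ b b'
  facing t {κ} {a} {a'} {b} {b'} h l l' m@(meet z f _)
    with leaf-compare (O.leaf-of (opp t) (lk-leafʳ l)) (O.leaf-of (opp t) (lk-leafʳ l'))
    where module O = OneLinking (linking h)
  ... | inj₁ refl with pos-injective {t} (lk-functional (OneLinking.unique-leaves (linking h)) (lk-sym l) (lk-sym l'))
  ...   | refl = ⊥-elim (fork-irrefl f)
  facing t h l l' m | inj₂ (⊗ₖ , m') = m'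
  facing t h l l' m | inj₂ (&ₖ , m') = ⊥-elim (no-additive-meet (opp t) h m' add-& (lk-leafʳ l) (lk-leafʳ l'))
  facing t h l l' m | inj₂ (⊕ₖ , m') = ⊥-elim (no-additive-meet (opp t) h m' add-⊕ (lk-leafʳ l) (lk-leafʳ l'))
  facing t h l l' m | inj₂ (⅋ₖ , m') with inverse h
  ... | μ , μ∈ , i = ⊥-elim (Nψ.tensor-square t μ∈ (lk-sym (to (i t) l)) (lk-sym (to (i t) l'))
    (meet-dual' t m') (meet-dual t m))

  inverse-visits : ∀ {κ μ} → κ ∈ θ → μ ∈ ψ → Inverse κ μ → ∀ t q → Visits κ t q ⇔ Tψ.Visits μ (opp t) (co q)
  inverse-visits {κ} {μ} κ∈ μ∈ i t q = mk⇔ forwards backwards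
    where
    forwards : Visits κ t q → Tψ.Visits μ (opp t) (co q)
    forwards v with visits-elim {κ} {t} v
    ... | s , m with partner t κ∈ m
    ... | b , l = Tψ.visits-leaf {μ} {opp t} {co q} {co s}
      (subst (λ x → pos (opp t) x ∈ leaves μ) (map-++ opp q s) (lk-leafˡ (to (i t) l)))
    backwards : Tψ.Visits μ (opp t) (co q) → Visits κ t q
    backwards v with Tψ.visits-elim {μ} {opp t} v
    ... | s , m with Nψ.partner (opp t) μ∈ m
    ... | b , l = visits-leaf {κ} {t} {q} {co s} (subst (λ x → pos t x ∈ leaves κ) (shape-eq) (lk-leafˡ (from (i t) l')))
      where
      shape-eq : co (co q ++ s) ≡ q ++ co s
      shape-eq = trans (map-++ opp (co q) s) (cong (_++ co s) (co-co q))
      l' : Lk μ (pos (opp t) (co (co (co q ++ s)))) (pos t (co (co b)))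
      l' = subst₂ (λ x y → Lk μ (pos (opp t) x) y) (sym (co-co (co q ++ s)))
        (cong₂ pos (opp-opp t) (sym (co-co b))) l

module FixedLink (P : InversePair) (dist : ∀ t → Distributed (InversePair.F P t)) (x : Dir → Path) where

  open InversePair P
  open TwoSided F
  open Cycles F
  open NetFacts net
  open Pair P

  E : Linking → Set
  E κ = Lk κ (pos L (x L)) (pos R (x R))

  E-at : ∀ t {κ} → E κ → Lk κ (pos t (x t)) (pos (opp t) (x (opp t)))
  E-at L l = l
  E-at R l = lk-sym l

  E-from : ∀ t {κ} → Lk κ (pos t (x t)) (pos (opp t) (x (opp t))) → E κ
  E-from L l = l
  E-from R l = lk-sym l

  E-leaf : ∀ t {κ} → E κ → pos t (x t) ∈ leaves κ
  E-leaf t l = lk-leafˡ (E-at t l)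

  -- A choice that cuts off an end of the link destroys it trivially, so only choices keeping both
  -- ends are compared.
  Compatible : (Pos → Dir) → Set
  Compatible c = ∀ t {z d} → OnPath (x t) z d → At (F t) z &ₖ → c (pos t z) ≡ d

  choiceOf-compatible : ∀ {κ} (h : κ ∈ θ) → E κ → Compatible (choiceOf (linking h))
  choiceOf-compatible {κ} h l t {z} {d} (s , e) a = trans (choiceOf-pos (linking h) t z)
    (OneLinking.choice-unique (linking h) t a add-& (visits-onPath κ t (s , e) (leaf-visited κ t (E-leaf t l))))

  Selects : (Pos → Dir) → Set
  Selects c = ∃[ κ ] (κ ∈ θ × On c κ × E κ)

  selects? : ∀ c → Dec (Selects c)
  selects? c with on-choice c
  ... | κ , κ∈ , o with lk? κ (pos L (x L)) (pos R (x R))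
  ...   | yes l = yes (κ , κ∈ , o , l)
  ...   | no n = no λ { (κ' , κ'∈ , o' , l) → n (lk-resp-≈ (on-unique κ'∈ κ∈ o' o) l) }

  selects-resp : ∀ {c c'} → (∀ v → IsWith (two F) v → c v ≡ c' v) → Selects c → Selects c'
  selects-resp e (κ , κ∈ , o , l) = κ , κ∈ , (λ W d w r → trans (o W d w r) (e W w)) , l

  Invariant : Pos → Set
  Invariant w = ∀ c c' → Compatible c → Compatible c' → (∀ v → v ≢ w → c v ≡ c' v) → Selects c → Selects c'

  record Sensitive (w : Pos) : Set where
    field
      c c' : Pos → Dir
      compatible : Compatible c
      compatible' : Compatible c'
      same-off : ∀ v → v ≢ w → c v ≡ c' v
      selects : Selects c
      not-selects : ¬ Selects c'

  sensitive : ∀ {w} → ¬ Invariant w → ¬ ¬ Sensitive w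
  sensitive n k = n λ c c' co co' off s → case selects? c' of λ where
    (yes s') → s'
    (no ns) → ⊥-elim (k (record { compatible = co ; compatible' = co' ; same-off = off
                                ; selects = s ; not-selects = ns }))

  mix : List Pos → (Pos → Dir) → (Pos → Dir) → Pos → Dir
  mix vs σ c v with v ∈? vs
  ... | yes _ = σ v
  ... | no _ = c v

  mix-in : ∀ {vs σ c v} → v ∈ vs → mix vs σ c v ≡ σ v
  mix-in {vs} {v = v} h with v ∈? vs
  ... | yes _ = refl
  ... | no n = ⊥-elim (n h)

  mix-out : ∀ {vs σ c v} → v ∉ vs → mix vs σ c v ≡ c v
  mix-out {vs} {v = v} h with v ∈? vs
  ... | yes m = ⊥-elim (h m)
  ... | no n = refl

  mix-compatible : ∀ {vs σ c} → Compatible σ → Compatible c → Compatible (mix vs σ c)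
  mix-compatible {vs} s k t {z} o a with pos t z ∈? vs
  ... | yes _ = s t o a
  ... | no _ = k t o a

  module Argument (Is : List Pos) (sound : ∀ {w} → w ∈ Is → Invariant w)
    (complete : ∀ {w} → IsWith (two F) w → Invariant w → w ∈ Is) where

    -- The choice is changed at one invariant vertex at a time; every intermediate mixture of two
    -- compatible choices is compatible again.
    move : ∀ {c c'} → Compatible c → Compatible c' →
      (∀ v → IsWith (two F) v → v ∉ Is → c v ≡ c' v) → Selects c → Selects c'
    move {c} {c'} k k' e s = selects-resp final (along Is sound)
      where
      along : ∀ ws → (∀ {w} → w ∈ ws → Invariant w) → Selects (mix ws c' c)
      along [] inv = selects-resp (λ _ _ → refl) s
      along (w ∷ ws) inv = inv (here refl) (mix ws c' c) (mix (w ∷ ws) c' c) (mix-compatible {ws} k' k)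
        (mix-compatible {w ∷ ws} k' k) off (along ws (inv ∘ there))
        where
        off : ∀ v → v ≢ w → mix ws c' c v ≡ mix (w ∷ ws) c' c v
        off v ne = case v ∈? ws of λ where
          (yes m) → trans (mix-in {ws} m) (sym (mix-in {w ∷ ws} (there m)))
          (no n) → trans (mix-out {ws} n) (sym (mix-out {w ∷ ws} λ { (here e) → ne e ; (there m) → n m }))
      final : ∀ v → IsWith (two F) v → mix Is c' c v ≡ c' v
      final v w with v ∈? Is
      ... | yes _ = refl
      ... | no n = e v w n

    move-mix : ∀ {σ c} → Compatible σ → Compatible c → Selects c → Selects (mix Is σ c)
    move-mix s k = move k (mix-compatible {Is} s k) (λ v _ n → sym (mix-out {Is} n))

    unmove-mix : ∀ {σ c} → Compatible σ → Compatible c → Selects (mix Is σ c) → Selects c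
    unmove-mix s k = move (mix-compatible {Is} s k) k (λ v _ n → mix-out {Is} n)

    Agrees : (Pos → Dir) → Linking → Set
    Agrees σ κ = ∀ w d → w ∈ Is → IsWith (two F) w → Res κ (child w d) → d ≡ σ w

    mix-agrees : ∀ {σ c κ} → On (mix Is σ c) κ → Agrees σ κ
    mix-agrees o w d m iw r = trans (o w d iw r) (mix-in {Is} m)

    -- The field visited expresses that only ⅋ separate n from the end x t of the link.
    record Beside (t : Dir) (n : Path) : Set where
      field
        at-⊕ : At (F t) n ⊕ₖ
        meeting : Path
        forked : Fork meeting (x t) n
        at-⅋ : At (F t) meeting ⅋ₖ
        visited : ∀ {κ} → κ ∈ θ → E κ → Visits κ t n

    -- `one-sided` is the constraint that `σ` imposes at `n`. The non-invariant & below side `i` is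
    -- kept because it shows that `i` cannot vary with `σ`.
    record Stuck (σ : Pos → Dir) (t : Dir) (n : Path) (i : Dir) : Set where
      field
        beside : Beside t n
        lower : Path
        is-with : At (F t) (n ++ i ∷ lower) &ₖ
        not-invariant : pos t (n ++ i ∷ lower) ∉ Is
        one-sided : ∀ {κ} → κ ∈ θ → Agrees σ κ → E κ → ¬ Visits κ t (n ∷ʳ opp i)

    sensitive-vertex : ∀ {w} → IsWith (two F) w → w ∉ Is → ¬ ¬ Sensitive w
    sensitive-vertex w n = sensitive (n ∘ complete w)

    -- Under `σ'` the linkings containing the link avoid side `i`, hence never reach the & below it.
    -- A linking that does not visit this & stays on the resolution when its choice there changes,
    -- so the link could not be lost, against sensitivity.
    not-stuck-both-ways : ∀ {σ σ' t n i} → Compatible σ' → Stuck σ t n i → Stuck σ' t n (opp i) → ⊥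
    not-stuck-both-ways {σ} {σ'} {t} {n} {i} k' st st' =
      sensitive-vertex (isWith⁺ t S.is-with) S.not-invariant go
      where
      module S = Stuck st
      module S' = Stuck st'
      go : ¬ Sensitive (pos t (n ++ i ∷ S.lower))
      go sv with move-mix k' (Sensitive.compatible sv) (Sensitive.selects sv)
      ... | κ , κ∈ , o , l = V.not-selects (unmove-mix k' V.compatible' (κ , κ∈ , o' , l))
        where
        module V = Sensitive sv
        avoids : ¬ Visits κ t (n ∷ʳ i)
        avoids v = S'.one-sided κ∈ (mix-agrees {σ'} {V.c} {κ} o) l (subst (λ d → Visits κ t (n ∷ʳ d)) (sym (opp-opp i)) v)
        o' : On (mix Is σ' V.c') κ
        o' W d w r with W ≟Pos pos t (n ++ i ∷ S.lower)
        ... | yes refl = ⊥-elim (avoids (visits-prefix {κ} {t} (S.lower ++ d ∷ [])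
          (subst (Visits κ t) (trans (++-assoc n (i ∷ S.lower) (d ∷ [])) (sym (∷ʳ-++ n i (S.lower ++ d ∷ [])))) r)))
        ... | no ne = trans (o W d w r) same
          where
          same : mix Is σ' V.c W ≡ mix Is σ' V.c' W
          same with W ∈? Is
          ... | yes _ = refl
          ... | no _ = V.same-off W ne

    module Getting-stuck (σ : Pos → Dir) (kσ : Compatible σ) (c₀ c₁ : Pos → Dir)
      (k₀ : Compatible c₀) (k₁ : Compatible c₁) (s₀ : Selects c₀) (n₁ : ¬ Selects c₁) where

      LambdaOf : List Linking → Set
      LambdaOf Λ = ∀ κ → κ ∈ Λ ⇔ (κ ∈ θ × Agrees σ κ)

      module WithLambda (Λ : List Linking) (isΛ : LambdaOf Λ) where

        inΛ : ∀ {c κ} → κ ∈ θ → On (mix Is σ c) κ → κ ∈ Λ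
        inΛ {c} {κ} h o = from (isΛ κ) (h , mix-agrees {σ} {c} {κ} o)

        fromΛ : ∀ {κ} → κ ∈ Λ → κ ∈ θ
        fromΛ h = proj₁ (to (isΛ _) h)

        -- Imposing `σ` on the invariant vertices alters neither the presence of the link at `c₀`
        -- nor its absence at `c₁`. So `Λ` has two distinct members, and (P3) applies to the whole
        -- of it.
        acyclic-vertex : ∃[ W ] (Toggles (two F) Λ W × Acyclic Λ W)
        acyclic-vertex with move-mix kσ k₀ s₀ | on-choice (mix Is σ c₁)
        ... | κ , κ∈ , o , l | κ' , κ'∈ , o' = p3 Λ (λ _ → fromΛ) (inΛ κ∈ o) (inΛ κ'∈ o')
          λ e → n₁ (unmove-mix kσ k₁ (κ' , κ'∈ , o' , lk-resp-≈ e l))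

        toggled-not-invariant : ∀ {W} → Toggles (two F) Λ W → W ∉ Is
        toggled-not-invariant {W} (w , (κ , h , r) , (κ' , h' , r')) m
          with trans (proj₂ (to (isΛ κ) h) W L m w r) (sym (proj₂ (to (isΛ κ') h') W R m w r'))
        ... | ()

        module AtVertex (t : Dir) (w : Path) (is-with : At (F t) w &ₖ) (w∉ : pos t w ∉ Is)
          (acyclic : Acyclic Λ (pos t w)) (sv : Sensitive (pos t w)) where
          module V = Sensitive sv
          y : Path
          y = x t

          same-off-mix : ∀ v → v ≢ pos t w → mix Is σ V.c v ≡ mix Is σ V.c' v
          same-off-mix v ne with v ∈? Is
          ... | yes _ = refl
          ... | no _ = V.same-off v ne

          -- At a & above an end of the link all compatible choices coincide, so none can be
          -- sensitive there.
          not-above : ∀ d s → y ≢ w ++ d ∷ s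
          not-above d s e = V.not-selects (selects-resp same V.selects)
            where
            same : ∀ v → IsWith (two F) v → V.c v ≡ V.c' v
            same v _ with v ≟Pos pos t w
            ... | yes refl = trans (V.compatible t (s , e) is-with) (sym (V.compatible' t (s , e) is-with))
            ... | no ne = V.same-off v ne

          module Dependency {κ κ'} (κ∈ : κ ∈ θ) (κ'∈ : κ' ∈ θ) (o : On (mix Is σ V.c) κ) (o' : On (mix Is σ V.c') κ')
            (l : E κ) (nl : ¬ E κ') where

            only : OnlyToggle (two F) (κ ∷ κ' ∷ []) (pos t w)
            only = proj₁ (pair-toggle same-off-mix κ∈ κ'∈ o o' (λ e → nl (lk-resp-≈ e l)))

            κ∈Λ : κ ∈ Λ
            κ∈Λ = inΛ κ∈ o

            visits-w : Visits κ t w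
            visits-w = toggles-left same-off-mix κ∈ κ'∈ o o' only

            visits-y : Visits κ t y
            visits-y = leaf-visited κ t (E-leaf t l)

            jumps : ∀ s → GEdges (two F) Λ (jump (pos s (x s)) (pos t w))
            jumps s = jump-edge κ∈Λ (inΛ κ'∈ o') only (E-at s l) (λ l' → nl (E-from s l'))

            leaf-y : Leaf (F t) y
            leaf-y = OneLinking.leaf-of (linking κ∈) t (E-leaf t l)

            module UnderPar {z d s s'} (ey : y ≡ z ++ opp d ∷ s') (ew : w ≡ z ++ d ∷ s) (at-z : At (F t) z ⅋ₖ) where

              module G = Guard (guard z d s (dist t) at-z (subst (λ q → At (F t) q &ₖ) ew is-with))

              n : Path
              n = z ++ d ∷ G.upper

              w-below : w ≡ n ++ G.side ∷ G.lower
              w-below = trans ew (trans (cong (λ q → z ++ d ∷ q) G.position) (sym (++-assoc z (d ∷ G.upper) _)))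

              -- From `z`, which lies above an end of the link, down to `n` only ⅋ are passed, and a
              -- linking visits both premises of each of them.
              n-visited : ∀ {κ} → κ ∈ θ → E κ → Visits κ t n
              n-visited {κ} h k = G.chain (Visits κ t)
                (visits-prefix {κ} {t} (opp d ∷ s') (subst (Visits κ t) ey (leaf-visited κ t (E-leaf t k))))
                (λ {q} a v e → OneLinking.visits-both (linking h) t {q} a mul-⅋ v e)

              y-n : Fork z y n
              y-n = onPath-fork (s' , ey) (G.upper , refl) (opp-≢ d)

              unswitched-guard : ∀ {k} → k ≡ ⊗ₖ ⊎ k ≡ ⊕ₖ → Unswitched k
              unswitched-guard (inj₁ refl) = free-⊗
              unswitched-guard (inj₂ refl) = free-⊕

              -- A linking of Λ that contains the link and visits the other premise of n closes a cycle through W.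
              other-side : ∀ {κ₁} → κ₁ ∈ Λ → E κ₁ → ¬ Visits κ₁ t (n ∷ʳ opp G.side)
              other-side {κ₁} h k v with visits-elim {κ₁} {t} v
              ... | r , m with partner t (fromΛ h) m
              -- In `κ₁` the new leaf and the end of the link separate at the ⅋ `z`, so their
              -- partners separate at a ⊗. The square then runs from `w` over `n` to the new leaf
              -- and over this ⊗ to the far end of the link, which jumps to `w`.
              ... | e , le with facing t (fromΛ h) le (E-at t k)
                      (meet z (onPath-fork (G.upper ++ opp G.side ∷ r , path) (s' , ey) (λ e → opp-≢ d (sym e))) at-z)
                where
                path : (n ∷ʳ opp G.side) ++ r ≡ z ++ d ∷ (G.upper ++ opp G.side ∷ r)
                path = trans (∷ʳ-++ n (opp G.side) r) (++-assoc z (d ∷ G.upper) (opp G.side ∷ r))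
              ... | meet z' f' a' = acyclic-square t acyclic
                (onPath-fork {n} {w} {(n ∷ʳ opp G.side) ++ r} (G.lower , w-below) (r , ∷ʳ-++ n (opp G.side) r)
                  (λ e → opp-≢ G.side (sym e)))
                G.at-guard (unswitched-guard G.free) f' a' (κ , κ∈Λ , visits-w)
                (κ , κ∈Λ , leaf-visited κ (opp t) (E-leaf (opp t) l)) h le (jumps (opp t))

              result : ∃[ n ] ∃[ i ] Stuck σ t n i
              result with G.kind | G.free | G.at-guard | other-side
              -- At a ⊗ the linking `κ` itself visits the other premise, so the guard must be a ⊕.
              ... | .⊗ₖ | inj₁ refl | a | _ = ⊥-elim (other-side κ∈Λ l (OneLinking.visits-both (linking κ∈) t {n} a mul-⊗
                      (n-visited κ∈ l) (opp G.side)))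
              ... | .⊕ₖ | inj₂ refl | a | _ = n , G.side , record
                { beside = record { at-⊕ = a ; meeting = z ; forked = y-n ; at-⅋ = at-z ; visited = n-visited }
                ; lower = G.lower
                ; is-with = subst (λ q → At (F t) q &ₖ) w-below is-with
                ; not-invariant = subst (λ q → pos t q ∉ Is) w-below w∉
                ; one-sided = λ h a k → other-side (from (isΛ _) (h , a)) k }

            result : ∃[ n ] ∃[ i ] Stuck σ t n i
            result with compare y w
            ... | below s e with leaf-maximal s leaf-y (proj₂ (at-subAt (subst (λ q → At (F t) q &ₖ) e is-with)))
            ...   | refl = ⊥-elim (At-not-Leaf (subst (λ q → At (F t) q &ₖ) (trans e (++-identityʳ y)) is-with) leaf-y)
            result | above [] e = ⊥-elim (At-not-Leaf is-with (subst (Leaf (F t)) (trans e (++-identityʳ w)) leaf-y))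
            result | above (d ∷ s) e = ⊥-elim (not-above d s e)
            result | apart z f with fork-onPath (fork-sym f)
            ... | d , (s , ew) , (s' , ey) with branching (F t) z d s (trans (cong (subAt (F t)) (sym ew)) (proj₂ (at-subAt is-with)))
            ...   | &ₖ , a = ⊥-elim (no-additive-fork t κ∈ f a add-& visits-y visits-w)
            ...   | ⊕ₖ , a = ⊥-elim (no-additive-fork t κ∈ f a add-⊕ visits-y visits-w)
            ...   | ⊗ₖ , a = ⊥-elim (acyclic-jump t acyclic (fork-sym f) a free-⊗ (κ , κ∈Λ , visits-w)
                      (κ , κ∈Λ , visits-y) (jumps t))
            ...   | ⅋ₖ , a = UnderPar.result ey ew a

          stuck : ∃[ n ] ∃[ i ] Stuck σ t n i
          stuck with move-mix kσ V.compatible V.selects | on-choice (mix Is σ V.c')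
          ... | κ , κ∈ , o , l | κ' , κ'∈ , o' = Dependency.result κ∈ κ'∈ o o' l
            λ l' → V.not-selects (unmove-mix kσ V.compatible' (κ' , κ'∈ , o' , l'))

      getting-stuck : ¬ ¬ (∃[ t ] ∃[ n ] ∃[ i ] Stuck σ t n i)
      getting-stuck k = ¬¬-filter (Agrees σ) θ λ { (Λ , isΛ) → go Λ isΛ }
        where
        go : ∀ Λ → LambdaOf Λ → ⊥
        go Λ isΛ with WithLambda.acyclic-vertex Λ isΛ
        ... | W , tog , acy with isWith⁻ {W} (proj₁ tog)
        ... | t , w , refl , a = sensitive-vertex (proj₁ tog) (WithLambda.toggled-not-invariant Λ isΛ tog) λ sv →
          k (t , WithLambda.AtVertex.stuck Λ isΛ t w a (WithLambda.toggled-not-invariant Λ isΛ tog) acy sv)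

    -- In ψ the vertex n is a &: changing its choice keeps the link, and every other vertex beside it.
    module Toggle {κ} (κ∈ : κ ∈ θ) (l : E κ) {t n} (b : Beside t n) (i : Dir) (v : Visits κ t (n ∷ʳ i)) where

      module B = Beside b
      μ : Linking
      μ = proj₁ (inverse κ∈)
      μ∈ : μ ∈ ψ
      μ∈ = proj₁ (proj₂ (inverse κ∈))
      iμ : Inverse κ μ
      iμ = proj₂ (proj₂ (inverse κ∈))

      W : Pos
      W = pos (opp t) (co n)

      with-W : At (F' (opp t)) (co n) &ₖ
      with-W = at-dual-side t B.at-⊕

      c c' : Pos → Dir
      c = Nψ.choiceOf (Nψ.linking μ∈)
      c' u with u ≟Pos W
      ... | yes _ = opp (c u)
      ... | no _ = c u

      c'-W : c' W ≡ opp (c W)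
      c'-W with W ≟Pos W
      ... | yes _ = refl
      ... | no ne = ⊥-elim (ne refl)

      c'-off : ∀ u → u ≢ W → c u ≡ c' u
      c'-off u ne with u ≟Pos W
      ... | yes e = ⊥-elim (ne e)
      ... | no _ = refl

      on-μ : Nψ.On c μ
      on-μ = Nψ.on-choiceOf (Nψ.linking μ∈)

      μ' : Linking
      μ' = proj₁ (Nψ.on-choice c')
      μ'∈ : μ' ∈ ψ
      μ'∈ = proj₁ (proj₂ (Nψ.on-choice c'))
      on-μ' : Nψ.On c' μ'
      on-μ' = proj₂ (proj₂ (Nψ.on-choice c'))

      dual-visits : ∀ {κ μ} → κ ∈ θ → μ ∈ ψ → Inverse κ μ → ∀ {s q j} → Visits κ s (q ∷ʳ j) →
        Tψ.Visits μ (opp s) (co q ∷ʳ opp j)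
      dual-visits {κ} {μ} h h' inv {s} {q} {j} u = subst (Tψ.Visits μ (opp s)) (map-++ opp q (j ∷ []))
        (to (inverse-visits h h' inv s (q ∷ʳ j)) u)

      c-W : opp i ≡ c W
      c-W = on-μ W (opp i) (Tψ.isWith⁺ (opp t) with-W) (dual-visits κ∈ μ∈ iμ v)

      not-opp-i : ¬ Tψ.Visits μ' (opp t) (co n ∷ʳ opp i)
      not-opp-i u = opp-≢ (c W) (sym (trans (sym c-W) (trans
        (on-μ' W (opp i) (Tψ.isWith⁺ (opp t) with-W) u) c'-W)))

      μ≉μ' : ¬ μ ≈L μ'
      μ≉μ' e = not-opp-i (res-resp-≈ e (dual-visits κ∈ μ∈ iμ v))

      y : Pos
      y = pos (opp t) (co (x t))

      z : Pos
      z = pos t (co (x (opp t)))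

      -- The ⅋ between `n` and the end of the link is a ⊗ in ψ. If the flip destroyed the link, its
      -- end would jump to `W`, and this jump would close a cycle over that ⊗.
      link-kept : Lk μ' y z
      link-kept with lk? μ' y z
      ... | yes l' = l'
      ... | no nl with Nψ.pair-toggle c'-off μ∈ μ'∈ on-μ on-μ' μ≉μ'
      ...   | only , acyclic = ⊥-elim (Cψ.acyclic-jump (opp t) acyclic (fork-co (fork-sym B.forked))
              (at-dual-side t B.at-⅋) Cψ.free-⊗
              (μ , here refl , Nψ.toggles-left c'-off μ∈ μ'∈ on-μ on-μ' only)
              (μ , here refl , Tψ.leaf-visited μ (opp t) (lk-leafˡ (to (iμ t) (E-at t l))))
              (Nψ.jump-edge (here refl) (there (here refl)) only (to (iμ t) (E-at t l)) nl))

      κ' : Linking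
      κ' = proj₁ (inverse' μ'∈)
      κ'∈ : κ' ∈ θ
      κ'∈ = proj₁ (proj₂ (inverse' μ'∈))
      iκ' : Inverse κ' μ'
      iκ' = inverse-sym (proj₂ (proj₂ (inverse' μ'∈)))

      link' : E κ'
      link' = E-from t (from (iκ' t) link-kept)

      toggled : ¬ Visits κ' t (n ∷ʳ i)
      toggled u = not-opp-i (dual-visits κ'∈ μ'∈ iκ' u)

      -- Keeps later repairs from undoing earlier ones: `κ` visits `m` as well, and the two linkings
      -- of ψ choose alike at its dual, since `c` and `c'` differ at `W` only.
      others-kept : ∀ {s m j} → Beside s m → pos s m ≢ pos t n → ¬ Visits κ s (m ∷ʳ j) → ¬ Visits κ' s (m ∷ʳ j)
      others-kept {s} {m} {j} b' ne nv u
        with OneLinking.visits-one (linking κ∈) s {m} (Beside.at-⊕ b') add-⊕ (Beside.visited b' κ∈ l)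
      ... | d , vd , _ = nv (subst (λ e → Visits κ s (m ∷ʳ e)) d≡j vd)
        where
        V : Pos
        V = pos (opp s) (co m)
        is-with : IsWith (two F') V
        is-with = Tψ.isWith⁺ (opp s) (at-dual-side s (Beside.at-⊕ b'))
        V≢W : V ≢ W
        V≢W e = ne (cong₂ pos (trans (sym (opp-opp s)) (trans (cong opp (pos-side e)) (opp-opp t)))
          (co-injective (cong proj₂ e)))
        d≡j : d ≡ j
        d≡j = trans (sym (opp-opp d)) (trans (cong opp (trans (on-μ V (opp d) is-with (dual-visits κ∈ μ∈ iμ vd))
          (trans (c'-off V V≢W) (sym (on-μ' V (opp j) is-with (dual-visits κ'∈ μ'∈ iκ' u)))))) (opp-opp j))

    module Contradiction (c₀ c₁ : Pos → Dir) (k₀ : Compatible c₀) (k₁ : Compatible c₁)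
      (s₀ : Selects c₀) (n₁ : ¬ Selects c₁) where

      -- The choice `σ` may be forgotten because `not-stuck-both-ways` allows at most one label `i`
      -- at each `n`.
      Labelled : Dir → Path → Dir → Set
      Labelled t n i = ∃[ σ ] (Compatible σ × Stuck σ t n i)

      Avoids : Linking → Pos → Set
      Avoids κ v = ∀ t n i → v ≡ pos t n → Labelled t n i → ¬ Visits κ t (n ∷ʳ i)

      Offends : Linking → Pos → Set
      Offends κ v = ∃[ t ] ∃[ n ] ∃[ i ] (v ≡ pos t n × Labelled t n i × Visits κ t (n ∷ʳ i))

      -- Offending vertices are toggled one by one. Toggling leaves the labelled side, as the label
      -- is unique, and the other vertices beside the link keep their sides.
      avoiding : ∀ vs → ¬ ¬ (∃[ κ ] (κ ∈ θ × E κ × (∀ v → v ∈ vs → Avoids κ v)))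
      avoiding [] k = case s₀ of λ { (κ , κ∈ , _ , l) → k (κ , κ∈ , l , λ _ ()) }
      avoiding (v ∷ vs) k = avoiding vs λ { (κ , κ∈ , l , av) → ¬¬-em (Offends κ v) λ where
        (inj₂ none) → k (κ , κ∈ , l , λ where
          u (here refl) t n i e lab vis → none (t , n , i , e , lab , vis)
          u (there h) → av u h)
        (inj₁ (t , n , i , refl , lab@(σ , kσ , st) , vis)) → repair κ∈ l av t n i σ kσ st vis refl }
        where
        repair : ∀ {κ} → κ ∈ θ → E κ → (∀ u → u ∈ vs → Avoids κ u) → ∀ t n i σ → Compatible σ → Stuck σ t n i →
          Visits κ t (n ∷ʳ i) → v ≡ pos t n → ⊥
        repair κ∈ l av t n i σ kσ st vis refl = k (T.κ' , T.κ'∈ , T.link' , good)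
          where
          module T = Toggle κ∈ l (Stuck.beside st) i vis
          here-avoided : ∀ j → Labelled t n j → ¬ Visits T.κ' t (n ∷ʳ j)
          here-avoided j (σ' , kσ' , st') with j ≟ᴰ i
          ... | yes refl = T.toggled
          ... | no ne with ≢⇒opp (λ e → ne (sym e))
          ... | refl = ⊥-elim (not-stuck-both-ways kσ' st st')
          good : ∀ u → u ∈ v ∷ vs → Avoids T.κ' u
          good u h s m j refl lab@(_ , _ , st') with pos s m ≟Pos pos t n
          ... | no ne = T.others-kept (Stuck.beside st') ne (av _ (in-tail h ne) s m j refl lab)
            where
            in-tail : ∀ {u v} → u ∈ v ∷ vs → u ≢ v → u ∈ vs
            in-tail (here e) ne = ⊥-elim (ne e)
            in-tail (there h) _ = h
          ... | yes e with pos-side {s} {t} e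
          ... | refl with pos-injective {s} e
          ... | refl = here-avoided j lab

      absurd : ⊥
      absurd = avoiding allVertices λ { (κ , κ∈ , l , av) → go κ κ∈ l av }
        where
        go : ∀ κ → κ ∈ θ → E κ → (∀ v → v ∈ allVertices → Avoids κ v) → ⊥
        go κ κ∈ l av = Getting-stuck.getting-stuck σ kσ c₀ c₁ k₀ k₁ s₀ n₁ λ { (t , n , i , st) → finish t n i st }
          where
          -- Taking `σ` from `κ` itself makes `κ` agree with it. At the stuck vertex, side `i` is
          -- then excluded by avoidance and side `opp i` by `one-sided`.
          σ : Pos → Dir
          σ = choiceOf (linking κ∈)
          kσ : Compatible σ
          kσ = choiceOf-compatible κ∈ l
          finish : ∀ t n i → Stuck σ t n i → ⊥
          finish t n i st
            with OneLinking.visits-one (linking κ∈) t {n} (Beside.at-⊕ (Stuck.beside st)) add-⊕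
                   (Beside.visited (Stuck.beside st) κ∈ l)
          ... | d , vd , _ with d ≟ᴰ i
          ...   | yes refl = av _ (vertex-∈ t (Beside.at-⊕ (Stuck.beside st))) t n i refl (σ , kσ , st) vd
          ...   | no ne with ≢⇒opp (λ e → ne (sym e))
          ...     | refl = Stuck.one-sided st κ∈ (λ w d _ iw r → on-choiceOf (linking κ∈) w d iw r) l vd

  -- Were the link lost at `c`, the choices of `κ` and `c` would be the two inputs of
  -- `Contradiction`. Decidability of `Selects c` allows the list of invariant vertices to exist
  -- only under a double negation.
  select-all : ∀ {κ} → κ ∈ θ → E κ → ∀ c → Compatible c → Selects c
  select-all {κ} κ∈ l c k with selects? c
  ... | yes s = s
  ... | no n = ⊥-elim (¬¬-filter Invariant allVertices λ { (Is , e) → go Is e })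
    where
    with-∈ : ∀ {w} → IsWith (two F) w → w ∈ allVertices
    with-∈ {w} iw with isWith⁻ {w} iw
    ... | t , n , refl , a = vertex-∈ t a
    go : ∀ Is → (∀ w → w ∈ Is ⇔ (w ∈ allVertices × Invariant w)) → ⊥
    go Is e = Argument.Contradiction.absurd Is (λ h → proj₂ (to (e _) h)) (λ iw inv → from (e _) (with-∈ iw , inv))
      (choiceOf (linking κ∈)) c (choiceOf-compatible κ∈ l) k (κ , κ∈ , on-choiceOf (linking κ∈) , l) n

-- Two links in one linking

follows-first : ∀ {F} p p' → Leaf F p → Follows F (dirTo p p') p
follows-first p p' l = follows l λ o _ _ → dirTo-first p p' o

follows-second : ∀ {F} p p' → Leaf F p' → (∀ {z k} → Fork z p p' → At F z k → ¬ Additive k) → Follows F (dirTo p p') p'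
follows-second p p' l n = follows l λ o a h → dirTo-second p p' o (λ f → n f a h)

-- The two choice functions differ at most where `a` and `a'` separate, so `v` and `v'` can separate
-- additively only there, with `v` on the side of `a`.
choices-apart : ∀ {F a a' v v' k} → Meet F ⊕ₖ a a' → Follows F (dirTo a a') v → Follows F (dirTo a' a) v' →
  Meet F k v v' → Additive k → Meet F ⊕ₖ v a'
choices-apart {F} {a} {a'} {v} {v'} (meet z f at-z) fv fv' (meet z₁ g at-g) add with fork-onPath g | fork-onPath f
... | e , o , o' | d , oa , oa' with z₁ ≟ᴾ z
... | no ne = ⊥-elim (opp-≢ e (trans (sym (chosen fv' o' at-g add)) (trans
        (sym (dirTo-swap a a' z₁ (λ h → ne (fork-functional h f)))) (chosen fv o at-g add))))
... | yes refl = meet z (onPath-fork o oa' (λ eq → opp-≢ d (trans (sym eq) e≡d))) at-z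
  where
  e≡d : e ≡ d
  e≡d = trans (sym (chosen fv o at-z add-⊕)) (dirTo-first a a' oa)

third-kind : ∀ {l j k} → Multiplicative l → Additive j → Additive k → l ≡ j ⊎ l ≡ k ⊎ j ≡ k → j ≡ k
third-kind m j k (inj₁ refl) = ⊥-elim (mul-not-add m j)
third-kind m j k (inj₂ (inj₁ refl)) = ⊥-elim (mul-not-add m k)
third-kind m j k (inj₂ (inj₂ e)) = e

ends : Path → Path → Dir → Path
ends p q L = p
ends p q R = q

-- The exceptional case k = & in θ is a ⊕ in ψ, so that the two nets together leave no exception.
Separated : (Dir → Formula) → Net → Set
Separated F θ = ∀ t {κ κ' a b b' k} → κ ∈ θ → κ' ∈ θ → Lk κ (pos t a) (pos (opp t) b) →
  Lk κ' (pos t a) (pos (opp t) b') → Meet (F (opp t)) k b b' → k ≢ &ₖ → ⊥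

module Separation (P : InversePair) (dist : ∀ t → Distributed (InversePair.F P t)) where

  open InversePair P
  open TwoSided F
  open NetFacts net

  -- Unless two ends separate at a &, the resolution leading to the first ends and otherwise to the
  -- second ones is compatible with both links; by (P1) its linking contains them both.
  common-linking : ∀ {κ κ'} x x' → (∀ t {z} → Fork z (x t) (x' t) → ¬ At (F t) z &ₖ) → κ ∈ θ → κ' ∈ θ →
    Lk κ (pos L (x L)) (pos R (x R)) → Lk κ' (pos L (x' L)) (pos R (x' R)) →
    ∃[ ξ ] (ξ ∈ θ × Lk ξ (pos L (x L)) (pos R (x R)) × Lk ξ (pos L (x' L)) (pos R (x' R)))
  common-linking x x' nf κ∈ κ'∈ l l'
    with FixedLink.select-all P dist x κ∈ l c kx | FixedLink.select-all P dist x' κ'∈ l' c kx'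
    where
    c : Pos → Dir
    c (concl 0 , q) = dirTo (x L) (x' L) q
    c (concl 1 , q) = dirTo (x R) (x' R) q
    c _ = L
    kx : FixedLink.Compatible P dist x c
    kx L o a = dirTo-first (x L) (x' L) o
    kx R o a = dirTo-first (x R) (x' R) o
    kx' : FixedLink.Compatible P dist x' c
    kx' L o a = dirTo-second (x L) (x' L) o (λ f → nf L f a)
    kx' R o a = dirTo-second (x R) (x' R) o (λ f → nf R f a)
  ... | ξ , ξ∈ , o , m | ξ' , ξ'∈ , o' , m' = ξ , ξ∈ , m , lk-resp-≈ (on-unique ξ'∈ ξ∈ o' o) m'

  -- Otherwise a single linking would contain both links, and the leaf `a` would have two partners
  -- in it.
  separated : Separated F θ
  separated t {κ} {κ'} {a} {b} {b'} {k} κ∈ κ'∈ l l' (meet z f at-z) k≢& = go t κ∈ κ'∈ l l' f at-z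
    where
    clash : ∀ {t} → Fork z b b' → At (F t) z k → ∀ {z'} → Fork z' b b' → ¬ At (F t) z' &ₖ
    clash f a f' a' with fork-functional f f'
    ... | refl = k≢& (At-functional a a')
    go : ∀ t {κ κ'} → κ ∈ θ → κ' ∈ θ → Lk κ (pos t a) (pos (opp t) b) →
      Lk κ' (pos t a) (pos (opp t) b') → Fork z b b' → At (F (opp t)) z k → ⊥
    go L κ∈ κ'∈ l l' f at-z with common-linking (ends a b) (ends a b')
      (λ { L f' _ → fork-irrefl f' ; R f' → clash {R} f at-z f' }) κ∈ κ'∈ l l'
    ... | ξ , ξ∈ , m , m' with lk-functional (OneLinking.unique-leaves (linking ξ∈)) m m'
    ... | refl = fork-irrefl f
    go R κ∈ κ'∈ l l' f at-z with common-linking (ends b a) (ends b' a)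
      (λ { R f' _ → fork-irrefl f' ; L f' → clash {L} f at-z f' }) κ∈ κ'∈ (lk-sym l) (lk-sym l')
    ... | ξ , ξ∈ , m , m' with lk-functional (OneLinking.unique-leaves (linking ξ∈)) (lk-sym m) (lk-sym m')
    ... | refl = fork-irrefl f

-- The leaf bijection of an inverse pair

module LeafBijection (P : InversePair) (sθ : Separated (InversePair.F P) (InversePair.θ P))
  (sψ : Separated (InversePair.F' P) (InversePair.ψ P)) (choices : RealisesChoices (InversePair.F P) (InversePair.θ P)) where

  open InversePair P
  open TwoSided F
  open NetFacts net
  open Pair P using (meet-dual')

  Linked : Dir → Path → Path → Set
  Linked t a b = ∃[ κ ] (κ ∈ θ × Lk κ (pos t a) (pos (opp t) b))

  linked-flip : ∀ t {a b} → Linked t a b → Linked (opp t) b a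
  linked-flip t {a} {b} (κ , h , l) = κ , h , subst (λ s → Lk κ (pos (opp t) b) (pos s a)) (sym (opp-opp t)) (lk-sym l)

  linked-leaf : ∀ t {a b} → Linked t a b → Leaf (F t) a
  linked-leaf t (κ , h , l) = OneLinking.leaf-of (linking h) t (lk-leafˡ l)

  linked-unique : ∀ t {a b b'} → Linked t a b → Linked t a b' → b ≡ b'
  linked-unique t {a} {b} {b'} p@(κ , h , l) p'@(κ' , h' , l')
    with leaf-compare (linked-leaf (opp t) (linked-flip t p)) (linked-leaf (opp t) (linked-flip t p'))
  ... | inj₁ e = e
  ... | inj₂ (k , m) with &ₖ? k
  ...   | no ne = ⊥-elim (sθ t h h' l l' m ne)
  ...   | yes refl with inverse h | inverse h'
  ...     | μ , μ∈ , i | μ' , μ'∈ , i' = ⊥-elim (sψ (opp t) μ∈ μ'∈ (transport i l) (transport i' l')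
              (subst (λ s → Meet (F' s) ⊕ₖ (co b) (co b')) (sym (opp-opp t)) (meet-dual' t m)) λ ())
    where
    transport : ∀ {κ μ b} → Inverse κ μ → Lk κ (pos t a) (pos (opp t) b) → Lk μ (pos (opp t) (co a)) (pos (opp (opp t)) (co b))
    transport {μ = μ} {b} i l = subst (λ s → Lk μ (pos (opp t) (co a)) (pos s (co b))) (sym (opp-opp t)) (to (i t) l)

  linked-injective : ∀ t {a a' b} → Linked t a b → Linked t a' b → a ≡ a'
  linked-injective t p p' = linked-unique (opp t) (linked-flip t p) (linked-flip t p')

  the-link : ∀ t {κ a b} → κ ∈ θ → Linked t a b → pos t a ∈ leaves κ → Lk κ (pos t a) (pos (opp t) b)
  the-link t {κ} {a} h p m with partner t h m
  ... | b' , l = subst (λ q → Lk κ (pos t a) (pos (opp t) q)) (linked-unique t (κ , h , l) p) l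

  leaf-linked' : ∀ t {a} → Leaf (F t) a → ∃[ b ] Linked t a b
  leaf-linked' t {a} l with choices t (dirTo a a)
  ... | κ , κ∈ , e with partner t κ∈ (from (e a) (follows-first a a l))
  ... | b , m = b , κ , κ∈ , m

  together : ∀ t {k a a' b b'} → Meet (F t) k a a' → Multiplicative k → Linked t a b → Linked t a' b' →
    ∃[ κ ] (κ ∈ θ × Lk κ (pos t a) (pos (opp t) b) × Lk κ (pos t a') (pos (opp t) b'))
  together t {a = a} {a'} (meet z f at-z) m p p' with choices t (dirTo a a')
  ... | κ , κ∈ , e = κ , κ∈ ,
    the-link t κ∈ p (from (e a) (follows-first a a' (linked-leaf t p))) ,
    the-link t κ∈ p' (from (e a') (follows-second a a' (linked-leaf t p') not-additive))
    where
    not-additive : ∀ {z' k} → Fork z' a a' → At (F t) z' k → ¬ Additive k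
    not-additive f' a'' h with fork-functional f f'
    ... | refl with At-functional at-z a''
    ... | refl = mul-not-add m h

  multiplicative-preserved : ∀ t {k k' a a' b b'} → Meet (F t) k a a' → Multiplicative k → Linked t a b → Linked t a' b' →
    Meet (F (opp t)) k' b b' → Multiplicative k'
  multiplicative-preserved t {k' = k'} m mul p p' m' with together t m mul p p' | polarity k'
  ... | κ , κ∈ , l , l' | inj₂ h = h
  ... | κ , κ∈ , l , l' | inj₁ h = ⊥-elim (no-additive-meet (opp t) κ∈ m' h (lk-leafʳ l) (lk-leafʳ l'))

  multiplicative-reflected : ∀ t {k k' a a' b b'} → Meet (F (opp t)) k' b b' → Multiplicative k' → Linked t a b → Linked t a' b' →
    Meet (F t) k a a' → Multiplicative k
  multiplicative-reflected t {k} {a = a} {a'} m mul p p' m' = multiplicative-preserved (opp t) m mul (linked-flip t p) (linked-flip t p')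
    (subst (λ s → Meet (F s) k a a') (sym (opp-opp t)) m')

  same-linking : ∀ t {κ c d k} → κ ∈ θ → pos t c ∈ leaves κ → pos t d ∈ leaves κ → Meet (F t) k c d → Multiplicative k
  same-linking t {k = k} h x y m with polarity k
  ... | inj₁ add = ⊥-elim (no-additive-meet t h m add x y)
  ... | inj₂ mul = mul

  -- Four leaves b, u of κ and b', u' of κ': the triangle property would make the pair u, b' both a ⊕ and a &.
  module FourLeaves (t : Dir) {a a' b b' u u' v v' : Path} {κ κ' : Linking} (p : Linked t a b) (p' : Linked t a' b')
    (m' : Meet (F (opp t)) ⊕ₖ b b') (κ∈ : κ ∈ θ) (κ'∈ : κ' ∈ θ)
    (b∈ : pos (opp t) b ∈ leaves κ) (b'∈ : pos (opp t) b' ∈ leaves κ')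
    (u∈ : pos (opp t) u ∈ leaves κ) (u'∈ : pos (opp t) u' ∈ leaves κ')
    (mu : Meet (F (opp t)) &ₖ u u') (pv : Linked t v u) (pv' : Linked t v' u')
    (apart' : ∀ {k} → Meet (F t) k v v' → Additive k → Meet (F t) ⊕ₖ v a') where

    leaf-of-linking : ∀ {ξ w} → ξ ∈ θ → pos (opp t) w ∈ leaves ξ → Leaf (F (opp t)) w
    leaf-of-linking h = OneLinking.leaf-of (linking h) (opp t)

    ⊕-kind : ∀ {k} → Meet (F (opp t)) k u b' → Additive k → ⊕ₖ ≡ k
    ⊕-kind mk add with leaf-compare (leaf-of-linking κ∈ u∈) (leaf-of-linking κ∈ b∈)
    ... | inj₁ refl = meet-functional m' mk
    ... | inj₂ (l , ml) = third-kind (same-linking (opp t) κ∈ u∈ b∈ ml) add-⊕ add (triangle ml m' mk)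

    &-kind : ∀ {k} → Meet (F (opp t)) k u b' → Additive k → &ₖ ≡ k
    &-kind mk add with leaf-compare (leaf-of-linking κ'∈ b'∈) (leaf-of-linking κ'∈ u'∈)
    ... | inj₁ refl = meet-functional mu mk
    ... | inj₂ (l , ml) = sym (third-kind (same-linking (opp t) κ'∈ b'∈ u'∈ ml) add add-& (triangle' (triangle mk ml mu)))
      where
      triangle' : ∀ {j l k : Kind} → j ≡ l ⊎ j ≡ k ⊎ l ≡ k → l ≡ j ⊎ l ≡ k ⊎ j ≡ k
      triangle' (inj₁ e) = inj₁ (sym e)
      triangle' (inj₂ (inj₁ e)) = inj₂ (inj₂ e)
      triangle' (inj₂ (inj₂ e)) = inj₂ (inj₁ e)

    u-b'-multiplicative : ∀ {k} → Meet (F (opp t)) k u b' → ¬ Additive k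
    u-b'-multiplicative mk add with trans (⊕-kind mk add) (sym (&-kind mk add))
    ... | ()

    -- The partners `u` and `b'` coincide or separate multiplicatively. The first would identify `v`
    -- with `a'`, and the second makes `v` and `a'` separate multiplicatively too.
    v-a'-not-⊕ : ¬ Meet (F t) ⊕ₖ v a'
    v-a'-not-⊕ mva@(meet _ g _) with leaf-compare (leaf-of-linking κ∈ u∈) (leaf-of-linking κ'∈ b'∈)
    ... | inj₁ refl = fork-irrefl (subst (Fork _ v) (linked-injective t p' pv) g)
    ... | inj₂ (k , mk) with polarity k
    ...   | inj₁ add = u-b'-multiplicative mk add
    ...   | inj₂ mul = mul-not-add (multiplicative-reflected t mk mul pv p' mva) add-⊕

    impossible : ⊥
    impossible with leaf-compare (linked-leaf t pv) (linked-leaf t pv')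
    ... | inj₁ refl = case mu of λ { (meet _ g _) → fork-irrefl (subst (λ w → Fork _ w u') (linked-unique t pv pv') g) }
    ... | inj₂ (k , mk) with polarity k
    ...   | inj₁ add = v-a'-not-⊕ (apart' mk add)
    ...   | inj₂ mul = mul-not-add (multiplicative-preserved t mk mul pv pv' mu) add-&

  leaf-partner : ∀ {t κ u} → κ ∈ θ → pos (opp t) u ∈ leaves κ → ∃[ v ] Linked t v u
  leaf-partner {t} {κ} {u} h m with partner (opp t) h m
  ... | v , l = v , κ , h , lk-sym (subst (λ s → Lk κ (pos (opp t) u) (pos s v)) (opp-opp t) l)

  the-link' : ∀ {t κ v u} → κ ∈ θ → Linked t v u → pos (opp t) u ∈ leaves κ → Lk κ (pos (opp t) u) (pos t v)
  the-link' {t} {κ} {v} {u} h p m = subst (λ s → Lk κ (pos (opp t) u) (pos s v)) (opp-opp t)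
    (the-link (opp t) h (linked-flip t p) m)

  -- If a, a' and their partners were both separated by a ⊕, the two linkings choosing a and a', and otherwise
  -- the same premises, would lie on a common &-resolution.
  module PlusSquare (t : Dir) {a a' b b'} (m : Meet (F t) ⊕ₖ a a') (m' : Meet (F (opp t)) ⊕ₖ b b')
    (p : Linked t a b) (p' : Linked t a' b') where

    f f' : Path → Dir
    f = dirTo a a'
    f' = dirTo a' a

    κ κ' : Linking
    κ = proj₁ (choices t f)
    κ' = proj₁ (choices t f')

    κ∈ : κ ∈ θ
    κ∈ = proj₁ (proj₂ (choices t f))
    κ'∈ : κ' ∈ θ
    κ'∈ = proj₁ (proj₂ (choices t f'))

    κ-leaves : ∀ q → pos t q ∈ leaves κ ⇔ Follows (F t) f q
    κ-leaves = proj₂ (proj₂ (choices t f))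
    κ'-leaves : ∀ q → pos t q ∈ leaves κ' ⇔ Follows (F t) f' q
    κ'-leaves = proj₂ (proj₂ (choices t f'))

    a∈κ : pos t a ∈ leaves κ
    a∈κ = from (κ-leaves a) (follows-first a a' (linked-leaf t p))
    a'∈κ' : pos t a' ∈ leaves κ'
    a'∈κ' = from (κ'-leaves a') (follows-first a' a (linked-leaf t p'))

    b∈κ : pos (opp t) b ∈ leaves κ
    b∈κ = lk-leafʳ (the-link t κ∈ p a∈κ)
    b'∈κ' : pos (opp t) b' ∈ leaves κ'
    b'∈κ' = lk-leafʳ (the-link t κ'∈ p' a'∈κ')

    same-choice : ∀ {q} → ¬ At (F t) q ⊕ₖ → f q ≡ f' q
    same-choice {q} n = dirTo-swap a a' q λ h → case m of λ { (meet z f₁ at-z) →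
      n (subst (λ q → At (F t) q ⊕ₖ) (fork-functional f₁ h) at-z) }

    follow-apart : ∀ {v v' k} → Follows (F t) f v → Follows (F t) f' v' → Meet (F t) k v v' → Additive k → Meet (F t) ⊕ₖ v a'
    follow-apart = choices-apart m

    conflict : ∀ {u u'} → pos (opp t) u ∈ leaves κ → pos (opp t) u' ∈ leaves κ' → ¬ Meet (F (opp t)) &ₖ u u'
    conflict {u} {u'} u∈ u'∈ mu = FourLeaves.impossible t p p' m' κ∈ κ'∈ b∈κ b'∈κ' u∈ u'∈ mu
      (proj₂ pv) (proj₂ pv') (follow-apart v∈κ v'∈κ')
      where
      pv : ∃[ v ] Linked t v u
      pv = leaf-partner κ∈ u∈
      pv' : ∃[ v ] Linked t v u'
      pv' = leaf-partner κ'∈ u'∈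
      v∈κ : Follows (F t) f (proj₁ pv)
      v∈κ = to (κ-leaves _) (lk-leafʳ (the-link' κ∈ (proj₂ pv) u∈))
      v'∈κ' : Follows (F t) f' (proj₁ pv')
      v'∈κ' = to (κ'-leaves _) (lk-leafʳ (the-link' κ'∈ (proj₂ pv') u'∈))

    -- A &-resolution for both linkings. On side `t` their choices agree at every &, since `f` and
    -- `f'` differ only at a ⊕. On the other side `κ` takes precedence where it visits, and
    -- `conflict` shows that `κ'` does not disagree there.
    c : Pos → Dir
    c v with proj₁ v ≟R concl (con t) | res? κ v
    ... | yes _ | _ = f (proj₂ v)
    ... | no _ | yes _ = choiceOf (linking κ∈) v
    ... | no _ | no _ = choiceOf (linking κ'∈) v

    side-t : ∀ {ξ g q d} → (∀ q → pos t q ∈ leaves ξ ⇔ Follows (F t) g q) → At (F t) q &ₖ → Visits ξ t (q ∷ʳ d) → g q ≡ d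
    side-t {ξ} {g} {q} {d} e a v with visits-elim {ξ} {t} v
    ... | s , h = chosen (to (e _) h) (s , ∷ʳ-++ q d s) a add-&

    on-κ : On c κ
    on-κ W d w r with isWith⁻ {W} w
    ... | s , q , refl , at-q with concl (con s) ≟R concl (con t) | res? κ (pos s q)
    ...   | yes e | _ with pos-side {s} {t} {q} {q} (cong (_, q) e)
    ...     | refl = sym (side-t {κ} {f} κ-leaves at-q r)
    on-κ W d w r | s , q , refl , at-q | no _ | yes _ = on-choiceOf (linking κ∈) W d w r
    on-κ W d w r | s , q , refl , at-q | no _ | no nv = ⊥-elim (nv (visits-prefix {κ} {s} (d ∷ []) r))

    on-κ' : On c κ'
    on-κ' W d w r with isWith⁻ {W} w
    ... | s , q , refl , at-q with concl (con s) ≟R concl (con t) | res? κ (pos s q)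
    ...   | yes e | _ with pos-side {s} {t} {q} {q} (cong (_, q) e)
    ...     | refl = sym (trans (same-choice (λ a⊕ → case At-functional at-q a⊕ of λ ())) (side-t {κ'} {f'} κ'-leaves at-q r))
    on-κ' W d w r | s , q , refl , at-q | no _ | no _ = on-choiceOf (linking κ'∈) W d w r
    on-κ' W d w r | s , q , refl , at-q | no ne | yes v with ≢⇒opp {t} {s} (λ e → ne (cong (concl ∘ con) (sym e)))
    ... | refl with d ≟ᴰ choiceOf (linking κ∈) (pos (opp t) q)
    ...   | yes e = e
    ...   | no d≢ with visits-elim {κ} {opp t} (OneLinking.choice-visits (linking κ∈) (opp t) {q} at-q add-& v)
                     | visits-elim {κ'} {opp t} r
    ...     | s₁ , h₁ | s₂ , h₂ = ⊥-elim (conflict h₁ h₂ (meet q (onPath-fork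
                (s₁ , ∷ʳ-++ q _ s₁) (s₂ , ∷ʳ-++ q d s₂)
                (λ e → d≢ (trans (sym e) (sym (choiceOf-pos (linking κ∈) (opp t) q))))) at-q))

    absurd : ⊥
    absurd = no-additive-meet t κ∈ m add-⊕ a∈κ
      (lk-leafˡ (lk-resp-≈ (on-unique κ'∈ κ∈ on-κ' on-κ) (proj₂ (leaf-linked a'∈κ'))))

-- Duality of the separating connectives and the theorem

distributed-neg : ∀ {A} → Distributed A → Distributed (neg A)
distributed-neg {A} D p G e u = D (co p) (neg G)
  (trans (cong (λ H → subAt H (co p)) (sym (neg-neg A))) (subAt-neg (neg A) p e)) (undistributed-neg u)
  where
  undistributed-neg : ∀ {G} → Undistributed G → Undistributed (neg G)
  undistributed-neg (⊗⊕ A B C) = &⅋ _ _ _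
  undistributed-neg (⊕⊗ A B C) = ⅋& _ _ _
  undistributed-neg (&⅋ A B C) = ⊗⊕ _ _ _
  undistributed-neg (⅋& A B C) = ⊕⊗ _ _ _

dualₖ-dualₖ : ∀ k → dualₖ (dualₖ k) ≡ k
dualₖ-dualₖ ⊗ₖ = refl
dualₖ-dualₖ ⅋ₖ = refl
dualₖ-dualₖ &ₖ = refl
dualₖ-dualₖ ⊕ₖ = refl

module Isomorphism (A B : Formula) (dA : Distributed A) (dB : Distributed B) (θ ψ : Net)
  (pnθ : IsProofNet (two (sides (neg A) B)) θ) (pnψ : IsProofNet (two (sides (neg B) A)) ψ)
  (red₁ : ReducesTo (composeSeq (neg A) B A , composeNet θ ψ) (cutFree (neg A ∷ A ∷ []) , idNet A))
  (red₂ : ReducesTo (composeSeq (neg B) A B , composeNet ψ θ) (cutFree (neg B ∷ B ∷ []) , idNet B)) where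

  F F' : Dir → Formula
  F = sides (neg A) B
  F' = sides (neg B) A

  nF : ∀ t → F' (opp t) ≡ neg (F t)
  nF L = sym (neg-neg A)
  nF R = refl
  nF' : ∀ t → F' t ≡ neg (F (opp t))
  nF' L = refl
  nF' R = sym (neg-neg A)
  mF : ∀ t → F (opp t) ≡ neg (F' t)
  mF L = sym (neg-neg B)
  mF R = refl
  mF' : ∀ t → F t ≡ neg (F' (opp t))
  mF' L = refl
  mF' R = sym (neg-neg B)

  dF : ∀ t → Distributed (F t)
  dF L = distributed-neg dA
  dF R = dB
  dF' : ∀ t → Distributed (F' t)
  dF' L = distributed-neg dB
  dF' R = dA

  lθ : LinkingsOf F θ
  lθ = proj₁ pnθ _
  lψ : LinkingsOf F' ψ
  lψ = proj₁ pnψ _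

  bipartite-θ : Bipartite θ
  bipartite-θ = Matching.bipartite A B θ ψ lθ lψ red₁ red₂
  bipartite-ψ : Bipartite ψ
  bipartite-ψ = Matching.bipartite B A ψ θ lψ lθ red₂ red₁

  iθ : Inverses θ ψ
  iθ = Matching.inverses A B θ ψ lθ lψ red₁ red₂ bipartite-ψ
  iψ : Inverses ψ θ
  iψ = Matching.inverses B A ψ θ lψ lθ red₂ red₁ bipartite-θ

  Nθ Nψ : BipartiteNet
  Nθ = record { F = F ; θ = θ ; pn = pnθ ; bip = bipartite-θ }
  Nψ = record { F = F' ; θ = ψ ; pn = pnψ ; bip = bipartite-ψ }

  P P' : InversePair
  P = record { net = Nθ ; net' = Nψ ; nF = nF ; nF' = nF' ; inverse = iθ ; inverse' = iψ }
  P' = record { net = Nψ ; net' = Nθ ; nF = mF ; nF' = mF' ; inverse = iψ ; inverse' = iθ }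

  sθ : Separated F θ
  sθ = Separation.separated P dF
  sψ : Separated F' ψ
  sψ = Separation.separated P' dF'

  choicesθ : RealisesChoices F θ
  choicesθ = Matching.realises-choices A B θ ψ lθ lψ red₁ red₂
  choicesψ : RealisesChoices F' ψ
  choicesψ = Matching.realises-choices B A ψ θ lψ lθ red₂ red₁

  module Bθ = LeafBijection P sθ sψ choicesθ
  module Bψ = LeafBijection P' sψ sθ choicesψ

  linked-dual : ∀ t {a b} → Bθ.Linked t a b → Bψ.Linked (opp t) (co a) (co b)
  linked-dual t {a} {b} (κ , h , l) with iθ h
  ... | μ , μ∈ , i = μ , μ∈ , subst (λ s → Lk μ (pos (opp t) (co a)) (pos s (co b))) (sym (opp-opp t)) (to (i t) l)

  opposite-kinds : ∀ {k k' a a' b b'} → Bθ.Linked L a b → Bθ.Linked L a' b' →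
    Meet (neg A) k a a' → Meet B k' b b' → k' ≡ dualₖ k
  opposite-kinds {⅋ₖ} p p' m m' with Bθ.together L m mul-⅋ p p'
  ... | κ , κ∈ , l , l' = meet-functional m' (Pair.facing P L κ∈ l l' m)
  opposite-kinds {⊗ₖ} {k'} p p' m m' with Bθ.together L m mul-⊗ p p' | Bθ.multiplicative-preserved L m mul-⊗ p p' m'
  ... | κ , κ∈ , l , l' | mul-⅋ = refl
  ... | κ , κ∈ , l , l' | mul-⊗ = ⊥-elim (NetFacts.tensor-square Nθ L κ∈ l l' m m')
  opposite-kinds {&ₖ} {k'} p p' m m' with k'
  ... | ⊕ₖ = refl
  -- Two & facing each other in θ are two ⊕ facing each other in ψ, where `PlusSquare` excludes
  -- them.
  ... | &ₖ = ⊥-elim (Bψ.PlusSquare.absurd R (Pair.meet-dual P L m) (Pair.meet-dual P R m') (linked-dual L p) (linked-dual L p'))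
  ... | ⊗ₖ = ⊥-elim (mul-not-add (Bθ.multiplicative-reflected L m' mul-⊗ p p' m) add-&)
  ... | ⅋ₖ = ⊥-elim (mul-not-add (Bθ.multiplicative-reflected L m' mul-⅋ p p' m) add-&)
  opposite-kinds {⊕ₖ} {k'} p p' m m' with k'
  ... | &ₖ = refl
  ... | ⊕ₖ = ⊥-elim (Bθ.PlusSquare.absurd L m m' p p')
  ... | ⊗ₖ = ⊥-elim (mul-not-add (Bθ.multiplicative-reflected L m' mul-⊗ p p' m) add-⊕)
  ... | ⅋ₖ = ⊥-elim (mul-not-add (Bθ.multiplicative-reflected L m' mul-⅋ p p' m) add-⊕)

  -- Paths of A^⊥ are paths of A with all directions reversed.
  leafIso : LeafIso A B (λ a b → Bθ.Linked L (co a) b)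
  leafIso = record
    { leafˡ = λ {a} p → subst (Leaf A) (co-co a) (leaf-neg⁻ (Bθ.linked-leaf L p))
    ; leafʳ = λ p → Bθ.linked-leaf R (Bθ.linked-flip L p)
    ; totalˡ = λ l → Bθ.leaf-linked' L (Leaf-neg l)
    ; totalʳ = λ l → case Bθ.leaf-linked' R l of λ { (a , p) →
        co a , subst (λ q → Bθ.Linked L q _) (sym (co-co a)) (Bθ.linked-flip R p) }
    ; injective = λ p p' → co-injective (Bθ.linked-injective L p p')
    ; labels = labels
    ; colours = λ {_} {_} {_} {_} {k} p p' m m' →
        sym (trans (opposite-kinds p p' (meet-neg m) m') (dualₖ-dualₖ k))
    ; functional = Bθ.linked-unique L }
    where
    labels : ∀ {a b} → Bθ.Linked L (co a) b → subAt A a ≡ subAt B b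
    labels {a} {b} (κ , h , l) with TwoSided.OneLinking.link-labels F (lθ h) L R l
    ... | X , _ , e , e' = trans
      (trans (cong₂ subAt (sym (neg-neg A)) (sym (co-co a))) (subAt-neg (neg A) (co a) e)) (sym e')

theorem8p35 : (A B : Formula) → Distributed A → Distributed B →
    (θ ψ : Net) →
    IsProofNet (cutFree (neg A ∷ B ∷ [])) θ →
    IsProofNet (cutFree (neg B ∷ A ∷ [])) ψ →
    ReducesTo (composeSeq (neg A) B A , composeNet θ ψ) (cutFree (neg A ∷ A ∷ []) , idNet A) →
    ReducesTo (composeSeq (neg B) A B , composeNet ψ θ) (cutFree (neg B ∷ B ∷ []) , idNet B) →
    A =AC B
theorem8p35 A B dA dB θ ψ pnθ pnψ red₁ red₂ =
  leafIso⇒AC (Isomorphism.leafIso A B dA dB θ ψ pnθ pnψ red₁ red₂)
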